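{- If $G$ is a planar graph with maximum degree $\Delta\ge 32$ that contains neither $4$-cycles nor $5$-cycles, then $\chi_{\ell}(G^2)\le \Delta+3$. In fact, this bound holds also for paintability: $\chi_p(G^2)\le \Delta+3$.
   Context: Graphs are finite and simple. "Contains no $k$-cycle" means there is no cycle of length $k$ as a (not necessarily induced) subgraph. The square $G^2$ of a graph $G$ is formed from $G$ by adding an edge between each pair of vertices at distance two in $G$. A list assignment $L$ assigns to each vertex $v$ a set $L(v)$ of allowable colors. An $L$-coloring is a proper coloring $f$ with $f(v)\in L(v)$ for every vertex $v$. A graph is $k$-choosable if it has an $L$-coloring whenever $|L(v)|=k$ for every vertex $v$. The list chromatic number $\chi_\ell$ of a graph is the least $k$ such that it is $k$-choosable. The game of $k$-paintability (online list $k$-coloring) on a graph is played by two players, Lister and Painter. In each round $i$, Lister presents to Painter some nonempty set of uncolored vertices. Painter chooses an independent subset of the presented vertices to receive color $i$ (these vertices are then colored). If Lister lists some particular vertex $k$ times and Painter never paints it, then Lister wins; otherwise Painter wins. A graph is $k$-paintable if Painter has a winning strategy, and the paint number $\chi_p$ of a graph is the least $k$ such that it is $k$-paintable. -}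

module Defs where

open import Data.Bool using (if_then_else_)
open import Data.Fin using (Fin; toℕ; _<?_)
open import Data.Fin.Properties using (_≟_; any?)
open import Data.Fin.Subset using (Subset; ⊤; _─_; Nonempty)
  renaming (_∈_ to _∈ₛ_; _⊆_ to _⊆ₛ_)
open import Data.List using (List; length; map; filter; allFin; cartesianProduct)
open import Data.List.Extrema.Nat using (max)
open import Data.List.Membership.Propositional using (_∈_)
open import Data.List.Relation.Unary.Unique.Propositional using (Unique)
open import Data.Nat using (ℕ; suc; _+_; _*_; _≤_; _<_; _%_; NonZero)
import Data.Nat as ℕ
open import Data.Product using (_×_; _,_; Σ; Σ-syntax; ∃-syntax; proj₁; proj₂)
open import Data.Sum using (_⊎_; inj₁; inj₂)
open import Data.Vec using (lookup)
open import Function.Bundles using (_⇔_)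
open import Function.Definitions using (Injective; StrictlySurjective)
open import Level using (0ℓ)
open import Relation.Binary using (Rel; Symmetric; Irreflexive; Decidable)
open import Relation.Binary.Construct.Closure.ReflexiveTransitive using (Star)
open import Relation.Binary.PropositionalEquality
  using (_≡_; _≢_; refl; sym)
open import Relation.Nullary using (¬_; ¬?; _×-dec_; _⊎-dec_)

Least : (ℕ → Set) → ℕ → Set
Least P k = P k × (∀ j → P j → k ≤ j)

-- When R is an equivalence relation: R has exactly k classes.
ClassCount : {A : Set} → Rel A 0ℓ → ℕ → Set
ClassCount {A} R k =
  Σ[ class ∈ (A → Fin k) ]
    StrictlySurjective _≡_ class × (∀ x y → R x y ⇔ class x ≡ class y)

record Graph (n : ℕ) : Set₁ where
  infix 4 _~_ _~?_
  field
    _~_      : Rel (Fin n) 0ℓ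
    _~?_     : Decidable _~_
    ~-sym    : Symmetric _~_
    ~-irrefl : Irreflexive _≡_ _~_

module _ {n : ℕ} (G : Graph n) where
  open Graph G

  degree : Fin n → ℕ
  degree v = length (filter (v ~?_) (allFin n))

  Δ : ℕ
  Δ = max 0 (map degree (allFin n))

  edges : List (Fin n × Fin n)
  edges = filter (λ (u , v) → (u <? v) ×-dec (u ~? v))
                 (cartesianProduct (allFin n) (allFin n))

  isolated : List (Fin n)
  isolated = filter (λ v → degree v ℕ.≟ 0) (allFin n)

  record Cycle (k : ℕ) .{{_ : NonZero k}} : Set where
    field
      3≤k       : 3 ≤ k
      vertex    : Fin k → Fin n
      injective : Injective _≡_ _≡_ vertex
      adjacent  : ∀ i j → toℕ j ≡ suc (toℕ i) % k → vertex i ~ vertex j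

  Connected : Rel (Fin n) 0ℓ
  Connected = Star _~_

  Dart : Set
  Dart = Σ[ (u , v) ∈ Fin n × Fin n ] u ~ v

  -- A cyclic order of the neighbours of each vertex: next v u is the neighbour
  -- of v that follows u (irrelevant if u is not a neighbour of v).  By
  -- finiteness, `cyclic` makes next v a permutation of the neighbours of v
  -- consisting of a single cycle.
  record RotationSystem : Set where
    field
      next   : Fin n → Fin n → Fin n
      closed : ∀ {v u} → v ~ u → v ~ next v u
      cyclic : ∀ {v u w} → v ~ u → v ~ w → Star (λ x y → next v x ≡ y) u w

    -- Face tracing: having arrived at v from u, leave along the edge that
    -- follows vu in the rotation at v.
    faceStep : Fin n × Fin n → Fin n × Fin n
    faceStep (u , v) = v , next v u

    -- faceStep permutes the darts, so its forward orbits are its cycles.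
    SameFace : Rel Dart 0ℓ
    SameFace d e = Star (λ x y → faceStep x ≡ y) (proj₁ d) (proj₁ e)

  -- A combinatorial embedding in the plane: a rotation system of genus 0.
  -- Embedded on its own surface, a component with n vertices, m edges and f
  -- faces has n + f ≤ m + 2, with equality exactly when the surface is the
  -- sphere.  Summed over all c components this becomes the equation below,
  -- which therefore holds exactly when every component lies on a sphere.  An
  -- isolated vertex has one face but no dart to trace it, so it is added
  -- separately.
  record PlaneEmbedding : Set where
    field
      rotation    : RotationSystem
      faces       : ℕ
      components  : ℕ
      #faces      : ClassCount (RotationSystem.SameFace rotation) faces
      #components : ClassCount Connected components
      euler       : n + (faces + length isolated)
                      ≡ length edges + 2 * components

  Planar : Set
  Planar = PlaneEmbedding

  AtDistanceTwo : Rel (Fin n) 0ℓ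
  AtDistanceTwo u v = u ≢ v × ¬ u ~ v × ∃[ w ] (u ~ w × w ~ v)

  square : Graph n
  square = record
    { _~_      = λ u v → u ~ v ⊎ AtDistanceTwo u v
    ; _~?_     = λ u v → (u ~? v) ⊎-dec (¬? (u ≟ v) ×-dec ¬? (u ~? v)
                           ×-dec any? (λ w → (u ~? w) ×-dec (w ~? v)))
    ; ~-sym    = λ where
        (inj₁ u~v) → inj₁ (~-sym u~v)
        (inj₂ (u≢v , u≁v , w , u~w , w~v)) →
          inj₂ ( (λ v≡u → u≢v (sym v≡u)) , (λ v~u → u≁v (~-sym v~u))
               , w , ~-sym w~v , ~-sym u~w)
    ; ~-irrefl = λ where
        u≡v (inj₁ u~v)       → ~-irrefl u≡v u~v
        u≡v (inj₂ (u≢v , _)) → u≢v u≡v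
    }

  record ListAssignment (k : ℕ) : Set where
    field
      list   : Fin n → List ℕ
      unique : ∀ v → Unique (list v)
      size   : ∀ v → length (list v) ≡ k

  record Coloring {k : ℕ} (L : ListAssignment k) : Set where
    field
      color   : Fin n → ℕ
      proper  : ∀ {u v} → u ~ v → color u ≢ color v
      allowed : ∀ v → color v ∈ ListAssignment.list L v

  Choosable : ℕ → Set
  Choosable k = (L : ListAssignment k) → Coloring L

  IsListChromaticNumber : ℕ → Set
  IsListChromaticNumber = Least Choosable

  Independent : Subset n → Set
  Independent I = ∀ {u v} → u ∈ₛ I → v ∈ₛ I → ¬ u ~ v

  recordListing : Subset n → (Fin n → ℕ) → (Fin n → ℕ)
  recordListing S listed v =
    if lookup S v then suc (listed v) else listed v

  -- Painter can win the game of k-paintability from the position where U is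
  -- the set of uncolored vertices and v has been listed `listed v` times.
  -- Every play is finite, so an inductive definition loses nothing.
  data PainterWins (k : ℕ) (U : Subset n) (listed : Fin n → ℕ) : Set where
    wins :
      (∀ v → v ∈ₛ U → listed v < k) →
      (∀ S → Nonempty S → S ⊆ₛ U →
         Σ[ I ∈ Subset n ] (I ⊆ₛ S × Independent I ×
           PainterWins k (U ─ I) (recordListing S listed))) →
      PainterWins k U listed

  Paintable : ℕ → Set
  Paintable k = PainterWins k ⊤ (λ _ → 0)

  IsPaintNumber : ℕ → Set
  IsPaintNumber = Least Paintable

{-# OPTIONS --safe #-}
module Submission where

-- The vertices of G² are coloured greedily, in an order in which each of them
-- has at most Δ + 2 earlier neighbours; Painter can follow the same order.
--
-- Such orders exist for all subgraphs H of G, by induction on the number of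
-- edges.  Let k = Δ(G), and let W be a maximal set of vertices that can be
-- removed from H² one at a time, each having at most k + 2 neighbours left.
-- Suppose uv is an edge with u ∈ W such that v ∈ W or all other neighbours of u
-- are adjacent to v.  Then two vertices outside W adjacent in H² are adjacent in
-- (H − uv)², so an order for (H − uv)², with W moved to the end, serves for H.
--
-- Otherwise W is independent, there are no vertices of degree 1, and 2-vertices
-- in triangles are outside W.  Faces other than triangles have length at least 6,
-- so Euler's formula gives Σ (2d(v) − 6) < 3t, where t is the number of
-- triangles.  Discharging contradicts this: each triangle receives 3 and each
-- 2-vertex receives 2 while no vertex ends with negative charge.  Vertices of
-- degree at least 6 simply spend at most 2 − 6/d(v) per edge.  A vertex of
-- degree 3 to 5 outside W has at least k + 3 neighbours outside W in H², so its
-- neighbours have large total degree, and large neighbours give it enough.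

open import Defs
open import Data.Bool using (Bool; true; false; if_then_else_; T; _∧_; _∨_)
open import Data.Bool.Properties using (∨-comm)
open import Data.Empty using (⊥; ⊥-elim)
open import Data.Fin using (Fin; zero; suc; toℕ; cast)
open import Data.Fin.Properties using (_≟_; any?; all?; toℕ-injective; toℕ-cast)
open import Data.List as List
  using (List; []; _∷_; _++_; map; length; filter; concat; allFin; tabulate; cartesianProduct)
open import Data.List.Membership.Propositional using (_∈_; _∉_; find; lose)
open import Data.List.Membership.Propositional.Properties
  using ( ∈-∃++; ∈-++⁺ˡ; ∈-++⁺ʳ; ∈-++⁻; ∈-filter⁺; ∈-filter⁻; ∈-map⁺; ∈-map⁻; ∈-concat⁺′; ∈-concat⁻′
        ; ∈-allFin; ∈-tabulate⁺; ∈-tabulate⁻; ∈-cartesianProduct⁺; ∈-lookup; ∈-length)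
open import Data.List.Properties using (length-++; length-map; length-tabulate; ++-assoc; ++-identityʳ; ++-conicalˡ)
open import Data.List.Relation.Binary.Permutation.Propositional
  using (_↭_; prep; swap; ↭-sym; ↭⇒↭ₛ) renaming (refl to refl↭; trans to trans↭)
open import Data.List.Relation.Binary.Permutation.Propositional.Properties
  using (All-resp-↭; ∈-resp-↭; ↭-length; shift; shifts; ++⁺ˡ; ++⁺ʳ; ++-comm)
import Data.List.Relation.Binary.Permutation.Setoid.Properties as ↭ₛ
open import Data.List.Relation.Unary.All as All using (All; []; _∷_)
import Data.List.Relation.Unary.All.Properties as All
open import Data.List.Relation.Unary.AllPairs using ([]; _∷_)
import Data.List.Relation.Unary.AllPairs.Properties as AllPairs
open import Data.List.Relation.Unary.Any as Any using (here; there)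
open import Data.List.Relation.Unary.Unique.Propositional using (Unique)
import Data.List.Relation.Unary.Unique.Propositional.Properties as Unique
open import Data.Nat hiding (_≟_)
import Data.Nat as ℕ
open import Data.Nat.Properties hiding (_≟_)
open import Data.Nat.Tactic.RingSolver using (solve-∀)
open import Data.Product as Product using (_×_; _,_; ∃; ∃-syntax; Σ-syntax; proj₁; proj₂)
open import Data.Product.Properties using (≡-dec)
open import Data.Sum using (_⊎_; inj₁; inj₂)
open import Data.Vec as Vec using (Vec; []; _∷_; zipWith; replicate; _[_]≔_)
open import Data.Vec.N-ary using (N-ary; ∀ⁿ; curryⁿ; _$ⁿ_)
open import Data.Vec.Properties using (lookup∘tabulate; []=⇒lookup; lookup⇒[]=)
open import Function using (_∘_; id; case_of_)
open import Function.Bundles using (Equivalence)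
open import Relation.Binary using (tri<; tri≈; tri>)
open import Relation.Binary.Construct.Closure.ReflexiveTransitive using (Star; ε; _◅_; _◅◅_; reverse)
open import Relation.Binary.PropositionalEquality hiding ([_])
open import Relation.Nullary using (Dec; yes; no; ¬_; ¬?; _×-dec_; _⊎-dec_; _→-dec_; does)
open import Relation.Nullary.Decidable using (dec-true; map′; decidable-stable)
open import Relation.Unary using (Decidable)

-- With k ≥ 32 the two neighbours of a 2-vertex outside W have total degree at least 35, so if one
-- of them has degree at most 5, the other has at least 30. At degree 30 a vertex can spend 2 - 6/30
-- = 9/5 per edge, which together with 1/5 from the small neighbour makes the 2 that is required.
--
-- For 2-vertices inside W no such degree bound is available, and they may weigh on small
-- neighbours. What compensates is that vertices of W act as a resource in the counting: one of them
-- within distance two of some v outside W is not among the k + 3 vertices that v must see, so it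
-- raises the degree sum demanded around v by one.
--
-- Planarity has to survive the deletion of edges. It is therefore carried as an inequality about
-- explicit lists of face boundaries and of roots meeting every component, so that whether a
-- deletion disconnects something never has to be decided.
--
-- The theorem asks for the two numbers themselves, not only for upper bounds; constructively, their
-- existence rests on choosability and paintability being decidable.

-- A reflective decision procedure for linear arithmetic over the naturals

module Linear where

  infixl 6 _⊕_
  infixl 7 _·_
  infix  4 _≤'_ _≡'_
  infixr 2 _⇒_
  infix  3 ⊢_
  infix  8 #_

  data Expr (n : ℕ) : Set where
    var : Fin n → Expr n
    #_  : ℕ → Expr n
    _⊕_ : Expr n → Expr n → Expr n
    _·_ : ℕ → Expr n → Expr n

  data Rel (n : ℕ) : Set where
    _≤'_ _≡'_ : Expr n → Expr n → Rel n

  data Claim (n : ℕ) : Set where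
    absurd : Claim n
    ⊢_     : Rel n → Claim n
    _⇒_    : Rel n → Claim n → Claim n

  ⟦_⟧ : ∀ {n} → Expr n → Vec ℕ n → ℕ
  ⟦ var i ⟧ ρ = Vec.lookup ρ i
  ⟦ # m ⟧ ρ = m
  ⟦ a ⊕ b ⟧ ρ = ⟦ a ⟧ ρ + ⟦ b ⟧ ρ
  ⟦ m · a ⟧ ρ = m * ⟦ a ⟧ ρ

  ⟦_⟧ʳ : ∀ {n} → Rel n → Vec ℕ n → Set
  ⟦ a ≤' b ⟧ʳ ρ = ⟦ a ⟧ ρ ≤ ⟦ b ⟧ ρ
  ⟦ a ≡' b ⟧ʳ ρ = ⟦ a ⟧ ρ ≡ ⟦ b ⟧ ρ

  ⟦_⟧ᶜ : ∀ {n} → Claim n → Vec ℕ n → Set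
  ⟦ absurd ⟧ᶜ ρ = ⊥
  ⟦ ⊢ r ⟧ᶜ ρ = ⟦ r ⟧ʳ ρ
  ⟦ r ⇒ c ⟧ᶜ ρ = ⟦ r ⟧ʳ ρ → ⟦ c ⟧ᶜ ρ

  -- Coefficient vectors; coordinate 0 is the constant term.
  Form : ℕ → Set
  Form n = Vec ℕ (suc n)

  dot : ∀ {n} → Vec ℕ n → Vec ℕ n → ℕ
  dot [] [] = 0
  dot (a ∷ as) (x ∷ xs) = a * x + dot as xs

  _⊞_ : ∀ {n} → Vec ℕ n → Vec ℕ n → Vec ℕ n
  _⊞_ = zipWith _+_

  dot-⊞ : ∀ {n} (a b x : Vec ℕ n) → dot (a ⊞ b) x ≡ dot a x + dot b x
  dot-⊞ [] [] [] = refl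
  dot-⊞ (a ∷ as) (b ∷ bs) (x ∷ xs) rewrite dot-⊞ as bs xs = eq a b x (dot as xs) (dot bs xs)
    where
    eq : ∀ a b x p q → (a + b) * x + (p + q) ≡ a * x + p + (b * x + q)
    eq = solve-∀

  dot-scale : ∀ {n} m (a x : Vec ℕ n) → dot (Vec.map (m *_) a) x ≡ m * dot a x
  dot-scale m [] [] = sym (*-zeroʳ m)
  dot-scale m (a ∷ as) (x ∷ xs) rewrite dot-scale m as xs = eq m a x (dot as xs)
    where
    eq : ∀ m a x p → m * a * x + m * p ≡ m * (a * x + p)
    eq = solve-∀

  zeros : ∀ {n} → Vec ℕ n
  zeros = replicate _ 0

  dot-zeros : ∀ {n} (x : Vec ℕ n) → dot zeros x ≡ 0
  dot-zeros [] = refl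
  dot-zeros (x ∷ xs) = dot-zeros xs

  unit : ∀ {n} → Fin n → Vec ℕ n
  unit zero = 1 ∷ zeros
  unit (suc i) = 0 ∷ unit i

  dot-unit : ∀ {n} (i : Fin n) x → dot (unit i) x ≡ Vec.lookup x i
  dot-unit zero (x ∷ xs) rewrite dot-zeros xs | +-identityʳ x = +-identityʳ x
  dot-unit (suc i) (x ∷ xs) = dot-unit i xs

  form : ∀ {n} → Expr n → Form n
  form (var i) = unit (suc i)
  form (# m) = m ∷ zeros
  form (a ⊕ b) = form a ⊞ form b
  form (m · a) = Vec.map (m *_) (form a)

  form-sound : ∀ {n} (e : Expr n) ρ → dot (form e) (1 ∷ ρ) ≡ ⟦ e ⟧ ρ
  form-sound (var i) ρ = dot-unit i ρ
  form-sound (# m) ρ rewrite dot-zeros ρ | +-identityʳ (m * 1) = *-identityʳ m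
  form-sound (a ⊕ b) ρ rewrite dot-⊞ (form a) (form b) (1 ∷ ρ) =
    cong₂ _+_ (form-sound a ρ) (form-sound b ρ)
  form-sound (m · a) ρ rewrite dot-scale m (form a) (1 ∷ ρ) = cong (m *_) (form-sound a ρ)

  Ineq : ℕ → Set
  Ineq n = Vec ℕ n × Vec ℕ n

  Holds : ∀ {n} → Vec ℕ n → Ineq n → Set
  Holds x (l , r) = dot l x ≤ dot r x

  -- Coefficients stay natural numbers, so common parts are removed from both sides instead of
  -- moving terms across. Afterwards each coordinate occurs on at most one side, which makes the
  -- classification in `split` faithful.
  cancel : ∀ {n} → Ineq n → Ineq n
  cancel (l , r) = zipWith _∸_ l r , zipWith _∸_ r l

  ∸-+-⊓ : ∀ m n → m ∸ n + m ⊓ n ≡ m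
  ∸-+-⊓ m n = trans (+-comm (m ∸ n) (m ⊓ n)) (trans (cong (_+ (m ∸ n)) (⊓-comm m n)) (m⊓n+n∸m≡n n m))

  dot-∸ : ∀ {n} (l r x : Vec ℕ n) → dot (zipWith _∸_ l r) x + dot (zipWith _⊓_ l r) x ≡ dot l x
  dot-∸ [] [] [] = refl
  dot-∸ (l ∷ ls) (r ∷ rs) (x ∷ xs) =
    trans (eq (l ∸ r) (l ⊓ r) x _ _) (cong₂ _+_ (cong (_* x) (∸-+-⊓ l r)) (dot-∸ ls rs xs))
    where
    eq : ∀ a b x p q → a * x + p + (b * x + q) ≡ (a + b) * x + (p + q)
    eq = solve-∀

  zipWith-⊓-comm : ∀ {n} (l r : Vec ℕ n) → zipWith _⊓_ l r ≡ zipWith _⊓_ r l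
  zipWith-⊓-comm [] [] = refl
  zipWith-⊓-comm (l ∷ ls) (r ∷ rs) = cong₂ _∷_ (⊓-comm l r) (zipWith-⊓-comm ls rs)

  cancel-sound : ∀ {n} (x : Vec ℕ n) c → Holds x c → Holds x (cancel c)
  cancel-sound x (l , r) h = +-cancelʳ-≤ (dot (zipWith _⊓_ l r) x) _ _
    (subst₂ _≤_ (sym (dot-∸ l r x))
      (trans (sym (dot-∸ r l x)) (cong (λ z → dot (zipWith _∸_ r l) x + dot z x) (zipWith-⊓-comm r l))) h)

  combine : ∀ {n} → ℕ → Ineq n → ℕ → Ineq n → Ineq n
  combine p (l , r) q (l′ , r′) =
    cancel (Vec.map (p *_) l ⊞ Vec.map (q *_) l′ , Vec.map (p *_) r ⊞ Vec.map (q *_) r′)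

  combine-sound : ∀ {n} (x : Vec ℕ n) p c q d → Holds x c → Holds x d → Holds x (combine p c q d)
  combine-sound x p (l , r) q (l′ , r′) h h′ = cancel-sound x
    (Vec.map (p *_) l ⊞ Vec.map (q *_) l′ , Vec.map (p *_) r ⊞ Vec.map (q *_) r′)
    (subst₂ _≤_ (sym (eq l l′)) (sym (eq r r′)) (+-mono-≤ (*-monoʳ-≤ p h) (*-monoʳ-≤ q h′)))
    where
    eq : ∀ a b → dot (Vec.map (p *_) a ⊞ Vec.map (q *_) b) x ≡ p * dot a x + q * dot b x
    eq a b = trans (dot-⊞ (Vec.map (p *_) a) (Vec.map (q *_) b) x)
                   (cong₂ _+_ (dot-scale p a x) (dot-scale q b x))

  -- The combination of an upper bound with the implicit lower bound 0: variables are naturals, so a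
  -- term on the smaller side may be omitted.
  drop-coord : ∀ {n} → Fin n → Ineq n → Ineq n
  drop-coord i (l , r) = (l [ i ]≔ 0) , r

  drop-dot : ∀ {n} (i : Fin n) (l x : Vec ℕ n) → dot (l [ i ]≔ 0) x ≤ dot l x
  drop-dot zero (l ∷ ls) (x ∷ xs) = m≤n+m _ (l * x)
  drop-dot (suc i) (l ∷ ls) (x ∷ xs) = +-monoʳ-≤ (l * x) (drop-dot i ls xs)

  -- Fourier–Motzkin elimination of one coordinate: `ups` bound it from above,
  -- `los` from below.
  split : ∀ {n} → Fin n → List (Ineq n) → List (Ineq n) × List (Ineq n) × List (Ineq n)
  split i [] = [] , [] , []
  split i (c@(l , r) ∷ cs) with split i cs | Vec.lookup l i | Vec.lookup r i
  ... | ups , los , rest | suc _ | _     = c ∷ ups , los , rest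
  ... | ups , los , rest | zero  | suc _ = ups , c ∷ los , rest
  ... | ups , los , rest | zero  | zero  = ups , los , c ∷ rest

  AllHold : ∀ {n} → Vec ℕ n → List (Ineq n) → Set
  AllHold x = All (Holds x)

  split-sound : ∀ {n} (x : Vec ℕ n) i cs → AllHold x cs →
    let ups , los , rest = split i cs in AllHold x ups × AllHold x los × AllHold x rest
  split-sound x i [] [] = [] , [] , []
  split-sound x i (c@(l , r) ∷ cs) (h ∷ hs)
    with split i cs | split-sound x i cs hs | Vec.lookup l i | Vec.lookup r i
  ... | _ | a , b , d | suc _ | _     = h ∷ a , b , d
  ... | _ | a , b , d | zero  | suc _ = a , h ∷ b , d
  ... | _ | a , b , d | zero  | zero  = a , b , h ∷ d

  pairs : ∀ {n} → Fin n → List (Ineq n) → List (Ineq n) → List (Ineq n)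
  pairs i [] los = []
  pairs i (c@(l , _) ∷ ups) los =
    drop-coord i c ∷ map (λ d@(_ , r) → combine (Vec.lookup r i) c (Vec.lookup l i) d) los ++ pairs i ups
      los

  pairs-sound : ∀ {n} (x : Vec ℕ n) i ups los → AllHold x ups → AllHold x los → AllHold x (pairs i ups los)
  pairs-sound x i [] los [] hs = []
  pairs-sound x i (c@(l , r) ∷ ups) los (h ∷ hs) gs =
    ≤-trans (drop-dot i l x) h ∷ All.++⁺ (go los gs) (pairs-sound x i ups los hs gs)
    where
    go : ∀ ds → AllHold x ds → AllHold
      x (map (λ d → combine (Vec.lookup (proj₂ d) i) c (Vec.lookup l i) d) ds)
    go [] [] = []
    go (d ∷ ds) (k ∷ ks) = combine-sound x (Vec.lookup (proj₂ d) i) c (Vec.lookup l i) d h k ∷ go ds ks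

  eliminate : ∀ {n} → Fin n → List (Ineq n) → List (Ineq n)
  eliminate i cs = let ups , los , rest = split i cs in rest ++ pairs i ups los

  eliminate-sound : ∀ {n} (x : Vec ℕ n) i cs → AllHold x cs → AllHold x (eliminate i cs)
  eliminate-sound x i cs hs = let a , b , d = split-sound x i cs hs in
    All.++⁺ d (pairs-sound x i _ _ a b)

  eliminate-all : ∀ {n m} → Vec (Fin n) m → List (Ineq n) → List (Ineq n)
  eliminate-all [] cs = cs
  eliminate-all (i ∷ is) cs = eliminate-all is (eliminate i cs)

  eliminate-all-sound : ∀ {n m} (x : Vec ℕ n) (is : Vec (Fin n) m) cs →
    AllHold x cs → AllHold x (eliminate-all is cs)
  eliminate-all-sound x [] cs hs = hs
  eliminate-all-sound x (i ∷ is) cs hs = eliminate-all-sound x is _ (eliminate-sound x i cs hs)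

  isZero : ∀ {n} → Vec ℕ n → Bool
  isZero [] = true
  isZero (zero ∷ as) = isZero as
  isZero (suc _ ∷ as) = false

  isZero-sound : ∀ {n} (a x : Vec ℕ n) → T (isZero a) → dot a x ≡ 0
  isZero-sound [] [] _ = refl
  isZero-sound (zero ∷ as) (x ∷ xs) t = isZero-sound as xs t

  contradictory : ∀ {n} → Ineq (suc n) → Bool
  contradictory (l ∷ _ , r ∷ rs) = (r <ᵇ l) ∧ isZero rs

  T-∧ : ∀ {a b} → T (a ∧ b) → T a × T b
  T-∧ {true} {true} _ = _

  contradictory-sound : ∀ {n} (ρ : Vec ℕ n) c → T (contradictory c) → Holds (1 ∷ ρ) c → ⊥
  contradictory-sound ρ (l ∷ ls , r ∷ rs) t h = <⇒≱ (<ᵇ⇒< r l (proj₁ (T-∧ t)))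
    (begin
      l                      ≡⟨ *-identityʳ l ⟨
      l * 1                  ≤⟨ m≤m+n (l * 1) _ ⟩
      l * 1 + dot ls ρ       ≤⟨ h ⟩
      r * 1 + dot rs ρ       ≡⟨ cong₂ _+_ (*-identityʳ r) (isZero-sound rs ρ (proj₂ (T-∧ {r <ᵇ l} t))) ⟩
      r + 0                  ≡⟨ +-identityʳ r ⟩
      r                      ∎)
    where open ≤-Reasoning

  anyC : ∀ {n} → List (Ineq (suc n)) → Bool
  anyC [] = false
  anyC (c ∷ cs) = if contradictory c then true else anyC cs

  anyC-sound : ∀ {n} (ρ : Vec ℕ n) cs → T (anyC cs) → AllHold (1 ∷ ρ) cs → ⊥
  anyC-sound ρ (c ∷ cs) t (h ∷ hs) with contradictory c in eq
  ... | true = contradictory-sound ρ c (subst T (sym eq) _) h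
  ... | false = anyC-sound ρ cs t hs

  refuted : ∀ {n} → List (Ineq (suc n)) → Bool
  refuted {n} cs = anyC (eliminate-all (Vec.tail (Vec.allFin (suc n))) cs)

  refuted-sound : ∀ {n} (ρ : Vec ℕ n) cs → T (refuted cs) → AllHold (1 ∷ ρ) cs → ⊥
  refuted-sound ρ cs t hs = anyC-sound ρ _ t (eliminate-all-sound (1 ∷ ρ) (Vec.tail (Vec.allFin _)) cs hs)

  ineq : ∀ {n} → Expr n → Expr n → Ineq (suc n)
  ineq a b = cancel (form a , form b)

  ineq-sound : ∀ {n} (ρ : Vec ℕ n) a b → ⟦ a ⟧ ρ ≤ ⟦ b ⟧ ρ → Holds (1 ∷ ρ) (ineq a b)
  ineq-sound ρ a b h = cancel-sound (1 ∷ ρ) (form a , form b)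
    (subst₂ _≤_ (sym (form-sound a ρ)) (sym (form-sound b ρ)) h)

  -- Goals are proved by refutation: the negation of `a ≤ b` over the naturals is `1 + b ≤ a`, which
  -- joins the hypotheses before all variables are eliminated.
  valid : ∀ {n} → List (Ineq (suc n)) → Claim n → Bool
  valid cs absurd = refuted cs
  valid cs (⊢ (a ≤' b)) = refuted (ineq (# 1 ⊕ b) a ∷ cs)
  valid cs (⊢ (a ≡' b)) = refuted (ineq (# 1 ⊕ b) a ∷ cs) ∧ refuted (ineq (# 1 ⊕ a) b ∷ cs)
  valid cs ((a ≤' b) ⇒ c) = valid (ineq a b ∷ cs) c
  valid cs ((a ≡' b) ⇒ c) = valid (ineq a b ∷ ineq b a ∷ cs) c

  ≤-sound : ∀ {n} (ρ : Vec ℕ n) cs a b → T (refuted (ineq (# 1 ⊕ b) a ∷ cs)) → AllHold (1 ∷ ρ) cs →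
    ⟦ a ⟧ ρ ≤ ⟦ b ⟧ ρ
  ≤-sound ρ cs a b t hs with ⟦ a ⟧ ρ ≤? ⟦ b ⟧ ρ
  ... | yes p = p
  ... | no ¬p = ⊥-elim (refuted-sound ρ _ t (ineq-sound ρ (# 1 ⊕ b) a (≰⇒> ¬p) ∷ hs))

  valid-sound : ∀ {n} (ρ : Vec ℕ n) cs c → T (valid cs c) → AllHold (1 ∷ ρ) cs → ⟦ c ⟧ᶜ ρ
  valid-sound ρ cs absurd t hs = refuted-sound ρ cs t hs
  valid-sound ρ cs (⊢ (a ≤' b)) t hs = ≤-sound ρ cs a b t hs
  valid-sound ρ cs (⊢ (a ≡' b)) t hs = let s , u = T-∧ t in
    ≤-antisym (≤-sound ρ cs a b s hs) (≤-sound ρ cs b a u hs)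
  valid-sound ρ cs ((a ≤' b) ⇒ c) t hs h = valid-sound ρ _ c t (ineq-sound ρ a b h ∷ hs)
  valid-sound ρ cs ((a ≡' b) ⇒ c) t hs h =
    valid-sound ρ _ c t (ineq-sound ρ a b (≤-reflexive h) ∷ ineq-sound ρ b a (≤-reflexive (sym h)) ∷ hs)

  vars : ∀ n → Vec (Expr n) n
  vars n = Vec.map var (Vec.allFin n)

  ∀ⁿ-curryⁿ : ∀ n {P : Vec ℕ n → Set} → (∀ ρ → P ρ) → ∀ⁿ n (curryⁿ P)
  ∀ⁿ-curryⁿ zero f = f []
  ∀ⁿ-curryⁿ (suc n) f x = ∀ⁿ-curryⁿ n (λ ρ → f (x ∷ ρ))

  -- For a closed claim the implicit argument evaluates to the unit type when elimination succeeds,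
  -- so it is filled in automatically. The result is curried to fit ordinary arithmetic hypotheses.
  lin : ∀ n (f : N-ary n (Expr n) (Claim n)) → {_ : T (valid [] (f $ⁿ vars n))} →
    ∀ⁿ n (curryⁿ ⟦ f $ⁿ vars n ⟧ᶜ)
  lin n f {t} = ∀ⁿ-curryⁿ n (λ ρ → valid-sound ρ [] (f $ⁿ vars n) t [])

open Linear using (lin; _⊕_; _·_; _≤'_; _≡'_; _⇒_; ⊢_; #_; absurd)

-- Cardinalities of duplicate-free lists and finite sums

module ListCounting where

  ∈⇒↭ : ∀ {A : Set} {x : A} {xs} → x ∈ xs → ∃[ zs ] xs ↭ x ∷ zs
  ∈⇒↭ {x = x} x∈xs with as , bs , refl ← ∈-∃++ x∈xs = as ++ bs , shift x as bs

  Unique-resp-↭ : ∀ {A : Set} {xs ys : List A} → xs ↭ ys → Unique xs → Unique ys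
  Unique-resp-↭ p = ↭ₛ.Unique-resp-↭ (setoid _) (↭⇒↭ₛ p)

  head∉tail : ∀ {A : Set} {x : A} {xs} → Unique (x ∷ xs) → x ∉ xs
  head∉tail = Unique.Unique[x∷xs]⇒x∉xs

  ∉⇒Unique : ∀ {A : Set} {x : A} {xs} → x ∉ xs → Unique xs → Unique (x ∷ xs)
  ∉⇒Unique x∉ u = All.tabulate (λ y∈ x≡y → x∉ (subst (_∈ _) (sym x≡y) y∈)) ∷ u

  -- The pigeonhole principle to which the cardinality estimates are reduced: finite sets are
  -- represented by duplicate-free lists.
  length-⊆ : ∀ {A : Set} {xs ys : List A} → Unique xs → (∀ {x} → x ∈ xs → x ∈ ys) → length xs ≤ length ys
  length-⊆ {xs = []} _ _ = z≤n
  length-⊆ {xs = x ∷ xs} {ys} u@(_ ∷ u′) sub with zs , p ← ∈⇒↭ (sub (here refl)) =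
    subst (suc (length xs) ≤_) (sym (↭-length p)) (s≤s (length-⊆ u′ sub′))
    where
    sub′ : ∀ {y} → y ∈ xs → y ∈ zs
    sub′ y∈ with ∈-resp-↭ p (sub (there y∈))
    ... | here refl = ⊥-elim (head∉tail u y∈)
    ... | there y∈zs = y∈zs

  ⊆⇒↭ : ∀ {A : Set} {xs ys : List A} → Unique xs → (∀ {x} → x ∈ xs → x ∈ ys) → length ys ≤ length xs →
    xs ↭ ys
  ⊆⇒↭ {xs = []} {[]} _ _ _ = refl↭
  ⊆⇒↭ {xs = x ∷ xs} {ys} u@(_ ∷ u′) sub len with zs , p ← ∈⇒↭ (sub (here refl)) =
    trans↭ (prep x (⊆⇒↭ u′ sub′ (≤-pred (subst (_≤ suc (length xs)) (↭-length p) len)))) (↭-sym p)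
    where
    sub′ : ∀ {y} → y ∈ xs → y ∈ zs
    sub′ y∈ with ∈-resp-↭ p (sub (there y∈))
    ... | here refl = ⊥-elim (head∉tail u y∈)
    ... | there y∈zs = y∈zs

  length-filter-mono : ∀ {A : Set} {P Q : A → Set} {xs} (P? : Decidable P) (Q? : Decidable Q) → Unique xs →
    (∀ {x} → x ∈ xs → P x → Q x) → length (filter P? xs) ≤ length (filter Q? xs)
  length-filter-mono {xs = xs} P? Q? u f = length-⊆ (Unique.filter⁺ P? u) λ x∈ →
    let x∈xs , px = ∈-filter⁻ P? {xs = xs} x∈ in ∈-filter⁺ Q? x∈xs (f x∈xs px)

  ∑[_] : ∀ {A : Set} → List A → (A → ℕ) → ℕ
  ∑[ [] ] f = 0
  ∑[ x ∷ xs ] f = f x + ∑[ xs ] f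

  𝟙 : ∀ {P : Set} → Dec P → ℕ
  𝟙 (yes _) = 1
  𝟙 (no _) = 0

  Σ-mono : ∀ {A : Set} (xs : List A) {f g : A → ℕ} → (∀ {x} → x ∈ xs → f x ≤ g x) → ∑[ xs ] f ≤ ∑[ xs ] g
  Σ-mono [] h = z≤n
  Σ-mono (x ∷ xs) h = +-mono-≤ (h (here refl)) (Σ-mono xs (h ∘ there))

  Σ-cong : ∀ {A : Set} (xs : List A) {f g : A → ℕ} → (∀ {x} → x ∈ xs → f x ≡ g x) → ∑[ xs ] f ≡ ∑[ xs ] g
  Σ-cong [] h = refl
  Σ-cong (x ∷ xs) h = cong₂ _+_ (h (here refl)) (Σ-cong xs (h ∘ there))

  interchange : ∀ a b c d → a + b + (c + d) ≡ a + c + (b + d)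
  interchange = solve-∀

  Σ-+ : ∀ {A : Set} (xs : List A) (f g : A → ℕ) → ∑[ xs ] (λ x → f x + g x) ≡ ∑[ xs ] f + ∑[ xs ] g
  Σ-+ [] f g = refl
  Σ-+ (x ∷ xs) f g rewrite Σ-+ xs f g = interchange (f x) (g x) (∑[ xs ] f) (∑[ xs ] g)

  Σ-* : ∀ {A : Set} (xs : List A) c (f : A → ℕ) → ∑[ xs ] (λ x → c * f x) ≡ c * ∑[ xs ] f
  Σ-* [] c f = sym (*-zeroʳ c)
  Σ-* (x ∷ xs) c f rewrite Σ-* xs c f = sym (*-distribˡ-+ c (f x) (∑[ xs ] f))

  Σ-zero : ∀ {A : Set} (xs : List A) → ∑[ xs ] (λ _ → 0) ≡ 0
  Σ-zero [] = refl
  Σ-zero (x ∷ xs) = Σ-zero xs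

  Σ-swap : ∀ {A B : Set} (xs : List A) (ys : List B) (f : A → B → ℕ) →
    ∑[ xs ] (λ x → ∑[ ys ] (f x)) ≡ ∑[ ys ] (λ y → ∑[ xs ] (λ x → f x y))
  Σ-swap [] ys f = sym (Σ-zero ys)
  Σ-swap (x ∷ xs) ys f rewrite Σ-swap xs ys f = sym (Σ-+ ys (f x) (λ y → ∑[ xs ] (λ x′ → f x′ y)))

  Σ-↭ : ∀ {A : Set} {xs ys : List A} (f : A → ℕ) → xs ↭ ys → ∑[ xs ] f ≡ ∑[ ys ] f
  Σ-↭ f refl↭ = refl
  Σ-↭ f (prep x p) = cong (f x +_) (Σ-↭ f p)
  Σ-↭ f (swap {xs} {ys} x y p) rewrite Σ-↭ f p = eq (f x) (f y) (∑[ ys ] f)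
    where
    eq : ∀ a b c → a + (b + c) ≡ b + (a + c)
    eq = solve-∀
  Σ-↭ f (trans↭ p q) = trans (Σ-↭ f p) (Σ-↭ f q)

  Σ-filter : ∀ {A : Set} {P : A → Set} (P? : Decidable P) (xs : List A) (f : A → ℕ) →
    ∑[ filter P? xs ] f ≡ ∑[ xs ] (λ x → 𝟙 (P? x) * f x)
  Σ-filter P? [] f = refl
  Σ-filter P? (x ∷ xs) f with P? x
  ... | yes _ rewrite +-identityʳ (f x) = cong (f x +_) (Σ-filter P? xs f)
  ... | no _ = Σ-filter P? xs f

  Σ-const : ∀ {A : Set} (xs : List A) c → ∑[ xs ] (λ _ → c) ≡ length xs * c
  Σ-const [] c = refl
  Σ-const (x ∷ xs) c = cong (c +_) (Σ-const xs c)

  length≡Σ : ∀ {A : Set} (xs : List A) → length xs ≡ ∑[ xs ] (λ _ → 1)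
  length≡Σ [] = refl
  length≡Σ (x ∷ xs) = cong suc (length≡Σ xs)

  length-filter≡Σ : ∀ {A : Set} {P : A → Set} (P? : Decidable P) (xs : List A) →
    length (filter P? xs) ≡ ∑[ xs ] (λ x → 𝟙 (P? x))
  length-filter≡Σ P? xs = trans (length≡Σ (filter P? xs))
    (trans (Σ-filter P? xs _) (Σ-cong xs λ {x} _ → *-identityʳ (𝟙 (P? x))))

  lookup-injective : ∀ {A : Set} {xs : List A} → Unique xs → ∀ a b → List.lookup xs a ≡ List.lookup xs b →
    a ≡ b
  lookup-injective {xs = x ∷ xs} u zero zero e = refl
  lookup-injective {xs = x ∷ xs} u zero (suc b) e =
    ⊥-elim (head∉tail u (subst (_∈ xs) (sym e) (∈-lookup b)))
  lookup-injective {xs = x ∷ xs} u (suc a) zero e = ⊥-elim (head∉tail u (subst (_∈ xs) e (∈-lookup a)))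
  lookup-injective {xs = x ∷ xs} (_ ∷ u) (suc a) (suc b) e = cong suc (lookup-injective u a b e)

  Σ-++ : ∀ {A : Set} (xs ys : List A) (f : A → ℕ) → ∑[ xs ++ ys ] f ≡ ∑[ xs ] f + ∑[ ys ] f
  Σ-++ [] ys f = refl
  Σ-++ (x ∷ xs) ys f rewrite Σ-++ xs ys f = sym (+-assoc (f x) _ _)

  Σ-map : ∀ {A B : Set} (h : A → B) (xs : List A) (f : B → ℕ) → ∑[ map h xs ] f ≡ ∑[ xs ] (f ∘ h)
  Σ-map h [] f = refl
  Σ-map h (x ∷ xs) f = cong (f (h x) +_) (Σ-map h xs f)

  Σ-cartesianProduct : ∀ {A B : Set} (xs : List A) (ys : List B) (f : A × B → ℕ) →
    ∑[ cartesianProduct xs ys ] f ≡ ∑[ xs ] (λ x → ∑[ ys ] (λ y → f (x , y)))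
  Σ-cartesianProduct [] ys f = refl
  Σ-cartesianProduct (x ∷ xs) ys f =
    trans (Σ-++ (map (x ,_) ys) (cartesianProduct xs ys) f)
          (cong₂ _+_ (Σ-map (x ,_) ys f) (Σ-cartesianProduct xs ys f))

  Σ-none : ∀ {A : Set} {Q : A → Set} (xs : List A) (Q? : Decidable Q) (f : A → ℕ) →
    (∀ {x} → x ∈ xs → ¬ Q x) →
    ∑[ xs ] (λ x → 𝟙 (Q? x) * f x) ≡ 0
  Σ-none [] Q? f h = refl
  Σ-none (x ∷ xs) Q? f h with Q? x
  ... | yes q = ⊥-elim (h (here refl) q)
  ... | no _ = Σ-none xs Q? f (h ∘ there)

  Σ-point : ∀ {A : Set} {Q : A → Set} {xs : List A} (Q? : Decidable Q) (f : A → ℕ) {w} → Unique xs →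
    w ∈ xs → Q w →
    (∀ {x} → Q x → x ≡ w) → ∑[ xs ] (λ x → 𝟙 (Q? x) * f x) ≡ f w
  Σ-point {xs = x ∷ xs} Q? f {w} u w∈ qw only with Q? x
  ... | yes q with refl ← only q
    rewrite Σ-none xs Q? f (λ {y} y∈ qy → head∉tail u (subst (_∈ xs) (only qy) y∈))
          | +-identityʳ (f x) = +-identityʳ (f x)
  Σ-point {xs = x ∷ xs} Q? f {w} (_ ∷ u) (here refl) qw only | no ¬q = ⊥-elim (¬q qw)
  Σ-point {xs = x ∷ xs} Q? f {w} (_ ∷ u) (there w∈) qw only | no ¬q = Σ-point Q? f u w∈ qw only

open ListCounting

-- The discharging rules as functions of degrees

module Prices where

  if-≤ : ∀ {A : Set} {m n} {x y : A} → m ≤ n → (if m ≤ᵇ n then x else y) ≡ x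
  if-≤ {m = m} {n} m≤n with m ≤ᵇ n | ≤⇒≤ᵇ m≤n
  ... | true | _ = refl

  if-> : ∀ {A : Set} {m n} {x y : A} → n < m → (if m ≤ᵇ n then x else y) ≡ y
  if-> {m = m} {n} n<m with m ≤ᵇ n | ≤ᵇ⇒≤ m n
  ... | true | f = ⊥-elim (<⇒≱ n<m (f _))
  ... | false | _ = refl

  if-cases : ∀ {m n x y z} → (m ≤ n → x ≤ z) → (n < m → y ≤ z) → (if m ≤ᵇ n then x else y) ≤ z
  if-cases {m} {n} f g with m ≤? n
  ... | yes h = ≤-trans (≤-reflexive (if-≤ h)) (f h)
  ... | no h = ≤-trans (≤-reflexive (if-> (≰⇒> h))) (g (≰⇒> h))

  if-both : ∀ b {x y z} → x ≤ z → y ≤ z → (if b then x else y) ≤ z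
  if-both true h _ = h
  if-both false _ h = h

  -- Charges are in units of 1/60: a vertex of degree d holds 2d − 6, so it can
  -- afford 2 − 6/d along each edge, rounded down here at d = 6, 12 and 30.
  cap : ℕ → ℕ
  cap d = if 30 ≤ᵇ d then 108 else if 12 ≤ᵇ d then 90 else 60

  opaque

    -- What u gives to v along an edge in no triangle.  A 2-vertex v has to receive
    -- 120 in all: half from either side if v is in W; otherwise its neighbours
    -- have total degree at least 35, so a small one can leave most to the other.
    pay : (du dv : ℕ) (v∈W : Bool) → ℕ
    pay du dv v∈W =
      if dv ≤ᵇ 2
      then (if v∈W then 60 else if du ≤ᵇ 5 then 12 else if du ≤ᵇ 29 then 60 else 108)
      else if dv ≤ᵇ 5 then (if 12 ≤ᵇ du then 90 else 0) else 0

  opaque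

    -- `share` and `price` give, plus 120, half of what u gives to a triangle whose
    -- other degrees are lo ≤ hi; the triangle has to receive 180 (and 120 more for
    -- a 2-vertex on it).  A vertex u of degree 3 to 5 receives when hi is large.
    share : (hi : ℕ) (du≤3 u∈W needy-u needy-nbr : Bool) → ℕ
    share hi du≤3 u∈W needy-u needy-nbr =
      if 30 ≤ᵇ hi
      then (if du≤3 then (if needy-u then 90 else 111) else (if needy-nbr then 132 else 111))
      else if 12 ≤ᵇ hi then 120
      else if 6 ≤ᵇ hi then (if u∈W then 120 else 150)
      else (if u∈W then 120 else 165)

    price : (du lo hi : ℕ) (u∈W needy-u needy-nbr : Bool) → ℕ
    price du lo hi u∈W needy-u needy-nbr =
      if du ≤ᵇ 2 then 60
      else if 6 ≤ᵇ du then 120 + cap du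
      else if lo ≤ᵇ 2 then 162
      else if 6 ≤ᵇ lo then 90
      else share hi (du ≤ᵇ 3) u∈W needy-u needy-nbr

  data CapView (d : ℕ) : ℕ → Set where
    cap-30 : 30 ≤ d → CapView d 108
    cap-12 : 12 ≤ d → d ≤ 29 → CapView d 90
    cap-0  : d ≤ 11 → CapView d 60

  capView : ∀ d → CapView d (cap d)
  capView d with 30 ≤? d | 12 ≤? d
  ... | yes p | _ = subst (CapView d) (sym (if-≤ p)) (cap-30 p)
  ... | no p | yes q = subst (CapView d) (sym (trans (if-> (≰⇒> p)) (if-≤ q))) (cap-12 q (≤-pred (≰⇒> p)))
  ... | no p | no q = subst (CapView d) (sym (trans (if-> (≰⇒> p)) (if-> (≰⇒> q)))) (cap-0 (≤-pred (≰⇒> q)))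

  60≤cap : ∀ d → 60 ≤ cap d
  60≤cap d with cap d | capView d
  ... | _ | cap-30 _ = ≤ᵇ⇒≤ 60 108 _
  ... | _ | cap-12 _ _ = ≤ᵇ⇒≤ 60 90 _
  ... | _ | cap-0 _ = ≤-refl

  90≤cap : ∀ d → 12 ≤ d → 90 ≤ cap d
  90≤cap d h with cap d | capView d
  ... | _ | cap-30 _ = ≤ᵇ⇒≤ 90 108 _
  ... | _ | cap-12 _ _ = ≤-refl
  ... | _ | cap-0 g = ⊥-elim (lin 1 (λ d → # 12 ≤' d ⇒ d ≤' # 11 ⇒ absurd) d h g)

  cap-huge : ∀ d → 30 ≤ d → cap d ≡ 108
  cap-huge d h with cap d | capView d
  ... | _ | cap-30 _ = refl
  ... | _ | cap-12 _ g = ⊥-elim (lin 1 (λ d → # 30 ≤' d ⇒ d ≤' # 29 ⇒ absurd) d h g)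
  ... | _ | cap-0 g = ⊥-elim (lin 1 (λ d → # 30 ≤' d ⇒ d ≤' # 11 ⇒ absurd) d h g)

  cap-affordable : ∀ d → 6 ≤ d → d * cap d + 360 ≤ 120 * d
  cap-affordable d h with cap d | capView d
  ... | _ | cap-30 g = subst (λ z → z + 360 ≤ 120 * d) (*-comm 108 d)
    (lin 1 (λ d → # 30 ≤' d ⇒ ⊢ 108 · d ⊕ # 360 ≤' 120 · d) d g)
  ... | _ | cap-12 g _ = subst (λ z → z + 360 ≤ 120 * d) (*-comm 90 d)
    (lin 1 (λ d → # 12 ≤' d ⇒ ⊢ 90 · d ⊕ # 360 ≤' 120 · d) d g)
  ... | _ | cap-0 _ = subst (λ z → z + 360 ≤ 120 * d) (*-comm 60 d)
    (lin 1 (λ d → # 6 ≤' d ⇒ ⊢ 60 · d ⊕ # 360 ≤' 120 · d) d h)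

  opaque
    unfolding pay

    pay-weak : ∀ {du dv} → dv ≤ 2 → pay du dv true ≡ 60
    pay-weak h = if-≤ h

    pay-strong-low : ∀ {du dv} → dv ≤ 2 → du ≤ 5 → pay du dv false ≡ 12
    pay-strong-low h g = trans (if-≤ h) (if-≤ g)

    pay-strong-mid : ∀ {du dv} → dv ≤ 2 → 6 ≤ du → 60 ≤ pay du dv false
    pay-strong-mid {du} h g = subst (60 ≤_) (sym (trans (if-≤ h) (if-> g))) (60≤ du)
      where
      60≤ : ∀ du → 60 ≤ (if du ≤ᵇ 29 then 60 else 108)
      60≤ du with du ≤ᵇ 29
      ... | true = ≤-refl
      ... | false = ≤ᵇ⇒≤ 60 108 _

    pay-strong-huge : ∀ {du dv} → dv ≤ 2 → 30 ≤ du → pay du dv false ≡ 108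
    pay-strong-huge {du} h g = trans (if-≤ h) (trans (if-> (≤-trans (≤ᵇ⇒≤ 6 30 _) g)) (if-> g))

    strong-pays : ∀ x y {dv} → dv ≤ 2 → 35 ≤ x + y → 120 ≤ pay x dv false + pay y dv false
    strong-pays x y h sum with x ≤? 5 | y ≤? 5
    ... | yes a | yes b = ⊥-elim (lin 2 (λ x y → # 35 ≤' x ⊕ y ⇒ x ≤' # 5 ⇒ y ≤' # 5 ⇒ absurd) x y sum a b)
    ... | yes a | no b = ≤-reflexive (sym (cong₂ _+_ (pay-strong-low {x} h a)
      (pay-strong-huge {y} h (lin 2 (λ x y → # 35 ≤' x ⊕ y ⇒ x ≤' # 5 ⇒ ⊢ # 30 ≤' y) x y sum a))))
    ... | no a | yes b = ≤-reflexive (sym (cong₂ _+_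
      (pay-strong-huge {x} h (lin 2 (λ x y → # 35 ≤' x ⊕ y ⇒ y ≤' # 5 ⇒ ⊢ # 30 ≤' x) x y sum b))
        (pay-strong-low {y} h b)))
    ... | no a | no b = +-mono-≤ {60} {_} {60} (pay-strong-mid {x} h (≰⇒> a)) (pay-strong-mid {y} h (≰⇒> b))

    pay-gift : ∀ {du dv w} → 3 ≤ dv → dv ≤ 5 → 12 ≤ du → pay du dv w ≡ 90
    pay-gift h₁ h₂ h₃ = trans (if-> h₁) (trans (if-≤ h₂) (if-≤ h₃))

    pay-none : ∀ {du dv w} → 3 ≤ dv → du ≤ 11 → pay du dv w ≡ 0
    pay-none {du} {dv} h₁ h₂ = trans (if-> h₁) (go (dv ≤ᵇ 5))
      where
      go : ∀ b → (if b then (if 12 ≤ᵇ du then 90 else 0) else 0) ≡ 0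
      go true = if-> (s≤s h₂)
      go false = refl

    pay≤120 : ∀ du dv w → pay du dv w ≤ 120
    pay≤120 du dv w = if-both (dv ≤ᵇ 2)
      (if-both w (≤ᵇ⇒≤ 60 120 _) (if-both (du ≤ᵇ 5) (≤ᵇ⇒≤ 12 120 _)
        (if-both (du ≤ᵇ 29) (≤ᵇ⇒≤ 60 120 _) (≤ᵇ⇒≤ 108 120 _))))
      (if-both (dv ≤ᵇ 5) (if-both (12 ≤ᵇ du) (≤ᵇ⇒≤ 90 120 _) z≤n) z≤n)

    pay≤cap : ∀ du dv w → 6 ≤ du → pay du dv w ≤ cap du
    pay≤cap du dv w h = if-both (dv ≤ᵇ 2)
      (if-both w (60≤cap du) (if-both (du ≤ᵇ 5) (≤-trans (≤ᵇ⇒≤ 12 60 _) (60≤cap du))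
        (if-cases {du} {29} (λ _ → 60≤cap du) λ g → ≤-reflexive (sym (cap-huge du g)))))
      (if-both (dv ≤ᵇ 5) (if-cases {12} {du} (90≤cap du) λ _ → z≤n) z≤n)

  opaque
    unfolding price

    price-tiny : ∀ {d lo hi w nd nn} → d ≤ 2 → price d lo hi w nd nn ≡ 60
    price-tiny h = if-≤ h

    price-large : ∀ {d lo hi w nd nn} → 6 ≤ d → price d lo hi w nd nn ≡ 120 + cap d
    price-large {d} h = trans (if-> (lin 1 (λ d → # 6 ≤' d ⇒ ⊢ # 3 ≤' d) d h)) (if-≤ h)

    price-share : ∀ {d lo hi w nd nn} → 3 ≤ d → d ≤ 5 → 3 ≤ lo → lo ≤ 5 →
      price d lo hi w nd nn ≡ share hi (d ≤ᵇ 3) w nd nn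
    price-share h₁ h₂ h₃ h₄ = trans (if-> h₁) (trans (if-> (s≤s h₂)) (trans (if-> h₃) (if-> (s≤s h₄))))

    price-by-tiny : ∀ {d lo hi w nd nn} → 3 ≤ d → d ≤ 5 → lo ≤ 2 → price d lo hi w nd nn ≡ 162
    price-by-tiny h₁ h₂ h₃ = trans (if-> h₁) (trans (if-> (s≤s h₂)) (if-≤ h₃))

    price-by-large : ∀ {d lo hi w nd nn} → 3 ≤ d → d ≤ 5 → 6 ≤ lo → price d lo hi w nd nn ≡ 90
    price-by-large {lo = lo} h₁ h₂ h₃ = trans (if-> h₁) (trans (if-> (s≤s h₂))
      (trans (if-> (lin 1 (λ d → # 6 ≤' d ⇒ ⊢ # 3 ≤' d) lo h₃)) (if-≤ h₃)))

  opaque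
    unfolding share

    share-huge : ∀ {hi t w nd nn} → 30 ≤ hi →
      share hi t w nd nn ≡ (if t then (if nd then 90 else 111) else (if nn then 132 else 111))
    share-huge = if-≤

    share-big : ∀ {hi t w nd nn} → 12 ≤ hi → hi < 30 → share hi t w nd nn ≡ 120
    share-big h g = trans (if-> g) (if-≤ h)

    share-mid : ∀ {hi t w nd nn} → 6 ≤ hi → hi < 12 → share hi t w nd nn ≡ (if w then 120 else 150)
    share-mid {hi} h g = trans (if-> (lin 1 (λ x → # 1 ⊕ x ≤' # 12 ⇒ ⊢ # 1 ⊕ x ≤' # 30) hi g))
      (trans (if-> g) (if-≤ h))

    share-none : ∀ {hi t w nd nn} → hi < 6 → share hi t w nd nn ≡ (if w then 120 else 165)
    share-none {hi} g = trans (if-> (lin 1 (λ x → # 1 ⊕ x ≤' # 6 ⇒ ⊢ # 1 ⊕ x ≤' # 30) hi g))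
      (trans (if-> (lin 1 (λ x → # 1 ⊕ x ≤' # 6 ⇒ ⊢ # 1 ⊕ x ≤' # 12) hi g)) (if-> g))

  price≥ : ∀ {d lo hi w nd nn} m → 6 ≤ d → m ≤ cap d → 120 + m ≤ price d lo hi w nd nn
  price≥ m h g = subst (120 + m ≤_) (sym (price-large h)) (+-monoʳ-≤ 120 g)

  needy⇒other≥4 : ∀ {k x c} → c ≤ k → k + 4 ≤ x + c → 4 ≤ x
  needy⇒other≥4 {k} {x} {c} = lin 3 (λ k x c → c ≤' k ⇒ k ⊕ # 4 ≤' x ⊕ c ⇒ ⊢ # 4 ≤' x) k x c

  -- A needy vertex of degree 3 is subsidised by its partner, which then has degree at least 4.
  huge-share-sum : ∀ {k a b c} na nb nc → c ≤ k →
    (na ≡ true → k + 4 ≤ b + c) → (nb ≡ true → k + 4 ≤ a + c) →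
    222 ≤ (if a ≤ᵇ 3 then (if na then 90 else 111) else (if nb ∨ nc then 132 else 111))
        + (if b ≤ᵇ 3 then (if nb then 90 else 111) else (if na ∨ nc then 132 else 111))
  huge-share-sum {k} {a} {b} na nb nc c≤k fa fb with a ≤ᵇ 3 | ≤ᵇ⇒≤ a 3 | b ≤ᵇ 3 | ≤ᵇ⇒≤ b 3
  huge-share-sum {k} {a} {b} true nb nc c≤k fa fb | _ | _ | true | g =
    ⊥-elim (<⇒≱ (needy⇒other≥4 c≤k (fa refl)) (g _))
  huge-share-sum {k} {a} {b} na true nc c≤k fa fb | true | g | _ | _ =
    ⊥-elim (<⇒≱ (needy⇒other≥4 c≤k (fb refl)) (g _))
  huge-share-sum false false nc _ _ _ | true | _ | true | _ = ≤ᵇ⇒≤ 222 222 _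
  huge-share-sum true false nc _ _ _ | true | _ | false | _ = ≤ᵇ⇒≤ 222 222 _
  huge-share-sum false false true _ _ _ | true | _ | false | _ = ≤ᵇ⇒≤ 222 243 _
  huge-share-sum false false false _ _ _ | true | _ | false | _ = ≤ᵇ⇒≤ 222 222 _
  huge-share-sum false true nc _ _ _ | false | _ | true | _ = ≤ᵇ⇒≤ 222 222 _
  huge-share-sum false false true _ _ _ | false | _ | true | _ = ≤ᵇ⇒≤ 222 243 _
  huge-share-sum false false false _ _ _ | false | _ | true | _ = ≤ᵇ⇒≤ 222 222 _
  huge-share-sum na nb nc _ _ _ | false | _ | false | _ =
    +-mono-≤ {111} {_} {111} (≥111 (nb ∨ nc)) (≥111 (na ∨ nc))
    where
    ≥111 : ∀ t → 111 ≤ (if t then 132 else 111)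
    ≥111 true = ≤ᵇ⇒≤ 111 132 _
    ≥111 false = ≤-refl

  mid-share-sum : ∀ wa wb → (wa ≡ true → wb ≡ true → ⊥) →
    270 ≤ (if wa then 120 else 150) + (if wb then 120 else 150)
  mid-share-sum true true h = ⊥-elim (h refl refl)
  mid-share-sum true false h = ≤-refl
  mid-share-sum false true h = ≤-refl
  mid-share-sum false false h = ≤ᵇ⇒≤ 270 300 _

  none-share-sum : ∀ wa wb wc → (wa ≡ true → wb ≡ true → ⊥) → (wa ≡ true → wc ≡ true → ⊥) →
    (wb ≡ true → wc ≡ true → ⊥) →
    450 ≤ (if wa then 120 else 165) + (if wb then 120 else 165) + (if wc then 120 else 165)
  none-share-sum true true _ h _ _ = ⊥-elim (h refl refl)
  none-share-sum true _ true _ h _ = ⊥-elim (h refl refl)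
  none-share-sum _ true true _ _ h = ⊥-elim (h refl refl)
  none-share-sum true false false _ _ _ = ≤-refl
  none-share-sum false true false _ _ _ = ≤-refl
  none-share-sum false false true _ _ _ = ≤-refl
  none-share-sum false false false _ _ _ = ≤ᵇ⇒≤ 450 495 _

  -- Three offsets of 120 plus half of the 180 that a triangle receives make 450. The rates leave no
  -- slack: the tight sums are 60 + 180 + 210 and 60 + 162 + 228 with a 2-vertex, 90 + 180 + 180
  -- with one vertex of degree 3 to 5, and 222 + 228, 240 + 210, 270 + 180 and 120 + 165 + 165 with
  -- more of them.
  triangle-paid : ∀ {k a b c} wa wb wc na nb nc → 32 ≤ k → 2 ≤ a → a ≤ b → b ≤ c → c ≤ k →
    (a ≤ 2 → k + 5 ≤ b + c) →
    (wa ≡ true → wb ≡ true → ⊥) → (wa ≡ true → wc ≡ true → ⊥) → (wb ≡ true → wc ≡ true → ⊥) →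
    (na ≡ true → k + 4 ≤ b + c) → (nb ≡ true → k + 4 ≤ a + c) →
    450 ≤ price a b c wa na (nb ∨ nc) + price b a c wb nb (na ∨ nc) + price c a b wc nc (na ∨ nb)
  triangle-paid {k} {a} {b} {c} wa wb wc na nb nc 32≤k 2≤a a≤b b≤c c≤k tiny-a ab ac bc fa fb
    with a ≤? 2 | 6 ≤? a | 6 ≤? b
  -- Here `b + c ≥ 37` and `b ≤ c`, so `c ≥ 19` and the rate 120 + 90 is available.
  ... | yes p | _ | yes r = +-mono-≤ (+-mono-≤ (≤-reflexive (sym (price-tiny p))) (price≥ 60 r (60≤cap b)))
    (price≥ 90 (≤-trans r b≤c) (90≤cap c
      (lin 3 (λ k b c → # 32 ≤' k ⇒ b ≤' c ⇒ k ⊕ # 5 ≤' b ⊕ c ⇒ ⊢ # 12 ≤' c)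
      k b c 32≤k b≤c (tiny-a p))))
  ... | yes p | _ | no r =
    +-mono-≤ (+-mono-≤ (≤-reflexive (sym (price-tiny p)))
      (≤-reflexive (sym (price-by-tiny 3≤b (≤-pred (≰⇒> r)) p))))
      (price≥ 108 (≤-trans (≤ᵇ⇒≤ 6 30 _) 30≤c) (≤-reflexive (sym (cap-huge c 30≤c))))
    where
    3≤b : 3 ≤ b
    3≤b = lin 3 (λ k b c → c ≤' k ⇒ k ⊕ # 5 ≤' b ⊕ c ⇒ ⊢ # 3 ≤' b) k b c c≤k (tiny-a p)
    30≤c : 30 ≤ c
    30≤c = lin 3 (λ k b c → # 32 ≤' k ⇒ # 1 ⊕ b ≤' # 6 ⇒ k ⊕ # 5 ≤' b ⊕ c ⇒ ⊢ # 30 ≤' c) k b c 32≤k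
      (≰⇒> r) (tiny-a p)
  ... | no p | yes q | _ = ≤-trans (≤ᵇ⇒≤ 450 540 _) (+-mono-≤ (+-mono-≤ (price≥ 60 q (60≤cap a))
    (price≥ 60 (≤-trans q a≤b) (60≤cap b))) (price≥ 60 (≤-trans q (≤-trans a≤b b≤c)) (60≤cap c)))
  ... | no p | no q | yes r = +-mono-≤ (+-mono-≤
    (≤-reflexive (sym (price-by-large (≰⇒> p) (≤-pred (≰⇒> q)) r)))
    (price≥ 60 r (60≤cap b))) (price≥ 60 (≤-trans r b≤c) (60≤cap c))
  ... | no p | no q | no r
    rewrite price-share {a} {b} {c} {wa} {na} {nb ∨ nc} (≰⇒> p) (≤-pred (≰⇒> q)) (≤-trans (≰⇒> p) a≤b)
      (≤-pred (≰⇒> r))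
          | price-share {b} {a} {c} {wb} {nb} {na ∨ nc} (≤-trans (≰⇒> p) a≤b) (≤-pred (≰⇒> r)) (≰⇒> p)
            (≤-pred (≰⇒> q))
    with 30 ≤? c | 12 ≤? c | 6 ≤? c
  ... | yes x | _ | _ rewrite share-huge {c} {a ≤ᵇ 3} {wa} {na} {nb ∨ nc} x | share-huge {c} {b ≤ᵇ 3} {wb} {nb} {na ∨ nc} x =
    +-mono-≤ {222} {_} {228} (huge-share-sum {k} {a} {b} {c} na nb nc c≤k fa fb)
      (price≥ 108 (≤-trans (≤ᵇ⇒≤ 6 30 _) x) (≤-reflexive (sym (cap-huge c x))))
  ... | no x | yes y | _
    rewrite share-big {c} {a ≤ᵇ 3} {wa} {na} {nb ∨ nc} y (≰⇒> x) | share-big {c} {b ≤ᵇ 3} {wb} {nb}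
      {na ∨ nc} y (≰⇒> x) =
    +-monoʳ-≤ 240 (price≥ 90 (≤-trans (≤ᵇ⇒≤ 6 12 _) y) (90≤cap c y))
  ... | no x | no y | yes z
    rewrite share-mid {c} {a ≤ᵇ 3} {wa} {na} {nb ∨ nc} z (≰⇒> y) | share-mid {c} {b ≤ᵇ 3} {wb} {nb}
      {na ∨ nc} z (≰⇒> y) =
    +-mono-≤ {270} {_} {180} (mid-share-sum wa wb ab) (price≥ 60 z (60≤cap c))
  ... | no x | no y | no z
    rewrite price-share {c} {a} {b} {wc} {nc} {na ∨ nb} (≤-trans (≰⇒> p) (≤-trans a≤b b≤c))
      (≤-pred (≰⇒> z)) (≰⇒> p) (≤-pred (≰⇒> q))
          | share-none {c} {a ≤ᵇ 3} {wa} {na} {nb ∨ nc} (≰⇒> z) | share-none {c} {b ≤ᵇ 3} {wb} {nb}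
            {na ∨ nc} (≰⇒> z)
          | share-none {b} {c ≤ᵇ 3} {wc} {nc} {na ∨ nb} (≰⇒> r) = none-share-sum wa wb wc ab ac bc

-- Neighbourhoods and triangles in graphs without 4-cycles

-- Only opposite vertices are required to differ; consecutive ones do so by irreflexivity. `C5-Free`
-- likewise lists just the non-consecutive pairs.
C4-Free : ∀ {n} → Graph n → Set
C4-Free H = ∀ {a b c d} → a ~ b → b ~ c → c ~ d → d ~ a → a ≢ c → b ≢ d → ⊥
  where open Graph H

C5-Free : ∀ {n} → Graph n → Set
C5-Free H = ∀ {a b c d e} → a ~ b → b ~ c → c ~ d → d ~ e → e ~ a →
    a ≢ c → b ≢ d → c ≢ e → d ≢ a → e ≢ b → ⊥
  where open Graph H

module Neighbourhoods {n : ℕ} (H : Graph n) where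
  open Graph H public

  N : Fin n → List (Fin n)
  N v = filter (v ~?_) (allFin n)

  N² : Fin n → List (Fin n)
  N² v = filter (Graph._~?_ (square H) v) (allFin n)

  ∈N⁺ : ∀ {v x} → v ~ x → x ∈ N v
  ∈N⁺ {v} {x} v~x = ∈-filter⁺ (v ~?_) (∈-allFin x) v~x

  ∈N⁻ : ∀ {v x} → x ∈ N v → v ~ x
  ∈N⁻ {v} x∈ = proj₂ (∈-filter⁻ (v ~?_) {xs = allFin n} x∈)

  ∈N²⁻ : ∀ {v x} → x ∈ N² v → Graph._~_ (square H) v x
  ∈N²⁻ {v} x∈ = proj₂ (∈-filter⁻ (Graph._~?_ (square H) v) {xs = allFin n} x∈)

  N-unique : ∀ v → Unique (N v)
  N-unique v = Unique.filter⁺ (v ~?_) (Unique.allFin⁺ n)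

  N²-unique : ∀ v → Unique (N² v)
  N²-unique v = Unique.filter⁺ _ (Unique.allFin⁺ n)

  ~⇒≢ : ∀ {u v} → u ~ v → u ≢ v
  ~⇒≢ u~v u≡v = ~-irrefl u≡v u~v

  _without_ : List (Fin n) → Fin n → List (Fin n)
  xs without a = filter (λ x → ¬? (x ≟ a)) xs

  without-length : ∀ {a xs} → Unique xs → a ∈ xs → suc (length (xs without a)) ≤ length xs
  without-length {a} {xs} u a∈ = length-⊆
    (∉⇒Unique (λ m → proj₂ (∈-filter⁻ (λ x → ¬? (x ≟ a)) {xs = xs} m) refl) (Unique.filter⁺ _ u))
    λ { (here refl) → a∈ ; (there m) → proj₁ (∈-filter⁻ (λ x → ¬? (x ≟ a)) {xs = xs} m) }

  ∈-without : ∀ {a x xs} → x ∈ xs → x ≢ a → x ∈ xs without a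
  ∈-without {a} x∈ x≢a = ∈-filter⁺ (λ x → ¬? (x ≟ a)) x∈ x≢a

  Triangle : Fin n → Fin n → Fin n → Set
  Triangle u v w = u ~ v × u ~ w × v ~ w

  triangle? : ∀ u v w → Dec (Triangle u v w)
  triangle? u v w = u ~? v ×-dec u ~? w ×-dec v ~? w

  triangle-swap : ∀ {u v w} → Triangle u v w → Triangle u w v
  triangle-swap (a , b , c) = b , a , ~-sym c

  triangle-rot : ∀ {u v w} → Triangle u v w → Triangle v w u
  triangle-rot (a , b , c) = c , ~-sym a , ~-sym b

  InTriangle : Fin n → Fin n → Set
  InTriangle u v = ∃[ w ] Triangle u v w

  inTriangle? : ∀ u v → Dec (InTriangle u v)
  inTriangle? u v = any? (triangle? u v)

  -- Without 4-cycles the triangles at u match up some of its neighbours; the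
  -- remaining neighbours are the single ones.
  data Grouped (u : Fin n) : List (Fin n) → Set where
    singles : ∀ {xs} → All (λ x → u ~ x × ¬ InTriangle u x) xs → Grouped u xs
    pair    : ∀ {x y xs} → Triangle u x y → Grouped u xs → Grouped u (x ∷ y ∷ xs)

  #pairs : ∀ {u xs} → Grouped u xs → ℕ
  #pairs (singles _) = 0
  #pairs (pair _ g) = suc (#pairs g)

  beyond : Fin n → List (Fin n) → List (Fin n)
  beyond u [] = []
  beyond u (x ∷ xs) = x ∷ (N x without u) ++ beyond u xs

  -- A cover of the square neighbourhood of `u`, possibly with repetitions. A single neighbour x
  -- accounts for d(x) entries, but a pair x, y only for d(x) + d(y) - 2, since each loses both `u`
  -- and its partner from its neighbourhood.
  reach : ∀ {u xs} → Grouped u xs → List (Fin n)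
  reach {u} {xs} (singles _) = beyond u xs
  reach {u} {x ∷ y ∷ _} (pair _ g) =
    x ∷ y ∷ ((N x without u) without y) ++ ((N y without u) without x) ++ reach g

  beyond-length : ∀ {u xs} → All (λ x → u ~ x × ¬ InTriangle u x) xs →
    length (beyond u xs) ≤ ∑[ xs ] (degree H)
  beyond-length [] = z≤n
  beyond-length {u} {x ∷ xs} ((u~x , _) ∷ as) =
    subst (_≤ degree H x + ∑[ xs ] (degree H)) (sym (cong suc (length-++ (N x without u))))
      (+-mono-≤ (without-length (N-unique x) (∈N⁺ (~-sym u~x))) (beyond-length as))

  reach-length : ∀ {u xs} (g : Grouped u xs) → length (reach g) + 2 * #pairs g ≤ ∑[ xs ] (degree H)
  reach-length (singles as) = subst (_≤ _) (sym (+-identityʳ _)) (beyond-length as)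
  reach-length {u} {x ∷ y ∷ xs} (pair (u~x , u~y , x~y) g)
    rewrite length-++ ((N x without u) without y) {((N y without u) without x) ++ reach g}
          | length-++ ((N y without u) without x) {reach g} =
    lin 7 (λ a b r p dx dy s → # 2 ⊕ a ≤' dx ⇒ # 2 ⊕ b ≤' dy ⇒ r ⊕ 2 · p ≤' s ⇒
        ⊢ # 2 ⊕ (a ⊕ (b ⊕ r)) ⊕ 2 · (# 1 ⊕ p) ≤' dx ⊕ (dy ⊕ s))
      _ _ (length (reach g)) (#pairs g) (degree H x) (degree H y) _
      (two x y u~x u~y x~y) (two y x u~y u~x (~-sym x~y)) (reach-length g)
    where
    two : ∀ x y → u ~ x → u ~ y → x ~ y → 2 + length ((N x without u) without y) ≤ degree H x
    two x y u~x u~y x~y = ≤-trans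
      (s≤s (without-length (Unique.filter⁺ _ (N-unique x)) (∈-without (∈N⁺ x~y) (~⇒≢ u~y ∘ sym))))
      (without-length (N-unique x) (∈N⁺ (~-sym u~x)))

  beyond-∋ : ∀ {u w xs} → w ∈ xs → w ∈ beyond u xs
  beyond-∋ (here refl) = here refl
  beyond-∋ {u} {xs = x ∷ xs} (there w∈) = there (∈-++⁺ʳ (N x without u) (beyond-∋ w∈))

  beyond-∋² : ∀ {u w z xs} → w ∈ xs → w ~ z → z ≢ u → z ∈ beyond u xs
  beyond-∋² {u} {xs = x ∷ xs} (here refl) w~z z≢u = there (∈-++⁺ˡ (∈-without (∈N⁺ w~z) z≢u))
  beyond-∋² {u} {xs = x ∷ xs} (there w∈) w~z z≢u = there (∈-++⁺ʳ (N x without u) (beyond-∋² w∈ w~z z≢u))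

  reach-∋ : ∀ {u w xs} (g : Grouped u xs) → w ∈ xs → w ∈ reach g
  reach-∋ (singles _) w∈ = beyond-∋ w∈
  reach-∋ (pair _ g) (here refl) = here refl
  reach-∋ (pair _ g) (there (here refl)) = there (here refl)
  reach-∋ {u} {xs = x ∷ y ∷ _} (pair _ g) (there (there w∈)) =
    there (there (∈-++⁺ʳ ((N x without u) without y) (∈-++⁺ʳ ((N y without u) without x) (reach-∋ g w∈))))

  reach-∋² : ∀ {u w z xs} (g : Grouped u xs) → w ∈ xs → w ~ z → z ≢ u → ¬ u ~ z → z ∈ reach g
  reach-∋² (singles _) w∈ w~z z≢u _ = beyond-∋² w∈ w~z z≢u
  reach-∋² {u} (pair (u~x , u~y , _) g) (here refl) w~z z≢u u≁z =
    there (there (∈-++⁺ˡ (∈-without (∈-without (∈N⁺ w~z) z≢u) λ { refl → u≁z u~y })))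
  reach-∋² {u} {xs = x ∷ y ∷ _} (pair (u~x , u~y , _) g) (there (here refl)) w~z z≢u u≁z =
    there (there (∈-++⁺ʳ ((N x without u) without y)
      (∈-++⁺ˡ (∈-without (∈-without (∈N⁺ w~z) z≢u) λ { refl → u≁z u~x }))))
  reach-∋² {u} {xs = x ∷ y ∷ _} (pair _ g) (there (there w∈)) w~z z≢u u≁z =
    there (there (∈-++⁺ʳ ((N x without u) without y)
      (∈-++⁺ʳ ((N y without u) without x) (reach-∋² g w∈ w~z z≢u u≁z))))

  N²⊆reach : ∀ {u xs z} (g : Grouped u xs) → xs ↭ N u → Graph._~_ (square H) u z → z ∈ reach g
  N²⊆reach g p (inj₁ u~z) = reach-∋ g (∈-resp-↭ (↭-sym p) (∈N⁺ u~z))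
  N²⊆reach g p (inj₂ (u≢z , u≁z , w , u~w , w~z)) =
    reach-∋² g (∈-resp-↭ (↭-sym p) (∈N⁺ u~w)) w~z (u≢z ∘ sym) u≁z

  module _ (no-C4 : C4-Free H) where

    -- Two triangles on the edge `uv` would form the 4-cycle `u`, `w`, `v`, `w′`.
    third-unique : ∀ {u v w w′} → Triangle u v w → Triangle u v w′ → w ≡ w′
    third-unique {w = w} {w′} (u~v , u~w , v~w) (_ , u~w′ , v~w′) with w ≟ w′
    ... | yes p = p
    ... | no w≢w′ = ⊥-elim (no-C4 u~w (~-sym v~w) v~w′ (~-sym u~w′) (~⇒≢ u~v) w≢w′)

    -- Matched pairs are split off one at a time, with `m` as fuel. The list always contains the
    -- partners of its members; this survives a removal because, by `third-unique`, no remaining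
    -- vertex has its partner in the removed pair.
    group : ∀ u m (xs : List (Fin n)) → length xs ≤ m → Unique xs → (∀ {x} → x ∈ xs → u ~ x) →
      (∀ {x w} → x ∈ xs → Triangle u x w → w ∈ xs) → ∃[ ys ] (ys ↭ xs × Grouped u ys)
    group u m xs len uniq nbrs closed with Any.any? (inTriangle? u) xs
    ... | no none = xs , refl↭ ,
      singles (All.tabulate λ x∈ → nbrs x∈ , λ t → none (lose x∈ t))
    ... | yes some with x , x∈ , w , t@(_ , _ , x~w) ← find some | m
    ...   | zero with xs
    ...     | [] = ⊥-elim (case x∈ of λ ())
    group u m xs len uniq nbrs closed | yes some | suc m′
      with zs , p ← ∈⇒↭ x∈
      with ∈-resp-↭ p (closed x∈ t)
    ... | here refl = ⊥-elim (~⇒≢ x~w refl)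
    ... | there w∈zs with zs′ , q ← ∈⇒↭ w∈zs =
      let all = trans↭ p (prep x q)
          u₁ = Unique-resp-↭ all uniq
          back : ∀ {z} → z ∈ zs′ → z ∈ xs
          back z∈ = ∈-resp-↭ (↭-sym all) (there (there z∈))
          ys , r , g = group u m′ zs′
            (≤-trans (n≤1+n _) (≤-pred (subst (_≤ suc m′) (↭-length all) len)))
            (case u₁ of λ { (_ ∷ _ ∷ u₂) → u₂ })
            (nbrs ∘ back)
            (λ {z} {v} z∈ t′ → case ∈-resp-↭ all (closed (back z∈) t′) of λ
              { (here refl) → ⊥-elim (head∉tail (case u₁ of λ { (_ ∷ u₂) → u₂ })
                  (subst (_∈ zs′) (third-unique (x-first t′) t) z∈))
              ; (there (here refl)) → ⊥-elim (head∉tail u₁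
                  (there (subst (_∈ zs′) (third-unique (x-first t′) (x-first t)) z∈)))
              ; (there (there v∈)) → v∈ })
      in x ∷ w ∷ ys , trans↭ (prep x (prep w r)) (↭-sym all) , pair t g
      where
      x-first : ∀ {u a b} → Triangle u a b → Triangle u b a
      x-first = triangle-swap

    neighbours-grouped : ∀ u → ∃[ ys ] (ys ↭ N u × Grouped u ys)
    neighbours-grouped u = group u (degree H u) (N u) ≤-refl (N-unique u) ∈N⁻
      λ _ (_ , u~w , _) → ∈N⁺ u~w

-- Discharging in an irreducible graph

module Discharging {n : ℕ} (H : Graph n) (k : ℕ) (32≤k : 32 ≤ k)
  (degree≤k : ∀ v → degree H v ≤ k)
  (no-C4 : C4-Free H)
  (W : Fin n → Set) (W? : ∀ v → Dec (W v))
  (W-closed : ∀ v → ¬ W v → k + 3 ≤ length (filter (λ x → ¬? (W? x)) (Neighbourhoods.N² H v)))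
  (irreducible : ∀ {u v} → W u → Graph._~_ H u v →
    (∀ y → Graph._~_ H y u → y ≢ v → Graph._~_ H y v ⊎ W v) → ⊥) where

  open Neighbourhoods H
  open Prices

  d : Fin n → ℕ
  d = degree H

  w : Fin n → ℕ
  w v = 𝟙 (W? v)

  _~²_ : Fin n → Fin n → Set
  _~²_ = Graph._~_ (square H)

  grouped : ∀ u → ∃[ ys ] (ys ↭ N u × Grouped u ys)
  grouped = neighbours-grouped no-C4

  -- Degree sums forced around vertices outside W

  -- The k + 3 or more square neighbours outside W are disjoint from `ws`, and both sets lie in
  -- `reach g`, whose length is at most the degree sum minus 2 for each pair.
  W-count : ∀ {v ys} → ¬ W v → ys ↭ N v → (g : Grouped v ys) → ∀ ws → Unique ws →
    (∀ {x} → x ∈ ws → W x × v ~² x) → k + 3 + length ws + 2 * #pairs g ≤ ∑[ ys ] d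
  W-count {v} {ys} ¬Wv p g ws uniq inW =
    lin 6 (λ k a b r t s → k ⊕ # 3 ≤' a ⇒ a ⊕ b ≤' r ⇒ r ⊕ t ≤' s ⇒ ⊢ k ⊕ # 3 ⊕ b ⊕ t ≤' s)
      k (length free) (length ws) (length (reach g)) (2 * #pairs g) (∑[ ys ] d)
      (W-closed v ¬Wv)
      (subst (_≤ length (reach g)) (length-++ free)
        (length-⊆ (Unique.++⁺ (Unique.filter⁺ _ (N²-unique v)) uniq
            λ (a , b) → proj₂ (∈-filter⁻ (λ x → ¬? (W? x)) {xs = N² v} a) (proj₁ (inW b)))
          λ m → N²⊆reach g p (case ∈-++⁻ free m of λ
            { (inj₁ a) → ∈N²⁻ (proj₁ (∈-filter⁻ (λ x → ¬? (W? x)) {xs = N² v} a))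
            ; (inj₂ b) → proj₂ (inW b) })))
      (reach-length g)
    where free = filter (λ x → ¬? (W? x)) (N² v)

  W-count-neighbours : ∀ {v ys} → ¬ W v → ys ↭ N v → (g : Grouped v ys) →
    k + 3 + ∑[ ys ] w + 2 * #pairs g ≤ ∑[ ys ] d
  W-count-neighbours {v} {ys} ¬Wv p g =
    subst (λ z → k + 3 + z + 2 * #pairs g ≤ ∑[ ys ] d) (length-filter≡Σ W? ys)
      (W-count ¬Wv p g (filter W? ys) (Unique.filter⁺ W? (Unique-resp-↭ (↭-sym p) (N-unique v)))
        λ m → let a , b = ∈-filter⁻ W? {xs = ys} m in b , inj₁ (∈N⁻ (∈-resp-↭ p a)))

  W-count-triangle : ∀ {v x y} → ¬ W v → Triangle v x y → ∀ xs → xs ↭ N v → ∀ ws → Unique ws →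
    (∀ {x} → x ∈ ws → W x × v ~² x) → k + 5 + length ws ≤ ∑[ xs ] d
  W-count-triangle {v} {x} {y} ¬Wv t xs q ws uniq inW with ys , p , g ← grouped v =
    subst (k + 5 + length ws ≤_) (Σ-↭ d (trans↭ p (↭-sym q)))
      (lin 4 (λ k b t s → k ⊕ # 3 ⊕ b ⊕ 2 · t ≤' s ⇒ # 1 ≤' t ⇒ ⊢ k ⊕ # 5 ⊕ b ≤' s)
        k (length ws) (#pairs g) (∑[ ys ] d) (W-count ¬Wv p g ws uniq inW) (some-pair g p))
    where
    some-pair : ∀ {ys} (g : Grouped v ys) → ys ↭ N v → 1 ≤ #pairs g
    some-pair (singles as) p = ⊥-elim (proj₂ (All.lookup as (∈-resp-↭ (↭-sym p) (∈N⁺ (proj₁ t)))) (y , t))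
    some-pair (pair _ _) p = s≤s z≤n

  W-independent : ∀ {u v} → W u → u ~ v → ¬ W v
  W-independent Wu u~v Wv = irreducible Wu u~v λ _ _ _ → inj₂ Wv

  -- A leaf in W makes its edge reducible, as it has no other neighbour. A leaf outside W sees at
  -- most `d v ≤ k` vertices within distance two.
  no-leaf : ∀ u → d u ≢ 1
  no-leaf u du≡1 with grouped u
  ... | [] , p , g = case trans (↭-length p) du≡1 of λ ()
  ... | _ ∷ _ ∷ _ , p , g = case trans (↭-length p) du≡1 of λ ()
  ... | v ∷ [] , p , g with W? u
  ...   | yes Wu = irreducible Wu (∈N⁻ (∈-resp-↭ p (here refl))) λ y y~u y≢v →
            case ∈-resp-↭ (↭-sym p) (∈N⁺ (~-sym y~u)) of λ { (here y≡v) → ⊥-elim (y≢v y≡v) }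
  ...   | no ¬Wu = lin 4 (λ k w t dv → k ⊕ # 3 ⊕ w ⊕ t ≤' dv ⊕ # 0 ⇒ dv ≤' k ⇒ absurd)
            k _ _ (d v) (W-count-neighbours ¬Wu p g) (degree≤k v)

  ~⇒2≤d : ∀ {u v} → u ~ v → 2 ≤ d u
  ~⇒2≤d {u} u~v = ≤∧≢⇒< (∈-length (∈N⁺ u~v)) (no-leaf u ∘ sym)

  neighbours-↭ : ∀ {u xs} → Unique xs → (∀ {x} → x ∈ xs → u ~ x) → d u ≤ length xs → xs ↭ N u
  neighbours-↭ uniq nbrs len = ⊆⇒↭ uniq (∈N⁺ ∘ nbrs) len

  two-neighbours : ∀ {u x y} → d u ≡ 2 → u ~ x → u ~ y → x ≢ y → x ∷ y ∷ [] ↭ N u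
  two-neighbours du≡2 u~x u~y x≢y = neighbours-↭ ((x≢y ∷ []) ∷ [] ∷ [])
    (λ { (here refl) → u~x ; (there (here refl)) → u~y }) (≤-reflexive du≡2)

  -- The only other neighbour `y` of `u` is adjacent to `x`, so the edge `ux` would be reducible.
  triangular-2∉W : ∀ {u x y} → d u ≡ 2 → Triangle u x y → ¬ W u
  triangular-2∉W {u} {x} {y} du≡2 (u~x , u~y , x~y) Wu = irreducible Wu u~x λ z z~u z≢x →
    case ∈-resp-↭ (↭-sym (two-neighbours du≡2 u~x u~y (~⇒≢ x~y))) (∈N⁺ (~-sym z~u)) of λ
      { (here z≡x) → ⊥-elim (z≢x z≡x) ; (there (here refl)) → inj₁ (~-sym x~y) }

  triangular-2 : ∀ {u x y} → d u ≡ 2 → Triangle u x y → ∀ ws → Unique ws →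
    (∀ {x} → x ∈ ws → W x × u ~² x) → k + 5 + length ws ≤ d x + d y
  triangular-2 {u} {x} {y} du≡2 t@(u~x , u~y , x~y) ws uniq inW =
    subst (k + 5 + length ws ≤_) (cong (d x +_) (+-identityʳ (d y)))
      (W-count-triangle (triangular-2∉W du≡2 t) t _ (two-neighbours du≡2 u~x u~y (~⇒≢ x~y)) ws uniq inW)

  triangular-2-sum : ∀ {u x y} → d u ≡ 2 → Triangle u x y → k + 5 ≤ d x + d y
  triangular-2-sum {x = x} {y} du≡2 t = subst (_≤ d x + d y) (+-identityʳ (k + 5))
    (triangular-2 du≡2 t [] [] λ ())

  strong-2 : ∀ {u x y ws} → d u ≡ 2 → ¬ W u → u ~ x → u ~ y → x ≢ y → Unique ws →
    (∀ {x} → x ∈ ws → W x × u ~² x) → k + 3 + length ws ≤ d x + d y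
  strong-2 {u} {x} {y} {ws} du≡2 ¬Wu u~x u~y x≢y uniq inW with ys , p , g ← grouped u =
    lin 6 (λ k a t s x y → k ⊕ # 3 ⊕ a ⊕ t ≤' s ⇒ s ≡' x ⊕ (y ⊕ # 0) ⇒ ⊢ k ⊕ # 3 ⊕ a ≤' x ⊕ y)
      k (length ws) (2 * #pairs g) (∑[ ys ] d) (d x) (d y) (W-count ¬Wu p g ws uniq inW)
      (Σ-↭ d (trans↭ p (↭-sym (two-neighbours du≡2 u~x u~y x≢y))))

  other-neighbour : ∀ {u x} → d u ≡ 2 → u ~ x → ∃[ y ] (u ~ y × x ≢ y)
  other-neighbour {u} {x} du≡2 u~x =
    let y , y∈ , x≢y = other (N-unique u) du≡2 (∈N⁺ u~x) in y , ∈N⁻ y∈ , x≢y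
    where
    other : ∀ {xs} → Unique xs → length xs ≡ 2 → x ∈ xs → ∃[ y ] (y ∈ xs × x ≢ y)
    other {a ∷ b ∷ []} ((a≢b ∷ _) ∷ _) _ (here refl) = b , there (here refl) , a≢b
    other {a ∷ b ∷ []} ((a≢b ∷ _) ∷ _) _ (there (here refl)) = a , here refl , a≢b ∘ sym

  -- Of two adjacent 2-vertices at least one is outside W, and its neighbours would have total
  -- degree at most 2 + k, below the required k + 3.
  two-next-to-≥3 : ∀ {u x} → d u ≡ 2 → u ~ x → 3 ≤ d x
  two-next-to-≥3 {u} {x} du≡2 u~x with 3 ≤? d x
  ... | yes h = h
  ... | no h with W? u | ≤-antisym (≤-pred (≰⇒> h)) (~⇒2≤d (~-sym u~x))
  ...   | no ¬Wu | dx≡2 with y , u~y , x≢y ← other-neighbour du≡2 u~x =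
            ⊥-elim (lin 3 (λ k x y → k ⊕ # 3 ⊕ # 0 ≤' x ⊕ y ⇒ x ≡' # 2 ⇒ y ≤' k ⇒ absurd) k (d x) (d y)
              (strong-2 du≡2 ¬Wu u~x u~y x≢y [] λ ()) dx≡2 (degree≤k y))
  ...   | yes Wu | dx≡2 with y , x~y , u≢y ← other-neighbour dx≡2 (~-sym u~x) =
            ⊥-elim (lin 3 (λ k u y → k ⊕ # 3 ⊕ # 1 ≤' u ⊕ y ⇒ u ≡' # 2 ⇒ y ≤' k ⇒ absurd) k (d u) (d y)
              (strong-2 dx≡2 (W-independent Wu u~x) (~-sym u~x) x~y u≢y ([] ∷ [])
                λ { (here refl) → Wu , inj₁ (~-sym u~x) }) du≡2 (degree≤k y))

  -- A needy vertex of a triangle passes on 60 to its neighbour outside the triangle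
  -- and recovers it from the triangle.
  Needy : Fin n → Set
  Needy v = d v ≡ 3 × ∃[ a ] (v ~ a × d a ≡ 2 × W a)

  opaque
    needy? : ∀ v → Dec (Needy v)
    needy? v = d v ℕ.≟ 3 ×-dec any? λ a → v ~? a ×-dec d a ℕ.≟ 2 ×-dec W? a

  needy∉W : ∀ {v} → Needy v → ¬ W v
  needy∉W (_ , a , v~a , _ , Wa) = W-independent Wa (~-sym v~a)

  -- The 2-vertex of `nd` lies in W, so it is on no triangle and differs from `x` and `y`.
  needy-pendant : ∀ {v x y} (nd : Needy v) → Triangle v x y → x ∷ y ∷ proj₁ (proj₂ nd) ∷ [] ↭ N v
  needy-pendant {v} {x} {y} (dv≡3 , a , v~a , da≡2 , Wa) t@(v~x , v~y , x~y) = neighbours-↭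
    ((~⇒≢ x~y ∷ (λ { refl → triangular-2∉W da≡2 (triangle-rot t) Wa }) ∷ [])
      ∷ ((λ { refl → triangular-2∉W da≡2 (triangle-rot (triangle-swap t)) Wa }) ∷ []) ∷ [] ∷ [])
    (λ { (here refl) → v~x ; (there (here refl)) → v~y ; (there (there (here refl))) → v~a })
    (≤-reflexive dv≡3)

  needy-count : ∀ {v x y} → Needy v → Triangle v x y → ∀ ws → Unique ws →
    (∀ {x} → x ∈ ws → W x × v ~² x) → k + 3 + length ws ≤ d x + d y
  needy-count {v} {x} {y} nd@(_ , a , _ , da≡2 , _) t ws uniq inW =
    lin 5 (λ k l a x y → k ⊕ # 5 ⊕ l ≤' x ⊕ (y ⊕ (a ⊕ # 0)) ⇒ a ≡' # 2 ⇒ ⊢ k ⊕ # 3 ⊕ l ≤' x ⊕ y)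
      k (length ws) (d a) (d x) (d y)
      (W-count-triangle (needy∉W nd) t _ (needy-pendant nd t) ws uniq inW) da≡2

  -- Of the k + 5 forced by the triangle, the pendant 2-vertex supplies 2; being in W, it adds 1 to
  -- the demand.
  needy-sum : ∀ {v x y} → Needy v → Triangle v x y → k + 4 ≤ d x + d y
  needy-sum {v} {x} {y} nd@(_ , a , v~a , _ , Wa) t =
    lin 3 (λ k x y → k ⊕ # 3 ⊕ # 1 ≤' x ⊕ y ⇒ ⊢ k ⊕ # 4 ≤' x ⊕ y) k (d x) (d y)
      (needy-count nd t (a ∷ []) ([] ∷ []) λ { (here refl) → Wa , inj₁ v~a })

  -- Charges sent along edges and received by triangles

  true⇒ : ∀ {P : Set} (P? : Dec P) → does P? ≡ true → P
  true⇒ (yes p) _ = p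

  price-of : (u v x : Fin n) → ℕ
  price-of u v x = price (d u) (d v ⊓ d x) (d v ⊔ d x) (does (W? u)) (does (needy? u))
    (does (needy? v) ∨ does (needy? x))

  -- The charge that u sends along uv, plus 120 to keep it nonnegative; what u gives
  -- to a triangle is sent in equal halves along its two edges of the triangle.
  cost : (u v : Fin n) → ℕ
  cost u v with inTriangle? u v
  ... | yes (x , _) = price-of u v x
  ... | no _ = (120 + pay (d u) (d v) (does (W? v))) ∸ pay (d v) (d u) (does (W? u))

  cost-triangle : ∀ {u v x} → Triangle u v x → cost u v ≡ price-of u v x
  cost-triangle {u} {v} {x} t with inTriangle? u v
  ... | yes (x′ , t′) = cong (price-of u v) (third-unique no-C4 t′ t)
  ... | no none = ⊥-elim (none (x , t))

  cost-single : ∀ {u v} → ¬ InTriangle u v →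
    cost u v ≡ (120 + pay (d u) (d v) (does (W? v))) ∸ pay (d v) (d u) (does (W? u))
  cost-single {u} {v} none with inTriangle? u v
  ... | yes t = ⊥-elim (none t)
  ... | no _ = refl

  price-of-comm : ∀ u v x → price-of u v x ≡ price-of u x v
  price-of-comm u v x rewrite ⊓-comm (d v) (d x) | ⊔-comm (d v) (d x)
    | ∨-comm (does (needy? v)) (does (needy? x)) = refl

  TrianglePaid : Fin n → Fin n → Fin n → Set
  TrianglePaid u v x = 450 ≤ price-of u v x + price-of v u x + price-of x u v

  paid-swap : ∀ {u v x} → TrianglePaid u v x → TrianglePaid v u x
  paid-swap {u} {v} {x} h rewrite price-of-comm x v u | +-comm (price-of v u x) (price-of u v x) = h

  paid-rot : ∀ {u v x} → TrianglePaid u v x → TrianglePaid u x v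
  paid-rot {u} {v} {x} h rewrite price-of-comm u x v | price-of-comm x u v | price-of-comm v u x =
    subst (450 ≤_) (lin 3 (λ a b c → ⊢ a ⊕ b ⊕ c ≡' a ⊕ c ⊕ b) (price-of u v x) (price-of v x u)
      (price-of x v u)) h

  paid-sorted : ∀ {u v x} → Triangle u v x → d u ≤ d v → d v ≤ d x → TrianglePaid u v x
  paid-sorted {u} {v} {x} t@(u~v , u~x , v~x) h g
    rewrite m≤n⇒m⊓n≡m g | m≤n⇒m⊔n≡n g
          | m≤n⇒m⊓n≡m (≤-trans h g) | m≤n⇒m⊔n≡n (≤-trans h g)
          | m≤n⇒m⊓n≡m h | m≤n⇒m⊔n≡n h =
    triangle-paid (does (W? u)) (does (W? v)) (does (W? x)) (does (needy? u)) (does (needy? v))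
      (does (needy? x))
      32≤k (~⇒2≤d u~v) h g (degree≤k x)
      (λ du≤2 → triangular-2-sum (≤-antisym du≤2 (~⇒2≤d u~v)) t)
      (λ a b → W-independent (true⇒ (W? u) a) u~v (true⇒ (W? v) b))
      (λ a b → W-independent (true⇒ (W? u) a) u~x (true⇒ (W? x) b))
      (λ a b → W-independent (true⇒ (W? v) a) v~x (true⇒ (W? x) b))
      (λ a → needy-sum (true⇒ (needy? u) a) t)
      (λ a → needy-sum (true⇒ (needy? v) a) (triangle-swap (triangle-rot t)))

  paid : ∀ {u v x} → Triangle u v x → TrianglePaid u v x
  paid {u} {v} {x} t with ≤-total (d u) (d v) | ≤-total (d v) (d x) | ≤-total (d u) (d x)
  ... | inj₁ a | inj₁ b | _ = paid-sorted t a b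
  ... | inj₁ a | inj₂ b | inj₁ c = paid-rot {u} {x} {v} (paid-sorted (triangle-swap t) c b)
  ... | inj₁ a | inj₂ b | inj₂ c =
    paid-rot {u} {x} {v} (paid-swap {x} {u} {v} (paid-sorted (triangle-rot (triangle-rot t)) c a))
  ... | inj₂ a | inj₁ b | inj₁ c = paid-swap {v} {u} {x} (paid-sorted (triangle-swap (triangle-rot t)) a c)
  ... | inj₂ a | inj₁ b | inj₂ c =
    paid-swap {v} {u} {x} (paid-rot {v} {x} {u} (paid-sorted (triangle-rot t) b c))
  ... | inj₂ a | inj₂ b | _ = paid-rot {u} {x} {v} (paid-swap {x} {u} {v}
    (paid-rot {x} {v} {u} (paid-sorted (triangle-swap (triangle-rot (triangle-rot t))) b a)))

  -- Each vertex is charged its rate along both of its triangle edges, hence 900 = 2 · 450, which is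
  -- six offsets of 120 plus the 180 for the triangle.
  six-costs : ∀ {u v x} → Triangle u v x →
    900 ≤ cost u v + cost v u + (cost u x + cost x u) + (cost v x + cost x v)
  six-costs {u} {v} {x} t
    rewrite cost-triangle t | cost-triangle (triangle-swap t) | price-of-comm u x v
          | cost-triangle (triangle-rot t) | cost-triangle (triangle-swap (triangle-rot t))
            | price-of-comm v x u
          | cost-triangle (triangle-rot (triangle-rot t))
          | cost-triangle (triangle-swap (triangle-rot (triangle-rot t))) | price-of-comm x v u =
    lin 3 (λ a b c → # 450 ≤' a ⊕ b ⊕ c ⇒ ⊢ # 900 ≤' a ⊕ b ⊕ (a ⊕ c) ⊕ (b ⊕ c))
      (price-of u v x) (price-of v u x) (price-of x u v) (paid t)

  -- The two opposite transfers cancel and leave the offsets; truncated subtraction can only raise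
  -- the sum.
  two-costs : ∀ {u v} → ¬ InTriangle u v → 240 ≤ cost u v + cost v u
  two-costs {u} {v} none
    rewrite cost-single none | cost-single {v} {u} (λ (x , t) → none (x , triangle-swap (triangle-rot t)))
    with pay (d u) (d v) (does (W? v)) | pay (d v) (d u) (does (W? u))
  ... | p | q = lin 4 (λ p q a b → # 120 ⊕ p ≤' q ⊕ a ⇒ # 120 ⊕ q ≤' p ⊕ b ⇒ ⊢ # 240 ≤' a ⊕ b)
    p q (120 + p ∸ q) (120 + q ∸ p) (m≤n+m∸n (120 + p) q) (m≤n+m∸n (120 + q) p)

  cost-large : ∀ {u x} → 6 ≤ d u → cost u x ≤ 120 + cap (d u)
  cost-large {u} {x} h with inTriangle? u x
  ... | yes (y , t) = ≤-reflexive (price-large h)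
  ... | no _ = ≤-trans (m∸n≤m (120 + pay (d u) (d x) (does (W? x))) (pay (d x) (d u) (does (W? u))))
    (+-monoʳ-≤ 120 (pay≤cap (d u) (d x) (does (W? x)) h))

  -- Nonnegative final charge: with the offset of 120 per edge removed, u gives away at most 120
  -- d(u) - 360, which is 2d(u) - 6 in units of 1/60.
  Affordable : Fin n → Set
  Affordable u = ∑[ N u ] (cost u) + 360 ≤ 240 * d u

  large-affordable : ∀ u → 6 ≤ d u → Affordable u
  large-affordable u h =
    lin 3 (λ s d c → s ≤' 120 · d ⊕ c ⇒ c ⊕ # 360 ≤' 120 · d ⇒ ⊢ s ⊕ # 360 ≤' 240 · d)
      _ (d u) (d u * cap (d u))
      (≤-trans (Σ-mono (N u) {g = λ _ → 120 + cap (d u)} (λ _ → cost-large h))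
        (≤-reflexive (trans (Σ-const (N u) _)
          (trans (*-distribˡ-+ (d u) 120 _) (cong (_+ d u * cap (d u)) (*-comm (d u) 120))))))
      (cap-affordable (d u) h)

  -- For u of degree 3 to 5 and ux in no triangle.  A weak neighbour is a 2-vertex in W,
  -- a strong one a 2-vertex outside W.
  data SingleView (u x : Fin n) : ℕ → Set where
    weak   : d x ≡ 2 → W x → SingleView u x 180
    strong : d x ≡ 2 → ¬ W x → SingleView u x 132
    plain  : 3 ≤ d x → d x ≤ 11 → SingleView u x 120
    big    : 12 ≤ d x → SingleView u x 30

  singleView : ∀ {u x} → 3 ≤ d u → d u ≤ 5 → u ~ x → ¬ InTriangle u x → SingleView u x (cost u x)
  singleView {u} {x} 3≤du du≤5 u~x none rewrite cost-single none with d x ≤? 2 | 12 ≤? d x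
  ... | yes p | _ rewrite pay-none {d x} {d u} {does (W? u)} 3≤du (≤-trans p (≤ᵇ⇒≤ 2 11 _)) with W? x
  ...   | yes Wx rewrite pay-weak {d u} p = weak (≤-antisym p (~⇒2≤d (~-sym u~x))) Wx
  ...   | no ¬Wx rewrite pay-strong-low p du≤5 = strong (≤-antisym p (~⇒2≤d (~-sym u~x))) ¬Wx
  singleView {u} {x} 3≤du du≤5 u~x none | no p | yes q
    rewrite pay-none {d u} {d x} {does (W? x)} (≰⇒> p) (≤-trans du≤5 (≤ᵇ⇒≤ 5 11 _))
          | pay-gift {d x} {d u} {does (W? u)} 3≤du du≤5 q = big q
  singleView {u} {x} 3≤du du≤5 u~x none | no p | no q
    rewrite pay-none {d u} {d x} {does (W? x)} (≰⇒> p) (≤-trans du≤5 (≤ᵇ⇒≤ 5 11 _))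
          | pay-none {d x} {d u} {does (W? u)} 3≤du (≤-pred (≰⇒> q)) = plain (≰⇒> p) (≤-pred (≰⇒> q))

  two-affordable : ∀ u → d u ≡ 2 → Affordable u
  two-affordable u du≡2 = go (grouped u)
    where
    enough : ∀ {x y a b} → x ∷ y ∷ [] ↭ N u → cost u x ≡ a → cost u y ≡ b → a + b ≤ 120 → Affordable u
    enough {x} {y} {a} {b} p ea eb h = subst₂ (λ s t → s + 360 ≤ 240 * t)
      (trans (cong₂ _+_ (sym ea) (trans (sym (+-identityʳ b)) (cong (_+ 0) (sym eb)))) (Σ-↭ (cost u) p))
      (sym du≡2) (+-monoˡ-≤ 360 h)

    sixty : ∀ {lo hi w nd nn} → price (d u) lo hi w nd nn ≡ 60
    sixty = price-tiny (≤-reflexive du≡2)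

    cost-2 : ∀ {x} → u ~ x → ¬ InTriangle u x → cost u x ≡ 120 ∸ pay (d x) (d u) (does (W? u))
    cost-2 {x} u~x none = trans (cost-single none) (cong (λ z → 120 + z ∸ pay (d x) (d u) (does (W? u)))
      (pay-none (two-next-to-≥3 du≡2 u~x) (≤-trans (≤-reflexive du≡2) (≤ᵇ⇒≤ 2 11 _))))

    pays : ∀ {x y} → u ~ x → u ~ y → x ≢ y →
      120 ≤ pay (d x) (d u) (does (W? u)) + pay (d y) (d u) (does (W? u))
    pays {x} {y} u~x u~y x≢y with W? u
    ... | yes _ = ≤-reflexive (sym (cong₂ _+_ (pay-weak {d x} (≤-reflexive du≡2))
      (pay-weak {d y} (≤-reflexive du≡2))))
    ... | no ¬Wu = strong-pays (d x) (d y) (≤-reflexive du≡2)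
      (lin 3 (λ k x y → # 32 ≤' k ⇒ k ⊕ # 3 ⊕ # 0 ≤' x ⊕ y ⇒ ⊢ # 35 ≤' x ⊕ y) k (d x) (d y) 32≤k
        (strong-2 du≡2 ¬Wu u~x u~y x≢y [] λ ()))

    go : ∃[ ys ] (ys ↭ N u × Grouped u ys) → Affordable u
    go ([] , p , g) = case trans (↭-length p) du≡2 of λ ()
    go (_ ∷ [] , p , g) = case trans (↭-length p) du≡2 of λ ()
    go (_ ∷ _ ∷ _ ∷ _ , p , g) = case trans (↭-length p) du≡2 of λ ()
    go (x ∷ y ∷ [] , p , pair t _) =
      enough p (trans (cost-triangle t) sixty) (trans (cost-triangle (triangle-swap t)) sixty) ≤-refl
    go (x ∷ y ∷ [] , p , singles ((u~x , nx) ∷ (u~y , ny) ∷ [])) =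
      enough p (cost-2 u~x nx) (cost-2 u~y ny)
        (lin 4 (λ p q a b → a ⊕ p ≡' # 120 ⇒ b ⊕ q ≡' # 120 ⇒ # 120 ≤' p ⊕ q ⇒ ⊢ a ⊕ b ≤' # 120)
          (pay (d x) (d u) (does (W? u))) (pay (d y) (d u) (does (W? u)))
          (120 ∸ pay (d x) (d u) (does (W? u))) (120 ∸ pay (d y) (d u) (does (W? u)))
          (m∸n+n≡m (pay≤120 (d x) (d u) (does (W? u)))) (m∸n+n≡m (pay≤120 (d y) (d u) (does (W? u))))
          (pays u~x u~y λ { refl → head∉tail (Unique-resp-↭ (↭-sym p) (N-unique u)) (here refl) }))

  ⊓+⊔ : ∀ a b → (a ⊓ b) + (a ⊔ b) ≡ a + b
  ⊓+⊔ a b with ≤-total a b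
  ... | inj₁ h rewrite m≤n⇒m⊓n≡m h | m≤n⇒m⊔n≡n h = refl
  ... | inj₂ h rewrite m≥n⇒m⊓n≡n h | m≥n⇒m⊔n≡m h = +-comm b a

  -- The two neighbours of `a` have total degree at least k + 5, and `b` contributes at most k.
  triangular-2⇒5≤ : ∀ {a b u} → d a ≡ 2 → Triangle a b u → 5 ≤ d u
  triangular-2⇒5≤ {a} {b} {u} da≡2 t =
    lin 3 (λ k b u → k ⊕ # 5 ≤' b ⊕ u ⇒ b ≤' k ⇒ ⊢ # 5 ≤' u) k (d b) (d u)
    (triangular-2-sum da≡2 t) (degree≤k b)

  -- The index is the rate of u, and each constructor keeps what the budget argument uses. The
  -- bounds 34, 16 and 10 arise as 5 for the lower degree plus 29, 11 or 5, the top of the bracket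
  -- of the higher one.
  data PairView (u x y : Fin n) : ℕ → Set where
    with-2      : d u ≡ 5 → d x ≡ 2 ⊎ d y ≡ 2 → PairView u x y 162
    paid-for    : PairView u x y 90
    huge        : ¬ Needy u ⊎ 4 ≤ d u → PairView u x y 111
    subsidising : 4 ≤ d u → Needy x ⊎ Needy y → PairView u x y 132
    neutral     : W u ⊎ d x + d y ≤ 34 → PairView u x y 120
    mid         : ¬ W u → d x + d y ≤ 16 → PairView u x y 150
    low         : ¬ W u → d x + d y ≤ 10 → PairView u x y 165

  pairView : ∀ {u x y} → 3 ≤ d u → d u ≤ 5 → Triangle u x y → PairView u x y (price-of u x y)
  pairView {u} {x} {y} 3≤du du≤5 t@(u~x , u~y , x~y)
    with d x ⊓ d y ≤? 2 | 6 ≤? d x ⊓ d y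
  ... | yes lo≤2 | _ = subst (PairView u x y) (sym (price-by-tiny 3≤du du≤5 lo≤2))
    (tiny (⊓-sel (d x) (d y)))
    where
    tiny : d x ⊓ d y ≡ d x ⊎ d x ⊓ d y ≡ d y → PairView u x y 162
    tiny (inj₁ e) = let dx≡2 = ≤-antisym (subst (_≤ 2) e lo≤2) (~⇒2≤d x~y)
      in with-2 (≤-antisym du≤5 (triangular-2⇒5≤ dx≡2 (triangle-rot t))) (inj₁ dx≡2)
    tiny (inj₂ e) = let dy≡2 = ≤-antisym (subst (_≤ 2) e lo≤2) (~⇒2≤d (~-sym x~y))
      in with-2 (≤-antisym du≤5 (triangular-2⇒5≤ dy≡2 (triangle-swap (triangle-rot (triangle-rot t)))))
        (inj₂ dy≡2)
  ... | no _ | yes 6≤lo = subst (PairView u x y) (sym (price-by-large 3≤du du≤5 6≤lo)) paid-for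
  ... | no lo≰2 | no 6≰lo = subst (PairView u x y)
      (sym (price-share 3≤du du≤5 (≰⇒> lo≰2) (≤-pred (≰⇒> 6≰lo)))) (shared (30 ≤? hi) (12 ≤? hi) (6 ≤? hi))
    where
    hi = d x ⊔ d y
    nd = does (needy? x) ∨ does (needy? y)
    sum≤ : ∀ {m} → hi ≤ m → d x + d y ≤ 5 + m
    sum≤ h = ≤-trans (≤-reflexive (sym (⊓+⊔ (d x) (d y)))) (+-mono-≤ (≤-pred (≰⇒> 6≰lo)) h)
    in-W? : ∀ {m} → (¬ W u → PairView u x y m) → PairView u x y (if does (W? u) then 120 else m)
    in-W? f with W? u
    ... | yes Wu = neutral (inj₁ Wu)
    ... | no ¬Wu = f ¬Wu
    at-huge : PairView u x y (if d u ≤ᵇ 3 then (if does (needy? u) then 90 else 111) else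
      (if nd then 132 else 111))
    at-huge with d u ≤ᵇ 3 | ≤⇒≤ᵇ {d u} {3}
    ... | true | _ with needy? u
    ...   | yes _ = paid-for
    ...   | no ¬nd = huge (inj₁ ¬nd)
    at-huge | false | f with needy? x | needy? y | ≰⇒> {d u} {3} f
    ... | yes a | _ | 4≤ = subsidising 4≤ (inj₁ a)
    ... | no _ | yes b | 4≤ = subsidising 4≤ (inj₂ b)
    ... | no _ | no _ | 4≤ = huge (inj₂ 4≤)
    shared : Dec (30 ≤ hi) → Dec (12 ≤ hi) → Dec (6 ≤ hi) →
      PairView u x y (share hi (d u ≤ᵇ 3) (does (W? u)) (does (needy? u)) nd)
    shared (yes h) _ _ = subst (PairView u x y) (sym (share-huge h)) at-huge
    shared (no g) (yes h) _ = subst (PairView u x y) (sym (share-big h (≰⇒> g)))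
      (neutral (inj₂ (sum≤ (≤-pred (≰⇒> g)))))
    shared _ (no g) (yes h) = subst (PairView u x y) (sym (share-mid h (≰⇒> g)))
      (in-W? λ ¬Wu → mid ¬Wu (sum≤ (≤-pred (≰⇒> g))))
    shared _ _ (no g) = subst (PairView u x y) (sym (share-none (≰⇒> g)))
      (in-W? λ ¬Wu → low ¬Wu (sum≤ (≤-pred (≰⇒> g))))

  -- Both `e` and `f` lie in W at distance two from `z` via `u`. They raise the demand on d(u) +
  -- d(v) to k + 5, but the sum is at most 4 + k.
  needy⇒¬two-weak : ∀ {u z v e f} → d u ≡ 4 → Needy z → Triangle u z v → e ≢ f →
    u ~ e → W e → ¬ InTriangle u e → u ~ f → W f → ¬ InTriangle u f → ⊥
  needy⇒¬two-weak {u} {z} {v} {e} {f} du≡4 nd t@(u~z , u~v , z~v) e≢f u~e We ne u~f Wf nf =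
    lin 3 (λ k u v → k ⊕ # 3 ⊕ # 2 ≤' v ⊕ u ⇒ u ≡' # 4 ⇒ v ≤' k ⇒ absurd) k (d u) (d v)
      (needy-count nd (triangle-rot t) (e ∷ f ∷ []) ((e≢f ∷ []) ∷ [] ∷ [])
        λ { (here refl) → We , near u~e ne ; (there (here refl)) → Wf , near u~f nf })
      du≡4 (degree≤k v)
    where
    near : ∀ {e} → u ~ e → ¬ InTriangle u e → z ~² e
    near u~e ne = inj₂ ((λ { refl → ne (v , t) }) , (λ z~e → ne (z , u~e , u~z , ~-sym z~e)) , u ,
      ~-sym u~z , u~e)

  -- A neighbour in W would be within distance two of the 2-vertex.
  with-2⇒¬weak : ∀ {u x y e} → d u ≡ 5 → Triangle u x y → d x ≡ 2 → u ~ e → ¬ InTriangle u e → ¬ W e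
  with-2⇒¬weak {u} {x} {y} {e} du≡5 t@(u~x , _) dx≡2 u~e ne We =
    lin 3 (λ k u y → k ⊕ # 5 ⊕ # 1 ≤' y ⊕ u ⇒ u ≡' # 5 ⇒ y ≤' k ⇒ absurd) k (d u) (d y)
      (triangular-2 dx≡2 (triangle-rot t) (e ∷ []) ([] ∷ []) λ { (here refl) → We ,
        inj₂ ((λ { refl → ne (y , t) }) , (λ x~e → ne (x , u~e , u~x , ~-sym x~e)) , u , ~-sym u~x , u~e) })
      du≡5 (degree≤k y)

  from-grouped : ∀ {u ys} → ys ↭ N u → ∑[ ys ] (cost u) + 360 ≤ 240 * length ys → Affordable u
  from-grouped {u} p h = subst₂ (λ s l → s + 360 ≤ 240 * l) (Σ-↭ (cost u) p) (↭-length p) h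

  -- Budgets of vertices of degree 3 to 5

  module Small {u : Fin n} (3≤du : 3 ≤ d u) (du≤5 : d u ≤ 5) where

    Single : Fin n → Set
    Single x = u ~ x × ¬ InTriangle u x

    single≤180 : ∀ {x} → Single x → cost u x ≤ 180
    single≤180 {x} (u~x , nx) with cost u x | singleView 3≤du du≤5 u~x nx
    ... | _ | weak _ _ = ≤-refl
    ... | _ | strong _ _ = ≤ᵇ⇒≤ 132 180 _
    ... | _ | plain _ _ = ≤ᵇ⇒≤ 120 180 _
    ... | _ | big _ = ≤ᵇ⇒≤ 30 180 _

    single≤132 : ∀ {x} → Single x → ¬ W x → cost u x ≤ 132
    single≤132 {x} (u~x , nx) ¬Wx with cost u x | singleView 3≤du du≤5 u~x nx
    ... | _ | weak _ Wx = ⊥-elim (¬Wx Wx)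
    ... | _ | strong _ _ = ≤-refl
    ... | _ | plain _ _ = ≤ᵇ⇒≤ 120 132 _
    ... | _ | big _ = ≤ᵇ⇒≤ 30 132 _

    weak-or-cheap : ∀ {x} → Single x → (d x ≡ 2 × W x) ⊎ cost u x ≤ 132
    weak-or-cheap {x} (u~x , nx) with cost u x | singleView 3≤du du≤5 u~x nx
    ... | _ | weak e Wx = inj₁ (e , Wx)
    ... | _ | strong _ _ = inj₂ ≤-refl
    ... | _ | plain _ _ = inj₂ (≤ᵇ⇒≤ 120 132 _)
    ... | _ | big _ = inj₂ (≤ᵇ⇒≤ 30 132 _)

    two-or-neutral : ∀ {x} → Single x → d x ≡ 2 ⊎ cost u x ≤ 120
    two-or-neutral {x} (u~x , nx) with cost u x | singleView 3≤du du≤5 u~x nx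
    ... | _ | weak e _ = inj₁ e
    ... | _ | strong e _ = inj₁ e
    ... | _ | plain _ _ = inj₂ ≤-refl
    ... | _ | big _ = inj₂ (≤ᵇ⇒≤ 30 120 _)

    -- The trade-off that lets a small vertex outside W pay: cheap neighbours
    -- have large degree, and W-count forces the degrees to be large in total.
    big-or-tradeoff : ∀ {x} → Single x → (12 ≤ d x × cost u x ≡ 30) ⊎ cost u x + 6 * d x ≤ 186 + 6 * w x
    big-or-tradeoff {x} (u~x , nx) with cost u x | singleView 3≤du du≤5 u~x nx
    -- The constants make two cases tight: a plain neighbour of degree 11 gives 120 + 66 = 186, a
    -- weak one 180 + 12 = 186 + 6.
    ... | _ | big h = inj₁ (h , refl)
    ... | _ | strong e _ = inj₂ (lin 2 (λ x v → x ≡' # 2 ⇒ ⊢ # 132 ⊕ 6 · x ≤' # 186 ⊕ 6 · v) (d x) (w x) e)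
    ... | _ | plain _ h = inj₂ (lin 2 (λ x v → x ≤' # 11 ⇒ ⊢ # 120 ⊕ 6 · x ≤' # 186 ⊕ 6 · v) (d x) (w x) h)
    ... | _ | weak e Wx with W? x
    ...   | yes _ = inj₂ (lin 1 (λ x → x ≡' # 2 ⇒ ⊢ # 180 ⊕ 6 · x ≤' # 192) (d x) e)
    ...   | no ¬Wx = ⊥-elim (¬Wx Wx)

    singles≤ : ∀ {xs} → All Single xs → ∑[ xs ] (cost u) ≤ 180 * length xs
    singles≤ [] = z≤n
    singles≤ {x ∷ xs} (s ∷ as) = ≤-trans (+-mono-≤ (single≤180 s) (singles≤ as))
      (≤-reflexive (sym (*-suc 180 (length xs))))

    singles≤132 : ∀ {xs} → All Single xs → All (λ x → ¬ W x) xs → ∑[ xs ] (cost u) ≤ 132 * length xs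
    singles≤132 [] [] = z≤n
    singles≤132 {x ∷ xs} (s ∷ as) (h ∷ hs) =
      ≤-trans (+-mono-≤ (single≤132 s h) (singles≤132 as hs)) (≤-reflexive (sym (*-suc 132 (length xs))))

    -- A single big neighbour at cost 30 already saves 150 against the uniform bound 180; if there
    -- is none, the individual trade-offs add up.
    singles-tradeoff : ∀ {xs} → All Single xs → ∑[ xs ] (cost u) + 150 ≤ 180 * length xs ⊎
      ∑[ xs ] (cost u) + 6 * ∑[ xs ] d ≤ 186 * length xs + 6 * ∑[ xs ] w
    singles-tradeoff [] = inj₂ ≤-refl
    singles-tradeoff {x ∷ xs} (s ∷ as) with big-or-tradeoff s | singles-tradeoff as
    ... | inj₁ (_ , e) | _ rewrite e = inj₁
      (lin 2 (λ s l → s ≤' 180 · l ⇒ ⊢ # 30 ⊕ s ⊕ # 150 ≤' 180 · (# 1 ⊕ l)) _ (length xs) (singles≤ as))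
    ... | inj₂ _ | inj₁ h = inj₁
      (lin 3 (λ a s l → a ≤' # 180 ⇒ s ⊕ # 150 ≤' 180 · l ⇒ ⊢ a ⊕ s ⊕ # 150 ≤' 180 · (# 1 ⊕ l))
        (cost u x) (∑[ xs ] (cost u)) (length xs) (single≤180 s) h)
    ... | inj₂ g | inj₂ h = inj₂
      (lin 7 (λ a s e D v V l → a ⊕ 6 · e ≤' # 186 ⊕ 6 · v ⇒ s ⊕ 6 · D ≤' 186 · l ⊕ 6 · V ⇒
          ⊢ a ⊕ s ⊕ 6 · (e ⊕ D) ≤' 186 · (# 1 ⊕ l) ⊕ 6 · (v ⊕ V))
        (cost u x) (∑[ xs ] (cost u)) (d x) (∑[ xs ] d) (w x) (∑[ xs ] w) (length xs) g h)

    pair-cost : ∀ {x y xs} → Triangle u x y →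
      ∑[ x ∷ y ∷ xs ] (cost u) ≡ price-of u x y + (price-of u x y + ∑[ xs ] (cost u))
    pair-cost {x} {y} {xs} t = cong₂ (λ a b → a + (b + ∑[ xs ] (cost u))) (cost-triangle t)
      (trans (cost-triangle (triangle-swap t)) (price-of-comm u y x))

    -- No neighbour is in W, so none is weak. A strong neighbour counts `u` as a vertex of W, which
    -- forces d(u) ≥ 4, and a 2-vertex on a common triangle forces d(u) = 5. The resulting bounds
    -- 120, 132 and 162 per edge fit degrees 3, 4 and 5.
    inside-W : W u → Affordable u
    inside-W Wu = let ys , p , g = grouped u in from-grouped p
      (≤-trans (+-monoˡ-≤ 360 (≤-trans (Σ-mono ys {g = λ _ → bound (d u)} λ y∈ →
        pointwise (∈N⁻ (∈-resp-↭ p y∈)))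
          (≤-reflexive (trans (Σ-const ys (bound (d u))) (cong (_* bound (d u)) (↭-length p))))))
        (subst (λ l → d u * bound (d u) + 360 ≤ 240 * l) (sym (↭-length p)) (bounded (d u) 3≤du du≤5)))
      where
      bound : ℕ → ℕ
      bound m = if m ≤ᵇ 3 then 120 else if m ≤ᵇ 4 then 132 else 162

      bounded : ∀ m → 3 ≤ m → m ≤ 5 → m * bound m + 360 ≤ 240 * m
      bounded (suc (suc (suc 0))) _ _ = ≤ᵇ⇒≤ 720 720 _
      bounded (suc (suc (suc 1))) _ _ = ≤ᵇ⇒≤ 888 960 _
      bounded (suc (suc (suc 2))) _ _ = ≤ᵇ⇒≤ 1170 1200 _
      bounded (suc (suc (suc (suc (suc (suc m)))))) _ (s≤s (s≤s (s≤s (s≤s (s≤s ())))))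
      bounded 1 (s≤s ()) _
      bounded 2 (s≤s (s≤s ())) _

      120≤bound : ∀ m → 120 ≤ bound m
      120≤bound m with m ≤ᵇ 3 | m ≤ᵇ 4
      ... | true | _ = ≤-refl
      ... | false | true = ≤ᵇ⇒≤ 120 132 _
      ... | false | false = ≤ᵇ⇒≤ 120 162 _

      132≤bound : d u ≢ 3 → 132 ≤ bound (d u)
      132≤bound h = ≤-trans (by (d u ≤ᵇ 4))
        (≤-reflexive (sym (if-> {m = d u} {3} (≤∧≢⇒< 3≤du (h ∘ sym)))))
        where
        by : ∀ b → 132 ≤ (if b then 132 else 162)
        by true = ≤-refl
        by false = ≤ᵇ⇒≤ 132 162 _

      strong⇒≢3 : ∀ {x} → u ~ x → d x ≡ 2 → ¬ W x → d u ≢ 3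
      strong⇒≢3 {x} u~x dx≡2 ¬Wx du≡3 = let y , x~y , u≢y = other-neighbour dx≡2 (~-sym u~x) in
        lin 3 (λ k u y → k ⊕ # 3 ⊕ # 1 ≤' u ⊕ y ⇒ u ≡' # 3 ⇒ y ≤' k ⇒ absurd) k (d u) (d y)
          (strong-2 dx≡2 ¬Wx (~-sym u~x) x~y u≢y ([] ∷ []) λ { (here refl) → Wu , inj₁ (~-sym u~x) })
          du≡3 (degree≤k y)

      pointwise : ∀ {x} → u ~ x → cost u x ≤ bound (d u)
      pointwise {x} u~x with inTriangle? u x
      ... | no none rewrite sym (cost-single none) with cost u x | singleView 3≤du du≤5 u~x none
      ...   | _ | weak _ Wx = ⊥-elim (W-independent Wu u~x Wx)
      ...   | _ | strong e ¬Wx = 132≤bound (strong⇒≢3 u~x e ¬Wx)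
      ...   | _ | plain _ _ = 120≤bound (d u)
      ...   | _ | big _ = ≤-trans (≤ᵇ⇒≤ 30 120 _) (120≤bound (d u))
      pointwise {x} u~x | yes (y , t) with price-of u x y | pairView 3≤du du≤5 t
      ... | _ | with-2 e _ = ≤-reflexive (sym (cong bound e))
      ... | _ | paid-for = ≤-trans (≤ᵇ⇒≤ 90 120 _) (120≤bound (d u))
      ... | _ | huge _ = ≤-trans (≤ᵇ⇒≤ 111 120 _) (120≤bound (d u))
      ... | _ | subsidising 4≤ _ = 132≤bound λ e → <⇒≢ 4≤ (sym e)
      ... | _ | neutral _ = 120≤bound (d u)
      ... | _ | mid ¬Wu _ = ⊥-elim (¬Wu Wu)
      ... | _ | low ¬Wu _ = ⊥-elim (¬Wu Wu)

  module OutsideW {u : Fin n} (3≤du : 3 ≤ d u) (du≤5 : d u ≤ 5) (¬Wu : ¬ W u) where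
    open Small 3≤du du≤5

    -- The degree sum exceeds the number of neighbours in W by at least k + 3 ≥ 35, and 210 = 6 ·
    -- 35.
    tradeoff-bound : ∀ {xs} s → All Single xs → k + 3 + ∑[ xs ] w + s ≤ ∑[ xs ] d →
      ∑[ xs ] (cost u) + 150 ≤ 180 * length xs ⊎ ∑[ xs ] (cost u) + 210 + 6 * s ≤ 186 * length xs
    tradeoff-bound {xs} s as h with singles-tradeoff as
    ... | inj₁ g = inj₁ g
    ... | inj₂ g = inj₂ (lin 6 (λ k C D V s l → # 32 ≤' k ⇒ k ⊕ # 3 ⊕ V ⊕ s ≤' D ⇒
        C ⊕ 6 · D ≤' 186 · l ⊕ 6 · V ⇒ ⊢ C ⊕ # 210 ⊕ 6 · s ≤' 186 · l)
      k (∑[ xs ] (cost u)) (∑[ xs ] d) (∑[ xs ] w) s (length xs) 32≤k h g)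

    -- Beside the cost 30 the budget of 360 allows 180 + 132, so only two weak neighbours could
    -- break it. Both being 2-vertices in W, they would force d(a) ≥ k + 1.
    big-first : ∀ {a b c} → Single b → Single c → cost u a ≡ 30 → a ∷ b ∷ c ∷ [] ↭ N u →
      All Single (a ∷ b ∷ c ∷ []) → Affordable u
    big-first {a} {b} {c} sb sc e p as = from-grouped p (bound (weak-or-cheap sb) (weak-or-cheap sc))
      where
      w≡1 : ∀ {x} → W x → w x ≡ 1
      w≡1 {x} Wx with W? x
      ... | yes _ = refl
      ... | no ¬Wx = ⊥-elim (¬Wx Wx)
      bound : (d b ≡ 2 × W b) ⊎ cost u b ≤ 132 → (d c ≡ 2 × W c) ⊎ cost u c ≤ 132 →
        cost u a + (cost u b + (cost u c + 0)) + 360 ≤ 720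
      bound (inj₂ g) _ = lin 3 (λ a b c → a ≡' # 30 ⇒ b ≤' # 132 ⇒ c ≤' # 180 ⇒
        ⊢ a ⊕ (b ⊕ (c ⊕ # 0)) ⊕ # 360 ≤' # 720)
        (cost u a) (cost u b) (cost u c) e g (single≤180 sc)
      bound _ (inj₂ g) = lin 3 (λ a b c → a ≡' # 30 ⇒ b ≤' # 180 ⇒ c ≤' # 132 ⇒
        ⊢ a ⊕ (b ⊕ (c ⊕ # 0)) ⊕ # 360 ≤' # 720)
        (cost u a) (cost u b) (cost u c) e (single≤180 sb) g
      bound (inj₁ (eb , Wb)) (inj₁ (ec , Wc)) = ⊥-elim (lin 7 (λ k x y z a b c →
          k ⊕ # 3 ⊕ (x ⊕ (y ⊕ (z ⊕ # 0))) ⊕ # 0 ≤' a ⊕ (b ⊕ (c ⊕ # 0)) ⇒ y ≡' # 1 ⇒ z ≡' # 1 ⇒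
          a ≤' k ⇒ b ≡' # 2 ⇒ c ≡' # 2 ⇒ absurd)
        k (w a) (w b) (w c) (d a) (d b) (d c) (W-count-neighbours ¬Wu p (singles as)) (w≡1 Wb) (w≡1 Wc)
          (degree≤k a) eb ec)

    three-singles : ∀ {a b c} → All Single (a ∷ b ∷ c ∷ []) → a ∷ b ∷ c ∷ [] ↭ N u → Affordable u
    three-singles {a} {b} {c} as@(sa ∷ sb ∷ sc ∷ []) p with big-or-tradeoff sa | big-or-tradeoff sb
      | big-or-tradeoff sc
    ... | inj₁ (_ , e) | _ | _ = big-first sb sc e p as
    ... | _ | inj₁ (_ , e) | _ = big-first sa sc e (trans↭ (swap b a refl↭) p) (sb ∷ sa ∷ sc ∷ [])
    ... | _ | _ | inj₁ (_ , e) = big-first sa sb e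
      (trans↭ (swap c a refl↭) (trans↭ (prep a (swap c b refl↭)) p)) (sc ∷ sa ∷ sb ∷ [])
    -- Without big neighbours the costs sum to at most 3 · 186 - 6 · 35 = 348, within the budget of
    -- 360.
    ... | inj₂ f | inj₂ g | inj₂ h = from-grouped p
      (lin 10 (λ k a b c va vb vc x y z → # 32 ≤' k ⇒
          k ⊕ # 3 ⊕ (va ⊕ (vb ⊕ (vc ⊕ # 0))) ⊕ # 0 ≤' x ⊕ (y ⊕ (z ⊕ # 0)) ⇒
          a ⊕ 6 · x ≤' # 186 ⊕ 6 · va ⇒ b ⊕ 6 · y ≤' # 186 ⊕ 6 · vb ⇒ c ⊕ 6 · z ≤' # 186 ⊕ 6 · vc ⇒
          ⊢ a ⊕ (b ⊕ (c ⊕ # 0)) ⊕ # 360 ≤' # 720)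
        k (cost u a) (cost u b) (cost u c) (w a) (w b) (w c) (d a) (d b) (d c) 32≤k
        (W-count-neighbours ¬Wu p (singles as)) f g h)

    many-singles : ∀ {xs} → 4 ≤ length xs → length xs ≤ 5 → All Single xs → xs ↭ N u → Affordable u
    many-singles {xs} 4≤ ≤5 as p = from-grouped p
      (case tradeoff-bound 0 as (W-count-neighbours ¬Wu p (singles as)) of λ
      { (inj₁ h) → lin 2 (λ C l → C ⊕ # 150 ≤' 180 · l ⇒ # 4 ≤' l ⇒ ⊢ C ⊕ # 360 ≤' 240 · l)
        (∑[ xs ] (cost u)) (length xs) h 4≤
      ; (inj₂ h) → lin 2 (λ C l → C ⊕ # 210 ⊕ # 0 ≤' 186 · l ⇒ # 4 ≤' l ⇒ ⊢ C ⊕ # 360 ≤' 240 · l)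
        (∑[ xs ] (cost u)) (length xs) h 4≤ })

    pair-enough : ∀ {x y xs q} → x ∷ y ∷ xs ↭ N u → Triangle u x y → price-of u x y ≡ q →
      q + q + ∑[ xs ] (cost u) + 360 ≤ 240 * (2 + length xs) → Affordable u
    pair-enough {x} {y} {xs} p t refl h = from-grouped p (subst (λ s → s + 360 ≤ 240 * (2 + length xs))
      (trans (+-assoc (price-of u x y) _ _) (sym (pair-cost {xs = xs} t))) h)

    -- The pair takes at most `s` of a degree sum of at least k + 5 ≥ 37 beyond the neighbours in W,
    -- so the singles supply 37 - s; and 222 = 6 · 37.
    beside-pair : ∀ {x y xs} s → (as : All Single xs) → (t : Triangle u x y) → x ∷ y ∷ xs ↭ N u →
      d x + d y ≤ s → s ≤ 16 →
      ∑[ xs ] (cost u) + 150 ≤ 180 * length xs ⊎ ∑[ xs ] (cost u) + 222 ≤ 186 * length xs + 6 * s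
    beside-pair {x} {y} {xs} s as t p h s≤16 with singles-tradeoff as
    ... | inj₁ g = inj₁ g
    ... | inj₂ g = inj₂ (lin 9 (λ k C D V l x y s v → # 32 ≤' k ⇒ k ⊕ # 3 ⊕ (v ⊕ V) ⊕ # 2 ≤' x ⊕ y ⊕ D ⇒
        C ⊕ 6 · D ≤' 186 · l ⊕ 6 · V ⇒ x ⊕ y ≤' s ⇒ ⊢ C ⊕ # 222 ≤' 186 · l ⊕ 6 · s)
      k (∑[ xs ] (cost u)) (∑[ xs ] d) (∑[ xs ] w) (length xs) (d x) (d y) s (w x + w y) 32≤k
      (subst₂ _≤_ (cong (λ z → k + 3 + z + 2) (sym (+-assoc (w x) (w y) _))) (sym (+-assoc (d x) (d y) _))
        (W-count-neighbours ¬Wu p (pair t (singles as)))) g h)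

    -- The budget is 360. Expensive pairs have small degrees, which forces a large degree on `a` and
    -- hence a small or negative transfer to it; a needy `u` is the case where `a` is weak beside a
    -- pair with a huge vertex.
    pair-and-one : ∀ {x y a} → d u ≡ 3 → Triangle u x y → Single a → x ∷ y ∷ a ∷ [] ↭ N u → Affordable u
    pair-and-one {x} {y} {a} du≡3 t sa p = go (price-of u x y) refl (pairView 3≤du du≤5 t)
      where
      count : k + 3 + (w x + (w y + (w a + 0))) + 2 ≤ d x + (d y + (d a + 0))
      count = W-count-neighbours ¬Wu p (pair t (singles (sa ∷ [])))
      finish : ∀ q → price-of u x y ≡ q → q + q + cost u a ≤ 360 → Affordable u
      finish q e h = pair-enough p t e
        (lin 2 (λ q c → q ⊕ q ⊕ c ≤' # 360 ⇒ ⊢ q ⊕ q ⊕ (c ⊕ # 0) ⊕ # 360 ≤' # 720) q (cost u a) h)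
      ¬small-a : ∀ s → d x + d y ≤ s → s ≤ 16 → d a ≤ 11 → ⊥
      ¬small-a s h s≤ da≤ = lin 6 (λ k v x y a s → # 32 ≤' k ⇒ k ⊕ # 3 ⊕ v ⊕ # 2 ≤' x ⊕ (y ⊕ (a ⊕ # 0)) ⇒
        a ≤' # 11 ⇒ x ⊕ y ≤' s ⇒ s ≤' # 16 ⇒ absurd)
        k (w x + (w y + (w a + 0))) (d x) (d y) (d a) s 32≤k count da≤ h s≤
      big-a : ∀ s → d x + d y ≤ s → s ≤ 16 → cost u a ≤ 30
      big-a s h s≤ with cost u a | singleView 3≤du du≤5 (proj₁ sa) (proj₂ sa)
      ... | _ | big _ = ≤-refl
      ... | _ | weak e _ = ⊥-elim (¬small-a s h s≤ (≤-trans (≤-reflexive e) (≤ᵇ⇒≤ 2 11 _)))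
      ... | _ | strong e _ = ⊥-elim (¬small-a s h s≤ (≤-trans (≤-reflexive e) (≤ᵇ⇒≤ 2 11 _)))
      ... | _ | plain _ e = ⊥-elim (¬small-a s h s≤ e)
      go : ∀ q → price-of u x y ≡ q → PairView u x y q → Affordable u
      go _ e (with-2 du≡5 _) = case trans (sym du≡3) du≡5 of λ ()
      go _ e paid-for = finish 90 e (+-monoʳ-≤ 180 (single≤180 sa))
      go _ e (subsidising 4≤ _) = ⊥-elim (<⇒≢ 4≤ (sym du≡3))
      go _ e (huge (inj₂ 4≤)) = ⊥-elim (<⇒≢ 4≤ (sym du≡3))
      go _ e (huge (inj₁ ¬nd)) = finish 111 e (≤-trans (+-monoʳ-≤ 222 (case weak-or-cheap sa of λ
        { (inj₁ (da , Wa)) → ⊥-elim (¬nd (du≡3 , a , proj₁ sa , da , Wa)) ; (inj₂ c) → c }))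
          (≤ᵇ⇒≤ 354 360 _))
      go _ e (neutral (inj₁ Wu)) = ⊥-elim (¬Wu Wu)
      -- The neighbour `a` has degree at least 37 - 34 = 3, so it is no 2-vertex and costs at most
      -- 120.
      go _ e (neutral (inj₂ h)) = finish 120 e (+-monoʳ-≤ 240 (case two-or-neutral sa of λ
        { (inj₂ c) → c
        ; (inj₁ da) → ⊥-elim (lin 5 (λ k v x y a → # 32 ≤' k ⇒ k ⊕ # 3 ⊕ v ⊕ # 2 ≤' x ⊕ (y ⊕ (a ⊕ # 0)) ⇒
            a ≡' # 2 ⇒ x ⊕ y ≤' # 34 ⇒ absurd) k (w x + (w y + (w a + 0))) (d x) (d y) (d a) 32≤k count da
              h) }))
      -- In this case and the next, `d x + d y ≤ 16` leaves at least 21 for `a`, which is therefore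
      -- big and gives 90.
      go _ e (mid _ h) = finish 150 e (≤-trans (+-monoʳ-≤ 300 (big-a 16 h ≤-refl)) (≤ᵇ⇒≤ 330 360 _))
      go _ e (low _ h) = finish 165 e (+-monoʳ-≤ 330 (big-a 10 h (≤ᵇ⇒≤ 10 16 _)))

    pair-and-two : ∀ {x y e f} → d u ≡ 4 → Triangle u x y → Single e → Single f → e ≢ f →
      x ∷ y ∷ e ∷ f ∷ [] ↭ N u → Affordable u
    pair-and-two {x} {y} {e} {f} du≡4 t se sf e≢f p = go (price-of u x y) refl (pairView 3≤du du≤5 t)
      where
      finish : ∀ q s → price-of u x y ≡ q → cost u e + (cost u f + 0) ≤ s → q + q + s ≤ 600 → Affordable u
      finish q s eq h g = pair-enough p t eq
        (lin 3 (λ q c s → c ≤' s ⇒ q ⊕ q ⊕ s ≤' # 600 ⇒ ⊢ q ⊕ q ⊕ c ⊕ # 360 ≤' # 960) q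
          (cost u e + (cost u f + 0)) s h g)
      both≤360 : cost u e + (cost u f + 0) ≤ 360
      both≤360 = singles≤ (se ∷ sf ∷ [])
      -- The trade-off gives 2 · 186 - 222 = 150 besides 6s; with a big neighbour the cost is at
      -- most 210, covered because s ≥ 10.
      beside : ∀ s → 10 ≤ s → d x + d y ≤ s → s ≤ 16 → cost u e + (cost u f + 0) ≤ 150 + 6 * s
      beside s 10≤s h s≤ = case beside-pair s (se ∷ sf ∷ []) t p h s≤ of λ
        { (inj₁ g) → lin 2 (λ c s → c ⊕ # 150 ≤' # 360 ⇒ # 10 ≤' s ⇒ ⊢ c ≤' # 150 ⊕ 6 · s)
          (cost u e + (cost u f + 0)) s g 10≤s
        ; (inj₂ g) → lin 2 (λ c s → c ⊕ # 222 ≤' # 372 ⊕ 6 · s ⇒ ⊢ c ≤' # 150 ⊕ 6 · s)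
          (cost u e + (cost u f + 0)) s g }
      go : ∀ q → price-of u x y ≡ q → PairView u x y q → Affordable u
      go _ eq (with-2 du≡5 _) = case trans (sym du≡4) du≡5 of λ ()
      go _ eq paid-for = finish 90 360 eq both≤360 (≤ᵇ⇒≤ 540 600 _)
      go _ eq (huge _) = finish 111 360 eq both≤360 (≤ᵇ⇒≤ 582 600 _)
      go _ eq (neutral _) = finish 120 360 eq both≤360 ≤-refl
      go _ eq (mid _ h) = finish 150 246 eq (beside 16 (≤ᵇ⇒≤ 10 16 _) h ≤-refl) (≤ᵇ⇒≤ 546 600 _)
      go _ eq (low _ h) = finish 165 210 eq (beside 10 ≤-refl h (≤ᵇ⇒≤ 10 16 _)) (≤ᵇ⇒≤ 540 600 _)
      go _ eq (subsidising _ nd) with weak-or-cheap se | weak-or-cheap sf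
      ... | inj₂ a | _ = finish 132 312 eq
        (lin 2 (λ a b → a ≤' # 132 ⇒ b ≤' # 180 ⇒ ⊢ a ⊕ (b ⊕ # 0) ≤' # 312)
              (cost u e) (cost u f) a (single≤180 sf)) (≤ᵇ⇒≤ 576 600 _)
      ... | inj₁ _ | inj₂ b = finish 132 312 eq
        (lin 2 (λ a b → a ≤' # 180 ⇒ b ≤' # 132 ⇒ ⊢ a ⊕ (b ⊕ # 0) ≤' # 312)
              (cost u e) (cost u f) (single≤180 se) b) (≤ᵇ⇒≤ 576 600 _)
      ... | inj₁ (_ , We) | inj₁ (_ , Wf) = ⊥-elim (case nd of λ
              { (inj₁ nx) → needy⇒¬two-weak du≡4 nx t e≢f (proj₁ se) We (proj₂ se) (proj₁ sf) Wf (proj₂ sf)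
              ; (inj₂ ny) → needy⇒¬two-weak du≡4 ny (triangle-swap t) e≢f (proj₁ se) We (proj₂ se)
                (proj₁ sf) Wf (proj₂ sf) })

    price≤165 : ∀ {x y} → Triangle u x y → price-of u x y ≤ 165
    price≤165 {x} {y} t with price-of u x y | pairView 3≤du du≤5 t
    ... | _ | with-2 _ _ = ≤ᵇ⇒≤ 162 165 _
    ... | _ | paid-for = ≤ᵇ⇒≤ 90 165 _
    ... | _ | huge _ = ≤ᵇ⇒≤ 111 165 _
    ... | _ | subsidising _ _ = ≤ᵇ⇒≤ 132 165 _
    ... | _ | neutral _ = ≤ᵇ⇒≤ 120 165 _
    ... | _ | mid _ _ = ≤ᵇ⇒≤ 150 165 _
    ... | _ | low _ _ = ≤-refl

    -- The two rates may sum to 300. At degree 4 only pairs of total degree at most 16 have a rate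
    -- above 132, and two of those would have total degree at most 32, short of k + 7; otherwise 132
    -- + 165 fits.
    two-pairs : ∀ {x y x′ y′} → d u ≡ 4 → Triangle u x y → Triangle u x′ y′ →
      x ∷ y ∷ x′ ∷ y′ ∷ [] ↭ N u → Affordable u
    two-pairs {x} {y} {x′} {y′} du≡4 t t′ p = from-grouped p (subst (λ s → s + 360 ≤ 960)
      (trans (cong (q + q +_) (sym (pair-cost {xs = []} t′)))
        (trans (+-assoc q q _) (sym (pair-cost {xs = x′ ∷ y′ ∷ []} t))))
      (lin 2 (λ q q′ → q ⊕ q′ ≤' # 300 ⇒ ⊢ q ⊕ q ⊕ (q′ ⊕ (q′ ⊕ # 0)) ⊕ # 360 ≤' # 960) q (price-of u x′ y′)
        (go _ _ (pairView 3≤du du≤5 t) (pairView 3≤du du≤5 t′))))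
      where
      q = price-of u x y
      count : k + 3 + (w x + (w y + (w x′ + (w y′ + 0)))) + 4 ≤ d x + (d y + (d x′ + (d y′ + 0)))
      count = W-count-neighbours ¬Wu p (pair t (pair t′ (singles [])))
      clash : ∀ {A : Set} → d x + d y ≤ 16 → d x′ + d y′ ≤ 16 → A
      clash h h′ = ⊥-elim (lin 6 (λ k v a b a′ b′ → # 32 ≤' k ⇒
        k ⊕ # 3 ⊕ v ⊕ # 4 ≤' a ⊕ (b ⊕ (a′ ⊕ (b′ ⊕ # 0))) ⇒
        a ⊕ b ≤' # 16 ⇒ a′ ⊕ b′ ≤' # 16 ⇒ absurd) k (w x + (w y + (w x′ + (w y′ + 0)))) (d x) (d y) (d x′)
          (d y′)
        32≤k count h h′)
      data Cheap (x y : Fin n) (q : ℕ) : Set where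
        cheap  : q ≤ 132 → Cheap x y q
        costly : q ≤ 165 → d x + d y ≤ 16 → Cheap x y q
      cheap? : ∀ {x y q} → PairView u x y q → Cheap x y q
      cheap? (with-2 du≡5 _) = case trans (sym du≡4) du≡5 of λ ()
      cheap? paid-for = cheap (≤ᵇ⇒≤ 90 132 _)
      cheap? (huge _) = cheap (≤ᵇ⇒≤ 111 132 _)
      cheap? (subsidising _ _) = cheap ≤-refl
      cheap? (neutral _) = cheap (≤ᵇ⇒≤ 120 132 _)
      cheap? (mid _ h) = costly (≤ᵇ⇒≤ 150 165 _) h
      cheap? (low _ h) = costly ≤-refl (≤-trans h (≤ᵇ⇒≤ 10 16 _))
      go : ∀ q q′ → PairView u x y q → PairView u x′ y′ q′ → q + q′ ≤ 300
      go q q′ v v′ with cheap? v | cheap? v′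
      ... | cheap a | cheap b = ≤-trans (+-mono-≤ a b) (≤ᵇ⇒≤ 264 300 _)
      ... | cheap a | costly b _ = ≤-trans (+-mono-≤ a b) (≤ᵇ⇒≤ 297 300 _)
      ... | costly a _ | cheap b = ≤-trans (+-mono-≤ a b) (≤ᵇ⇒≤ 297 300 _)
      ... | costly _ h | costly _ h′ = clash h h′

    pair-and-three : ∀ {x y xs} → length xs ≡ 3 → Triangle u x y → All Single xs → x ∷ y ∷ xs ↭ N u →
      Affordable u
    pair-and-three {x} {y} {xs} len t as p = go (price-of u x y) refl (pairView 3≤du du≤5 t)
      where
      finish : ∀ q s → price-of u x y ≡ q → ∑[ xs ] (cost u) ≤ s → q + q + s ≤ 840 → Affordable u
      finish q s eq h g = pair-enough p t eq
        (subst (λ l → q + q + ∑[ xs ] (cost u) + 360 ≤ 240 * (2 + l)) (sym len)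
          (lin 3 (λ q c s → c ≤' s ⇒ q ⊕ q ⊕ s ≤' # 840 ⇒ ⊢ q ⊕ q ⊕ c ⊕ # 360 ≤' # 1200) q
            (∑[ xs ] (cost u)) s h g))
      all≤540 : ∑[ xs ] (cost u) ≤ 540
      all≤540 = subst (λ l → ∑[ xs ] (cost u) ≤ 180 * l) len (singles≤ as)
      no-weak : (∀ {e} → Single e → ¬ W e) → ∑[ xs ] (cost u) ≤ 396
      no-weak f = subst (λ l → ∑[ xs ] (cost u) ≤ 132 * l) len (singles≤132 as (All.map f as))
      go : ∀ q → price-of u x y ≡ q → PairView u x y q → Affordable u
      go _ eq (with-2 du≡5 (inj₁ dx≡2)) = finish 162 396 eq
        (no-weak λ (u~e , ne) → with-2⇒¬weak du≡5 t dx≡2 u~e ne) (≤ᵇ⇒≤ 720 840 _)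
      go _ eq (with-2 du≡5 (inj₂ dy≡2)) = finish 162 396 eq
        (no-weak λ (u~e , ne) → with-2⇒¬weak du≡5 (triangle-swap t) dy≡2 u~e ne) (≤ᵇ⇒≤ 720 840 _)
      go _ eq paid-for = finish 90 540 eq all≤540 (≤ᵇ⇒≤ 720 840 _)
      go _ eq (huge _) = finish 111 540 eq all≤540 (≤ᵇ⇒≤ 762 840 _)
      go _ eq (subsidising _ _) = finish 132 540 eq all≤540 (≤ᵇ⇒≤ 804 840 _)
      go _ eq (neutral _) = finish 120 540 eq all≤540 (≤ᵇ⇒≤ 780 840 _)
      go _ eq (mid _ _) = finish 150 540 eq all≤540 ≤-refl
      -- The alternatives bound the singles by 540 - 150 = 390 and by 558 + 60 - 222 = 396.
      go _ eq (low _ h) = finish 165 396 eq (case beside-pair 10 as t p h (≤ᵇ⇒≤ 10 16 _) of λ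
        { (inj₁ g) → lin 2 (λ c l → c ⊕ # 150 ≤' 180 · l ⇒ l ≡' # 3 ⇒ ⊢ c ≤' # 396) (∑[ xs ] (cost u))
          (length xs) g len
        ; (inj₂ g) → lin 2 (λ c l → c ⊕ # 222 ≤' 186 · l ⊕ # 60 ⇒ l ≡' # 3 ⇒ ⊢ c ≤' # 396)
          (∑[ xs ] (cost u)) (length xs) g len })
        (≤ᵇ⇒≤ 726 840 _)

    -- At degree 5 the crude bounds suffice: 4 · 165 + 180 = 840 is exactly the budget 5 · 240 -
    -- 360.
    two-pairs-and-one : ∀ {x y x′ y′ e} → Triangle u x y → Triangle u x′ y′ → Single e →
      x ∷ y ∷ x′ ∷ y′ ∷ e ∷ [] ↭ N u → Affordable u
    two-pairs-and-one {x} {y} {x′} {y′} {e} t t′ se p = from-grouped p (subst (λ s → s + 360 ≤ 1200)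
      (trans (cong (q + q +_) (sym (pair-cost {xs = e ∷ []} t′)))
        (trans (+-assoc q q _) (sym (pair-cost {xs = x′ ∷ y′ ∷ e ∷ []} t))))
      (lin 3 (λ q q′ c → q ≤' # 165 ⇒ q′ ≤' # 165 ⇒ c ≤' # 180 ⇒
        ⊢ q ⊕ q ⊕ (q′ ⊕ (q′ ⊕ (c ⊕ # 0))) ⊕ # 360 ≤' # 1200)
        q (price-of u x′ y′) (cost u e) (price≤165 t) (price≤165 t′) (single≤180 se)))
      where q = price-of u x y

    outside-W : Affordable u
    outside-W with grouped u
    ... | ys , p , g = go ys p g (subst (3 ≤_) (sym (↭-length p)) 3≤du)
      (subst (_≤ 5) (sym (↭-length p)) du≤5)
      where
      distinct : ∀ {a b e f} → a ∷ b ∷ e ∷ f ∷ [] ↭ N u → e ≢ f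
      distinct p refl with Unique-resp-↭ (↭-sym p) (N-unique u)
      ... | _ ∷ _ ∷ uniq = head∉tail uniq (here refl)
      go : ∀ ys → ys ↭ N u → Grouped u ys → 3 ≤ length ys → length ys ≤ 5 → Affordable u
      go ys@(_ ∷ _ ∷ _ ∷ []) p (singles as) _ _ = three-singles as p
      go ys@(_ ∷ _ ∷ _ ∷ _ ∷ _) p (singles as) _ h = many-singles (s≤s (s≤s (s≤s (s≤s z≤n)))) h as p
      go (_ ∷ []) p (singles _) (s≤s ()) _
      go (_ ∷ _ ∷ []) p (singles _) (s≤s (s≤s ())) _
      go (_ ∷ _ ∷ []) p (pair t (singles [])) (s≤s (s≤s ())) _
      go (_ ∷ _ ∷ _ ∷ []) p (pair t (singles (s ∷ []))) _ _ = pair-and-one (sym (↭-length p)) t s p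
      go (_ ∷ _ ∷ _ ∷ _ ∷ []) p (pair t (singles (se ∷ sf ∷ []))) _ _ =
        pair-and-two (sym (↭-length p)) t se sf (distinct p) p
      go (_ ∷ _ ∷ _ ∷ _ ∷ _ ∷ []) p (pair t (singles as)) _ _ = pair-and-three refl t as p
      go (_ ∷ _ ∷ _ ∷ _ ∷ []) p (pair t (pair t′ (singles []))) _ _ = two-pairs (sym (↭-length p)) t t′ p
      go (_ ∷ _ ∷ _ ∷ _ ∷ _ ∷ []) p (pair t (pair t′ (singles (s ∷ [])))) _ _ = two-pairs-and-one t t′ s p
      go (_ ∷ _ ∷ _ ∷ _ ∷ _ ∷ _ ∷ _) p _ _ (s≤s (s≤s (s≤s (s≤s (s≤s ())))))

  affordable : ∀ {u v} → u ~ v → Affordable u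
  affordable {u} u~v with 3 ≤? d u | 6 ≤? d u | W? u
  ... | no h | _ | _ = two-affordable u (≤-antisym (≤-pred (≰⇒> h)) (~⇒2≤d u~v))
  ... | _ | yes h | _ = large-affordable u h
  ... | yes h | no g | yes Wu = Small.inside-W h (≤-pred (≰⇒> g)) Wu
  ... | yes h | no g | no ¬Wu = OutsideW.outside-W h (≤-pred (≰⇒> g)) ¬Wu

  -- Summing the charges over the graph

  V : List (Fin n)
  V = allFin n

  V-unique : Unique V
  V-unique = Unique.allFin⁺ n

  Σ³ : (Fin n → Fin n → Fin n → ℕ) → ℕ
  Σ³ f = ∑[ V ] λ u → ∑[ V ] λ v → ∑[ V ] (f u v)

  Σ³-swap₁₂ : ∀ f → Σ³ f ≡ Σ³ (λ u v x → f v u x)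
  Σ³-swap₁₂ f = Σ-swap V V (λ u v → ∑[ V ] (f u v))

  Σ³-swap₂₃ : ∀ f → Σ³ f ≡ Σ³ (λ u v x → f u x v)
  Σ³-swap₂₃ f = Σ-cong V λ {u} _ → Σ-swap V V (f u)

  Σ³-+ : ∀ f g → Σ³ (λ u v x → f u v x + g u v x) ≡ Σ³ f + Σ³ g
  Σ³-+ f g = trans (Σ-cong V λ {u} _ → trans (Σ-cong V λ {v} _ → Σ-+ V (f u v) (g u v)) (Σ-+ V _ _))
    (Σ-+ V _ _)

  Σ³-mono : ∀ {f g} → (∀ u v x → f u v x ≤ g u v x) → Σ³ f ≤ Σ³ g
  Σ³-mono h = Σ-mono V λ {u} _ → Σ-mono V λ {v} _ → Σ-mono V λ {x} _ → h u v x

  Σ³-* : ∀ c f → Σ³ (λ u v x → c * f u v x) ≡ c * Σ³ f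
  Σ³-* c f = trans (Σ-cong V λ {u} _ → trans (Σ-cong V λ {v} _ → Σ-* V c (f u v)) (Σ-* V c _)) (Σ-* V c _)

  single? : ∀ u v → Dec (u ~ v × ¬ InTriangle u v)
  single? u v = u ~? v ×-dec ¬? (inTriangle? u v)

  triangle-edges single-edges triangle-cost single-cost total-cost total-degree non-isolated : ℕ
  triangle-edges = ∑[ V ] λ u → ∑[ V ] λ v → 𝟙 (inTriangle? u v)
  single-edges   = ∑[ V ] λ u → ∑[ V ] λ v → 𝟙 (single? u v)
  triangle-cost  = ∑[ V ] λ u → ∑[ V ] λ v → 𝟙 (inTriangle? u v) * cost u v
  single-cost    = ∑[ V ] λ u → ∑[ V ] λ v → 𝟙 (single? u v) * cost u v
  total-cost     = ∑[ V ] λ u → ∑[ N u ] (cost u)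
  total-degree   = ∑[ V ] d
  non-isolated   = ∑[ V ] λ u → 𝟙 (1 ≤? d u)

  𝟙-split : ∀ u v → 𝟙 (u ~? v) ≡ 𝟙 (single? u v) + 𝟙 (inTriangle? u v)
  𝟙-split u v with u ~? v | inTriangle? u v
  ... | yes _ | yes _ = refl
  ... | yes _ | no _ = refl
  ... | no u≁v | yes (_ , u~v , _) = ⊥-elim (u≁v u~v)
  ... | no _ | no _ = refl

  total-degree-split : total-degree ≡ single-edges + triangle-edges
  total-degree-split = trans
    (Σ-cong V λ {u} _ → trans (length-filter≡Σ (u ~?_) V)
      (trans (Σ-cong V λ {v} _ → 𝟙-split u v) (Σ-+ V (λ v → 𝟙 (single? u v)) (λ v → 𝟙 (inTriangle? u v)))))
    (Σ-+ V (λ u → ∑[ V ] λ v → 𝟙 (single? u v)) (λ u → ∑[ V ] λ v → 𝟙 (inTriangle? u v)))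

  total-cost-split : total-cost ≡ single-cost + triangle-cost
  total-cost-split = trans
    (Σ-cong V λ {u} _ → trans (Σ-filter (u ~?_) V (cost u))
      (trans (Σ-cong V λ {v} _ → trans (cong (_* cost u v) (𝟙-split u v))
                                       (*-distribʳ-+ (cost u v) (𝟙 (single? u v)) (𝟙 (inTriangle? u v))))
        (Σ-+ V (λ v → 𝟙 (single? u v) * cost u v) (λ v → 𝟙 (inTriangle? u v) * cost u v))))
    (Σ-+ V (λ u → ∑[ V ] λ v → 𝟙 (single? u v) * cost u v) (λ u → ∑[ V ] λ v →
      𝟙 (inTriangle? u v) * cost u v))

  InTriangle-sym : ∀ {u v} → InTriangle u v → InTriangle v u
  InTriangle-sym (x , t) = x , triangle-swap (triangle-rot t)

  single-lower : 120 * single-edges ≤ single-cost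
  single-lower = lin 2 (λ s c → 240 · s ≤' c ⊕ c ⇒ ⊢ 120 · s ≤' c) single-edges single-cost
    (subst₂ _≤_
      (trans (Σ-cong V λ {u} _ → Σ-* V 240 (λ v → 𝟙 (single? u v))) (Σ-* V 240 _))
      (trans (Σ-cong V λ {u} _ → Σ-+ V (λ v → s u v) (λ v → s v u))
        (trans (Σ-+ V _ _) (cong (single-cost +_) (sym (Σ-swap V V s)))))
      (Σ-mono V λ {u} _ → Σ-mono V λ {v} _ → pointwise u v))
    where
    s : Fin n → Fin n → ℕ
    s u v = 𝟙 (single? u v) * cost u v
    pointwise : ∀ u v → 240 * 𝟙 (single? u v) ≤ s u v + s v u
    pointwise u v with single? u v | single? v u
    ... | no _ | _ = z≤n
    ... | yes (_ , nt) | yes _ =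
      lin 2 (λ a b → # 240 ≤' a ⊕ b ⇒ ⊢ # 240 ≤' 1 · a ⊕ 1 · b) (cost u v) (cost v u) (two-costs nt)
    ... | yes (u~v , nt) | no none = ⊥-elim (none (~-sym u~v , nt ∘ InTriangle-sym))

  on-triangles : (Fin n → Fin n → ℕ) → Fin n → Fin n → Fin n → ℕ
  on-triangles f u v x = 𝟙 (triangle? u v x) * f u v

  Σ³-triangles : ∀ f → Σ³ (on-triangles f) ≡ ∑[ V ] λ u → ∑[ V ] λ v → 𝟙 (inTriangle? u v) * f u v
  Σ³-triangles f = Σ-cong V λ {u} _ → Σ-cong V λ {v} _ → point u v
    where
    point : ∀ u v → ∑[ V ] (on-triangles f u v) ≡ 𝟙 (inTriangle? u v) * f u v
    point u v with inTriangle? u v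
    ... | yes (x , t) = trans (Σ-point (triangle? u v) (λ _ → f u v) V-unique (∈-allFin x) t (λ t′ →
      third-unique no-C4 t′ t))
            (sym (+-identityʳ (f u v)))
    ... | no none = Σ-none V (triangle? u v) (λ _ → f u v) λ {x} _ t → none (x , t)

  -- An ordered pair in a triangle has exactly one third vertex, so sums over such pairs become sums
  -- over ordered triangles. Averaging over the six orders of each triangle turns 900 into 150 per
  -- pair.
  triangle-lower : 150 * triangle-edges ≤ triangle-cost
  triangle-lower = lin 2 (λ s c → 900 · s ≤' c ⊕ c ⊕ (c ⊕ c) ⊕ (c ⊕ c) ⇒ ⊢ 150 · s ≤' c) triangle-edges
    triangle-cost
    (subst₂ _≤_ count six (Σ³-mono pointwise))
    where
    g = on-triangles cost

    pointwise : ∀ u v x → 900 * (𝟙 (triangle? u v x) * 1) ≤ g u v x + g v u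
      x + (g u x v + g x u v) + (g v x u + g x v u)
    pointwise u v x with triangle? u v x
    ... | no _ = z≤n
    ... | yes t with triangle? v u x | triangle? u x v | triangle? x u v | triangle? v x u | triangle? x v u
    ...   | yes _ | yes _ | yes _ | yes _ | yes _ =
      lin 6 (λ a b c d e f → # 900 ≤' a ⊕ b ⊕ (c ⊕ d) ⊕ (e ⊕ f) ⇒
          ⊢ # 900 ≤' 1 · a ⊕ 1 · b ⊕ (1 · c ⊕ 1 · d) ⊕ (1 · e ⊕ 1 · f))
        (cost u v) (cost v u) (cost u x) (cost x u) (cost v x) (cost x v) (six-costs t)
    ...   | no h | _ | _ | _ | _ = ⊥-elim (h (triangle-swap (triangle-rot t)))
    ...   | _ | no h | _ | _ | _ = ⊥-elim (h (triangle-swap t))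
    ...   | _ | _ | no h | _ | _ = ⊥-elim (h (triangle-rot (triangle-rot t)))
    ...   | _ | _ | _ | no h | _ = ⊥-elim (h (triangle-rot t))
    ...   | _ | _ | _ | _ | no h = ⊥-elim (h (triangle-swap (triangle-rot (triangle-rot t))))

    count : Σ³ (λ u v x → 900 * (𝟙 (triangle? u v x) * 1)) ≡ 900 * triangle-edges
    count = trans (Σ³-* 900 (on-triangles (λ _ _ → 1))) (cong (900 *_) (trans (Σ³-triangles (λ _ _ → 1))
      (Σ-cong V λ {u} _ → Σ-cong V λ {v} _ → *-identityʳ (𝟙 (inTriangle? u v)))))

    same : Σ³ g ≡ triangle-cost
    same = Σ³-triangles cost

    to : ∀ {f} → Σ³ f ≡ Σ³ g → Σ³ f ≡ triangle-cost
    to e = trans e same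

    s₁₂ : Σ³ (λ u v x → g v u x) ≡ Σ³ g
    s₁₂ = sym (Σ³-swap₁₂ g)
    s₂₃ : Σ³ (λ u v x → g u x v) ≡ Σ³ g
    s₂₃ = sym (Σ³-swap₂₃ g)
    s₂₃₁₂ : Σ³ (λ u v x → g x u v) ≡ Σ³ g
    s₂₃₁₂ = trans (sym (Σ³-swap₂₃ (λ u v x → g v u x))) s₁₂
    s₁₂₂₃ : Σ³ (λ u v x → g v x u) ≡ Σ³ g
    s₁₂₂₃ = trans (sym (Σ³-swap₁₂ (λ u v x → g u x v))) s₂₃
    s₁₃ : Σ³ (λ u v x → g x v u) ≡ Σ³ g
    s₁₃ = trans (sym (Σ³-swap₁₂ (λ u v x → g x u v))) s₂₃₁₂

    six : Σ³ (λ u v x → g u v x + g v u x + (g u x v + g x u v) + (g v x u + g x v u)) ≡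
      triangle-cost + triangle-cost + (triangle-cost + triangle-cost) + (triangle-cost + triangle-cost)
    six = trans (Σ³-+ (λ u v x → g u v x + g v u x + (g u x v + g x u v)) (λ u v x → g v x u + g x v u))
      (cong₂ _+_
        (trans (Σ³-+ (λ u v x → g u v x + g v u x) (λ u v x → g u x v + g x u v))
          (cong₂ _+_ (trans (Σ³-+ g (λ u v x → g v u x)) (cong₂ _+_ same (to s₁₂)))
                     (trans (Σ³-+ (λ u v x → g u x v) (λ u v x → g x u v))
                       (cong₂ _+_ (to s₂₃) (to s₂₃₁₂)))))
        (trans (Σ³-+ (λ u v x → g v x u) (λ u v x → g x v u)) (cong₂ _+_ (to s₁₂₂₃) (to s₁₃))))

  total-upper : total-cost + 360 * non-isolated ≤ 240 * total-degree
  total-upper = subst₂ _≤_ (trans (Σ-+ V _ _) (cong (total-cost +_) (Σ-* V 360 (λ u → 𝟙 (1 ≤? d u)))))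
    (Σ-* V 240 d)
    (Σ-mono V λ {u} _ → pointwise u)
    where
    pointwise : ∀ u → ∑[ N u ] (cost u) + 360 * 𝟙 (1 ≤? d u) ≤ 240 * d u
    pointwise u = go (N u) ∈N⁻ refl
      where
      go : ∀ xs → (∀ {x} → x ∈ xs → u ~ x) → N u ≡ xs →
        ∑[ N u ] (cost u) + 360 * 𝟙 (1 ≤? d u) ≤ 240 * d u
      go [] _ e rewrite e = z≤n
      go (x ∷ xs) nbrs e = ≤-trans (+-monoʳ-≤ (∑[ N u ] (cost u)) (*-monoʳ-≤ 360 (𝟙≤1 (1 ≤? d u))))
        (affordable (nbrs (here refl)))
        where
        𝟙≤1 : ∀ {P : Set} (P? : Dec P) → 𝟙 P? ≤ 1
        𝟙≤1 (yes _) = ≤-refl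
        𝟙≤1 (no _) = z≤n

  -- Since `triangle-edges` is six times the number t of triangles, this is half of the
  -- contradiction: 3t is at most the sum of 2d - 6 over the non-isolated vertices. The offsets of
  -- 120 cancel and 30 is divided out.
  dense : triangle-edges + 12 * non-isolated ≤ 4 * total-degree
  dense = lin 4 (λ D T C M → 120 · D ⊕ 30 · T ≤' C ⇒ C ⊕ 360 · M ≤' 240 · D ⇒ ⊢ T ⊕ 12 · M ≤' 4 · D)
    total-degree triangle-edges total-cost non-isolated
    (lin 6 (λ D S T C A B → D ≡' S ⊕ T ⇒ C ≡' A ⊕ B ⇒ 120 · S ≤' A ⇒ 150 · T ≤' B ⇒ ⊢ 120 · D ⊕ 30 · T ≤' C)
      total-degree single-edges triangle-edges total-cost single-cost triangle-cost
      total-degree-split total-cost-split single-lower triangle-lower)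
    total-upper

-- Closed walks of a map, and removing a point from a cyclic order

module Tracing {A : Set} where

  Run : (A → A) → A → List A → A → Set
  Run φ x [] y = x ≡ y
  Run φ x (z ∷ zs) y = x ≡ z × Run φ (φ z) zs y

  -- The empty list is excluded because every listed face has a dart; faces of isolated vertices are
  -- kept apart.
  Cyclic : (A → A) → List A → Set
  Cyclic φ [] = ⊥
  Cyclic φ (z ∷ zs) = Run φ (φ z) zs z

  Run-++ : ∀ {φ x m y} xs {ys} → Run φ x xs m → Run φ m ys y → Run φ x (xs ++ ys) y
  Run-++ [] refl r = r
  Run-++ (z ∷ zs) (e , r) r′ = e , Run-++ zs r r′

  Run-split : ∀ {φ x z y} xs {ys} → Run φ x (xs ++ z ∷ ys) y → Run φ x xs z × Run φ (φ z) ys y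
  Run-split [] r = r
  Run-split (x ∷ xs) (e , r) = let a , b = Run-split xs r in (e , a) , b

  Cyclic⇒Run : ∀ {φ x xs y} → Run φ x xs y → x ≡ y → xs ≢ [] → Cyclic φ xs
  Cyclic⇒Run {xs = []} r e ne = ne refl
  Cyclic⇒Run {xs = z ∷ zs} (refl , r) refl ne = r

  rotate : ∀ {φ z} xs {ys} → Cyclic φ (xs ++ z ∷ ys) → Run φ (φ z) (ys ++ xs) z
  rotate [] {ys} r = subst (λ l → Run _ _ l _) (sym (++-identityʳ ys)) r
  rotate (x ∷ xs) {ys} r = let a , b = Run-split xs r in Run-++ ys b (refl , a)

  module _ {φ φ′ : A → A} (Bad : A → Set)
    (same : ∀ {e} → ¬ Bad (φ e) → φ′ e ≡ φ e) where

    Run-avoiding : ∀ {x y} xs → All (λ z → ¬ Bad z) xs → ¬ Bad y → Run φ x xs y → Run φ′ x xs y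
    Run-avoiding [] _ _ e = e
    Run-avoiding (z ∷ []) (_ ∷ []) y (e , refl) = e , same y
    Run-avoiding (z ∷ xs@(z′ ∷ _)) (_ ∷ as@(b ∷ _)) y (e , r@(e′ , _)) =
      e , subst (λ s → Run φ′ s xs _) (sym (same (subst (λ s → ¬ Bad s) (sym e′) b)))
        (Run-avoiding xs as y r)

    -- The end `y` may be bad. Only the last step enters it, so only that step changes, to the
    -- target given by the first hypothesis.
    Run-redirect : ∀ {x y y′} xs → (∀ {e} → φ e ≡ y → φ′ e ≡ y′) → All (λ z → ¬ Bad z) xs → xs ≢ [] →
      Run φ x xs y → Run φ′ x xs y′
    Run-redirect [] _ _ ne _ = ⊥-elim (ne refl)
    Run-redirect (z ∷ []) new _ _ (e , r) = e , new r
    Run-redirect (z ∷ xs@(z′ ∷ _)) new (_ ∷ as@(b ∷ _)) _ (e , r@(e′ , _)) =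
      e , subst (λ s → Run φ′ s xs _) (sym (same (subst (λ s → ¬ Bad s) (sym e′) b)))
        (Run-redirect xs new as (λ ()) r)

    Cyclic-avoiding : ∀ xs → All (λ z → ¬ Bad z) xs → Cyclic φ xs → Cyclic φ′ xs
    Cyclic-avoiding (z ∷ xs) as@(b ∷ _) r = proj₂ (Run-avoiding (z ∷ xs) as b (refl , r))

module Skipping {A : Set} (_≟_ : ∀ (x y : A) → Dec (x ≡ y)) where

  Steps : (A → A) → A → A → Set
  Steps f = Star (λ x y → f x ≡ y)

  -- The cyclic order of f with `bad` taken out: its predecessor is joined to its successor.
  skip : (A → A) → A → A → A
  skip f bad x with f x ≟ bad
  ... | yes _ = f bad
  ... | no _ = f x

  skip-bad : ∀ {f bad x} → f x ≡ bad → skip f bad x ≡ f bad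
  skip-bad {f} {bad} {x} e with f x ≟ bad
  ... | yes _ = refl
  ... | no h = ⊥-elim (h e)

  skip-good : ∀ {f bad x} → f x ≢ bad → skip f bad x ≡ f x
  skip-good {f} {bad} {x} h with f x ≟ bad
  ... | yes e = ⊥-elim (h e)
  ... | no _ = refl

  skip-steps : ∀ {f bad x y} → y ≢ bad → Steps f x y →
    (x ≢ bad → Steps (skip f bad) x y) × (x ≡ bad → Steps (skip f bad) (f bad) y)
  skip-steps y≢ ε = (λ _ → ε) , (λ e → ⊥-elim (y≢ e))
  skip-steps {f} {bad} {x} y≢ (refl ◅ s) with f x ≟ bad | skip-steps y≢ s
  ... | yes e | _ , b = (λ _ → skip-bad e ◅ b e) , (λ { refl → b e })
  ... | no h | a , _ = (λ _ → skip-good h ◅ a h) , (λ { refl → a h })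

  fixed-steps : ∀ {f x y} → f x ≡ x → Steps f x y → y ≡ x
  fixed-steps e ε = refl
  fixed-steps {f} e (refl ◅ s) = trans (fixed-steps (cong f e) s) e

-- Plane embeddings and the deletion of an edge

module Embeddings {n : ℕ} where

  open Tracing {Fin n × Fin n}
  open Skipping {Fin n} _≟_

  V² : Set
  V² = Fin n × Fin n

  _≟²_ : (x y : V²) → Dec (x ≡ y)
  _≟²_ = ≡-dec _≟_ _≟_

  step : (Fin n → Fin n → Fin n) → V² → V²
  step next (u , v) = v , next v u

  -- `faces` lists the face boundaries; `bare` stands in for the faces of
  -- isolated vertices, which have no boundary.  `roots` meets every component,
  -- so `euler` is the planar half of Euler's formula, counted in darts.
  record Embedded (H : Graph n) : Set where
    open Graph H
    field
      next     : Fin n → Fin n → Fin n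
      closed   : ∀ {v u} → v ~ u → v ~ next v u
      cyclic   : ∀ {v u w} → v ~ u → v ~ w → Steps (next v) u w
      faces    : List (List V²)
      traced   : All (Cyclic (step next)) faces
      unique   : Unique (concat faces)
      covered  : ∀ {a b} → a ~ b → (a , b) ∈ concat faces
      sound    : ∀ {a b} → (a , b) ∈ concat faces → a ~ b
      bare : List (Fin n)
      bare-unique : Unique bare
      bare-sound  : ∀ {v u} → v ∈ bare → ¬ v ~ u
      roots    : List (Fin n)
      rooted   : ∀ x → ∃[ r ] (r ∈ roots × Star _~_ x r)
      euler    : length (concat faces) + 4 * length roots ≤ 2 * n + 2 * length faces + 2 * length bare

  delete : Graph n → Fin n → Fin n → Graph n
  delete H u v = record
    { _~_ = λ x y → x ~ y × ¬ (x ≡ u × y ≡ v) × ¬ (x ≡ v × y ≡ u)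
    ; _~?_ = λ x y → x ~? y ×-dec ¬? (x ≟ u ×-dec y ≟ v) ×-dec ¬? (x ≟ v ×-dec y ≟ u)
    ; ~-sym = λ (e , a , b) → ~-sym e , (λ (p , q) → b (q , p)) , (λ (p , q) → a (q , p))
    ; ~-irrefl = λ e (x~y , _) → ~-irrefl e x~y
    }
    where open Graph H

  concat-↭ : ∀ {A : Set} {xss yss : List (List A)} → xss ↭ yss → concat xss ↭ concat yss
  concat-↭ refl↭ = refl↭
  concat-↭ (prep xs p) = ++⁺ˡ xs (concat-↭ p)
  concat-↭ (swap xs ys p) = trans↭ (shifts xs ys) (++⁺ˡ ys (++⁺ˡ xs (concat-↭ p)))
  concat-↭ (trans↭ p q) = trans↭ (concat-↭ p) (concat-↭ q)

  find-face : ∀ {A : Set} {x : A} xss → x ∈ concat xss → ∃[ xs ] ∃[ rest ] (xss ↭ xs ∷ rest × x ∈ xs)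
  find-face (xs ∷ xss) x∈ with ∈-++⁻ xs x∈
  ... | inj₁ h = xs , xss , refl↭ , h
  ... | inj₂ h with ys , rest , p , y∈ ← find-face xss h =
    ys , xs ∷ rest , trans↭ (prep xs p) (swap xs ys refl↭) , y∈

  module Deletion (H : Graph n) (E : Embedded H) {u v : Fin n} (u~v : Graph._~_ H u v) where
    open Graph H
    open Embedded E

    H′ : Graph n
    H′ = delete H u v

    open Graph H′ using () renaming (_~_ to _~′_; ~-sym to ~′-sym)

    u≢v : u ≢ v
    u≢v e = ~-irrefl e u~v

    next′ : Fin n → Fin n → Fin n
    next′ a with a ≟ u | a ≟ v
    ... | yes _ | _ = skip (next u) v
    ... | no _ | yes _ = skip (next v) u
    ... | no _ | no _ = next a

    next′-u : next′ u ≡ skip (next u) v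
    next′-u with u ≟ u
    ... | yes _ = refl
    ... | no h = ⊥-elim (h refl)

    next′-v : next′ v ≡ skip (next v) u
    next′-v with v ≟ u | v ≟ v
    ... | yes e | _ = ⊥-elim (u≢v (sym e))
    ... | no _ | yes _ = refl
    ... | no _ | no h = ⊥-elim (h refl)

    next′-other : ∀ {a} → a ≢ u → a ≢ v → next′ a ≡ next a
    next′-other {a} a≢u a≢v with a ≟ u | a ≟ v
    ... | yes e | _ = ⊥-elim (a≢u e)
    ... | no _ | yes e = ⊥-elim (a≢v e)
    ... | no _ | no _ = refl

    data Endpoint (a : Fin n) : Set where
      is-u  : a ≡ u → Endpoint a
      is-v  : a ≡ v → Endpoint a
      other : a ≢ u → a ≢ v → Endpoint a

    endpoint? : ∀ a → Endpoint a
    endpoint? a with a ≟ u | a ≟ v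
    ... | yes e | _ = is-u e
    ... | no _ | yes e = is-v e
    ... | no h | no g = other h g

    -- If `b` were its own successor, the cyclic order at `a` would consist of `b` alone, against
    -- `x ≢ b`.
    skip-closed : ∀ {a b x} → a ~ b → a ~ x → x ≢ b → a ~ skip (next a) b x × skip (next a) b x ≢ b
    skip-closed {a} {b} {x} a~b a~x x≢b with next a x ≟ b
    ... | yes _ = closed a~b , λ e → x≢b (fixed-steps e (cyclic a~b a~x))
    ... | no h = closed a~x , h

    closed′ : ∀ {a x} → a ~′ x → a ~′ next′ a x
    closed′ {a} {x} (a~x , h , g) with endpoint? a
    ... | is-u refl rewrite next′-u = let p , q = skip-closed u~v a~x (λ e → h (refl , e)) in
            p , (λ (_ , e) → q e) , (λ (e , _) → u≢v e)
    ... | is-v refl rewrite next′-v = let p , q = skip-closed (~-sym u~v) a~x (λ e → g (refl , e)) in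
            p , (λ (e , _) → u≢v (sym e)) , (λ (_ , e) → q e)
    ... | other a≢u a≢v rewrite next′-other a≢u a≢v = closed a~x , (λ (e , _) → a≢u e) , (λ (e , _) → a≢v e)

    cyclic′ : ∀ {a x y} → a ~′ x → a ~′ y → Steps (next′ a) x y
    cyclic′ {a} {x} {y} (a~x , hx , gx) (a~y , hy , gy) with endpoint? a
    ... | is-u refl rewrite next′-u =
      proj₁ (skip-steps (λ e → hy (refl , e)) (cyclic a~x a~y)) (λ e → hx (refl , e))
    ... | is-v refl rewrite next′-v =
      proj₁ (skip-steps (λ e → gy (refl , e)) (cyclic a~x a~y)) (λ e → gx (refl , e))
    ... | other a≢u a≢v rewrite next′-other a≢u a≢v = cyclic a~x a~y

    φ φ′ : V² → V²
    φ = step next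
    φ′ = step next′

    Deleted : V² → Set
    Deleted e = e ≡ (u , v) ⊎ e ≡ (v , u)

    φ′-same : ∀ {e} → ¬ Deleted (φ e) → φ′ e ≡ φ e
    φ′-same {p , q} h with endpoint? q
    ... | is-u refl rewrite next′-u = cong (u ,_) (skip-good {next u} λ e → h (inj₁ (cong (u ,_) e)))
    ... | is-v refl rewrite next′-v = cong (v ,_) (skip-good {next v} λ e → h (inj₂ (cong (v ,_) e)))
    ... | other q≢u q≢v rewrite next′-other q≢u q≢v = refl

    φ′-uv : ∀ {e} → φ e ≡ (u , v) → φ′ e ≡ φ (v , u)
    φ′-uv {p , q} e with refl ← cong proj₁ e rewrite next′-u =
      cong (u ,_) (skip-bad {next u} (cong proj₂ e))

    φ′-vu : ∀ {e} → φ e ≡ (v , u) → φ′ e ≡ φ (u , v)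
    φ′-vu {p , q} e with refl ← cong proj₁ e rewrite next′-v =
      cong (v ,_) (skip-bad {next v} (cong proj₂ e))

    ~′⇒¬Deleted : ∀ {a b} → a ~′ b → ¬ Deleted (a , b)
    ~′⇒¬Deleted (_ , h , g) (inj₁ refl) = h (refl , refl)
    ~′⇒¬Deleted (_ , h , g) (inj₂ refl) = g (refl , refl)

    ~⇒~′ : ∀ {a b} → a ~ b → ¬ Deleted (a , b) → a ~′ b
    ~⇒~′ a~b h = a~b , (λ { (refl , refl) → h (inj₁ refl) }) , (λ { (refl , refl) → h (inj₂ refl) })

    edge? : ∀ a b → Deleted (a , b) ⊎ ¬ Deleted (a , b)
    edge? a b with (a , b) ≟² (u , v) | (a , b) ≟² (v , u)
    ... | yes e | _ = inj₁ (inj₁ e)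
    ... | no _ | yes e = inj₁ (inj₂ e)
    ... | no h | no g = inj₂ λ { (inj₁ e) → h e ; (inj₂ e) → g e }

    -- A path that uses the deleted edge is cut before its first use; `reached` cuts after the last
    -- one.
    reaches : ∀ {x r} → Star _~_ x r → Star _~′_ x r ⊎ Star _~′_ x u ⊎ Star _~′_ x v
    reaches ε = inj₁ ε
    reaches {x} (_◅_ {j = z} x~z s) with edge? x z
    ... | inj₁ (inj₁ refl) = inj₂ (inj₁ ε)
    ... | inj₁ (inj₂ refl) = inj₂ (inj₂ ε)
    ... | inj₂ h with reaches s
    ...   | inj₁ t = inj₁ (~⇒~′ x~z h ◅ t)
    ...   | inj₂ (inj₁ t) = inj₂ (inj₁ (~⇒~′ x~z h ◅ t))
    ...   | inj₂ (inj₂ t) = inj₂ (inj₂ (~⇒~′ x~z h ◅ t))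

    reached : ∀ {x r} → Star _~_ x r → Star _~′_ x r ⊎ Star _~′_ u r ⊎ Star _~′_ v r
    reached ε = inj₁ ε
    reached {x} (_◅_ {j = z} x~z s) with edge? x z | reached s
    ... | _ | inj₂ t = inj₂ t
    ... | inj₁ (inj₁ refl) | inj₁ t = inj₂ (inj₂ t)
    ... | inj₁ (inj₂ refl) | inj₁ t = inj₂ (inj₁ t)
    ... | inj₂ h | inj₁ t = inj₁ (~⇒~′ x~z h ◅ t)

    Run⇒Star : ∀ {x y} xs → All (λ z → proj₁ z ~′ proj₂ z) xs → Run φ x xs y → Star _~′_ (proj₁ x) (proj₁ y)
    Run⇒Star [] _ refl = ε
    Run⇒Star (z ∷ xs) (a ∷ as) (refl , r) = a ◅ Run⇒Star xs as r

    -- The hypothesis `count` is the change in Euler's inequality. Two darts disappear, so with the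
    -- same roots one face may be lost, while an additional root has to be paid for by one more face
    -- or bare vertex.
    module Assemble (faces′ : List (List V²)) (traced′ : All (Cyclic φ′) faces′)
      (p : concat faces ↭ (u , v) ∷ (v , u) ∷ concat faces′)
      (bare′ : List (Fin n)) (bare′-unique : Unique bare′)
      (bare′-sound : ∀ {a b} → a ∈ bare′ → ¬ a ~′ b)
      (roots′ : List (Fin n)) (rooted′ : ∀ x → ∃[ r ] (r ∈ roots′ × Star _~′_ x r))
      (count : length faces + length bare + 2 * length roots′ ≤ length faces′ + length bare′ + 2 * length
        roots + 1)
      where

      uniq : Unique ((u , v) ∷ (v , u) ∷ concat faces′)
      uniq = Unique-resp-↭ p unique

      result : Embedded H′
      result = record
        { next = next′ ; closed = closed′ ; cyclic = cyclic′ ; faces = faces′ ; traced = traced′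
        ; unique = case uniq of λ { (_ ∷ _ ∷ q) → q }
        ; covered = λ a~′b → case ∈-resp-↭ p (covered (proj₁ a~′b)) of λ
            { (here e) → ⊥-elim (~′⇒¬Deleted a~′b (inj₁ e))
            ; (there (here e)) → ⊥-elim (~′⇒¬Deleted a~′b (inj₂ e))
            ; (there (there m)) → m }
        ; sound = λ m → ~⇒~′ (sound (∈-resp-↭ (↭-sym p) (there (there m)))) λ
            { (inj₁ refl) → head∉tail uniq (there m)
            ; (inj₂ refl) → head∉tail (case uniq of λ { (_ ∷ q) → q }) m }
        ; bare = bare′ ; bare-unique = bare′-unique ; bare-sound = bare′-sound
        ; roots = roots′ ; rooted = rooted′
        ; euler = lin 9 (λ L L′ R R′ n F F′ I I′ → L ≡' # 2 ⊕ L′ ⇒ L ⊕ 4 · R ≤' 2 · n ⊕ 2 · F ⊕ 2 · I ⇒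
              F ⊕ I ⊕ 2 · R′ ≤' F′ ⊕ I′ ⊕ 2 · R ⊕ # 1 ⇒ ⊢ L′ ⊕ 4 · R′ ≤' 2 · n ⊕ 2 · F′ ⊕ 2 · I′)
            (length (concat faces)) (length (concat faces′)) (length roots) (length roots′) n
            (length faces) (length faces′) (length bare) (length bare′) (↭-length p) euler count
        }

    private
      d d′ : V²
      d = u , v
      d′ = v , u

      d≢d′ : d ≢ d′
      d≢d′ e = u≢v (cong proj₁ e)

      good : ∀ {xs} → d ∉ xs → d′ ∉ xs → All (λ z → ¬ Deleted z) xs
      good h g = All.tabulate λ z∈ → λ { (inj₁ refl) → h z∈ ; (inj₂ refl) → g z∈ }

      φd≢d : φ d ≢ d
      φd≢d e = u≢v (sym (cong proj₁ e))

      φd′≢d′ : φ d′ ≢ d′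
      φd′≢d′ e = u≢v (cong proj₁ e)

      turn : ∀ {A : Set} {z : A} as {bs} → as ++ z ∷ bs ↭ z ∷ bs ++ as
      turn {z = z} as {bs} = ++-comm as (z ∷ bs)

      keep : ∀ fs → All (Cyclic φ) fs → All (λ z → ¬ Deleted z) (concat fs) → All (Cyclic φ′) fs
      keep [] [] _ = []
      keep (l ∷ fs) (c ∷ cs) g =
        Cyclic-avoiding Deleted φ′-same l (All.tabulate λ m → All.lookup g (∈-++⁺ˡ m)) c
        ∷ keep fs cs (All.tabulate λ m → All.lookup g (∈-++⁺ʳ l m))

    -- The two faces at uv are different and merge; the rest of either one still
    -- connects u to v.
    merge : ∀ {f g rest} → faces ↭ f ∷ g ∷ rest → d ∈ f → d′ ∈ g → Embedded H′
    merge {f} {g} {rest} p d∈f d′∈g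
      with as , bs , refl ← ∈-∃++ d∈f | as′ , bs′ , refl ← ∈-∃++ d′∈g
      with All-resp-↭ p traced
    ... | cf ∷ cg ∷ cs = Assemble.result ((xs ++ ys) ∷ rest)
        (Cyclic⇒Run (Run-++ xs xs-run ys-run) refl (λ e → xs≢[] (++-conicalˡ xs ys e)) ∷ keep rest cs
          goodrest)
        q bare bare-unique (λ m (a~b , _) → bare-sound m a~b)
        roots rooted′ (lin 4 (λ F F′ I R → F ≡' # 1 ⊕ F′ ⇒ ⊢ F ⊕ I ⊕ 2 · R ≤' F′ ⊕ I ⊕ 2 · R ⊕ # 1)
          (length faces) (suc (length rest)) (length bare) (length roots) (↭-length p))
      where
      xs = bs ++ as
      ys = bs′ ++ as′
      rx : Run φ (φ d) xs d
      rx = rotate as cf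
      ry : Run φ (φ d′) ys d′
      ry = rotate as′ cg
      q : concat faces ↭ d ∷ d′ ∷ ((xs ++ ys) ++ concat rest)
      q = trans↭ (concat-↭ p) (trans↭ (++⁺ʳ _ (turn as))
        (prep d (trans↭ (++⁺ˡ xs (++⁺ʳ (concat rest) (turn as′)))
            (trans↭ (shift d′ xs _) (prep d′
              (subst (xs ++ ys ++ concat rest ↭_) (sym (++-assoc xs ys _)) refl↭))))))
      uniq : Unique (d ∷ d′ ∷ ((xs ++ ys) ++ concat rest))
      uniq = Unique-resp-↭ q unique
      d∉ : d ∉ (xs ++ ys) ++ concat rest
      d∉ m = head∉tail uniq (there m)
      d′∉ : d′ ∉ (xs ++ ys) ++ concat rest
      d′∉ m = head∉tail (case uniq of λ { (_ ∷ w) → w }) m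
      goodxs : All (λ z → ¬ Deleted z) xs
      goodxs = good (d∉ ∘ ∈-++⁺ˡ ∘ ∈-++⁺ˡ) (d′∉ ∘ ∈-++⁺ˡ ∘ ∈-++⁺ˡ)
      goodys : All (λ z → ¬ Deleted z) ys
      goodys = good (d∉ ∘ ∈-++⁺ˡ ∘ ∈-++⁺ʳ xs) (d′∉ ∘ ∈-++⁺ˡ ∘ ∈-++⁺ʳ xs)
      goodrest : All (λ z → ¬ Deleted z) (concat rest)
      goodrest = good (d∉ ∘ ∈-++⁺ʳ (xs ++ ys)) (d′∉ ∘ ∈-++⁺ʳ (xs ++ ys))
      run≢[] : ∀ {x y} zs → x ≢ y → Run φ x zs y → zs ≢ []
      run≢[] _ h r refl = h r
      xs≢[] : xs ≢ []
      xs≢[] = run≢[] xs φd≢d rx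
      xs-run : Run φ′ (φ d) xs (φ d′)
      xs-run = Run-redirect Deleted φ′-same xs φ′-uv goodxs xs≢[] rx
      ys-run : Run φ′ (φ d′) ys (φ d)
      ys-run = Run-redirect Deleted φ′-same ys φ′-vu goodys (run≢[] ys φd′≢d′ ry) ry
      alive : All (λ z → proj₁ z ~′ proj₂ z) xs
      alive = All.tabulate λ {z} m → ~⇒~′ (sound (∈-resp-↭ (↭-sym q) (there (there (∈-++⁺ˡ (∈-++⁺ˡ m))))))
        (All.lookup goodxs m)
      v→u : Star _~′_ v u
      v→u = Run⇒Star xs alive rx
      lift : ∀ {a b} → Star _~_ a b → Star _~′_ a b
      lift ε = ε
      lift {a} (_◅_ {j = z} e s) with edge? a z
      ... | inj₁ (inj₁ refl) = reverse ~′-sym v→u ◅◅ lift s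
      ... | inj₁ (inj₂ refl) = v→u ◅◅ lift s
      ... | inj₂ h = ~⇒~′ e h ◅ lift s
      rooted′ : ∀ x → ∃[ r ] (r ∈ roots × Star _~′_ x r)
      rooted′ x = let r , r∈ , s = rooted x in r , r∈ , lift s

    -- uv borders a single face, which splits in two; an empty part means that an
    -- end of uv becomes isolated.
    module Split {rest : List (List V²)} {xs ys : List V²}
      (q : concat faces ↭ d ∷ d′ ∷ (xs ++ ys ++ concat rest))
      (len : length faces ≡ suc (length rest)) (cs : All (Cyclic φ) rest)
      (rx : Run φ (φ d) xs d′) (ry : Run φ (φ d′) ys d) where

      uniq : Unique (d ∷ d′ ∷ (xs ++ ys ++ concat rest))
      uniq = Unique-resp-↭ q unique
      d∉ : d ∉ xs ++ ys ++ concat rest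
      d∉ m = head∉tail uniq (there m)
      d′∉ : d′ ∉ xs ++ ys ++ concat rest
      d′∉ m = head∉tail (case uniq of λ { (_ ∷ w) → w }) m
      goodxs : All (λ z → ¬ Deleted z) xs
      goodxs = good (d∉ ∘ ∈-++⁺ˡ) (d′∉ ∘ ∈-++⁺ˡ)
      goodys : All (λ z → ¬ Deleted z) ys
      goodys = good (d∉ ∘ ∈-++⁺ʳ xs ∘ ∈-++⁺ˡ) (d′∉ ∘ ∈-++⁺ʳ xs ∘ ∈-++⁺ˡ)
      traced-rest : All (Cyclic φ′) rest
      traced-rest = keep rest cs (good (d∉ ∘ ∈-++⁺ʳ xs ∘ ∈-++⁺ʳ ys) (d′∉ ∘ ∈-++⁺ʳ xs ∘ ∈-++⁺ʳ ys))

      traced-x : xs ≢ [] → Cyclic φ′ xs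
      traced-x h = Cyclic⇒Run (Run-redirect Deleted φ′-same xs φ′-vu goodxs h rx) refl h
      traced-y : ys ≢ [] → Cyclic φ′ ys
      traced-y h = Cyclic⇒Run (Run-redirect Deleted φ′-same ys φ′-uv goodys h ry) refl h

      alone : ∀ {a b c} → a ~ b → next a b ≡ b → a ~ c → c ≡ b
      alone a~b e a~c = fixed-steps e (cyclic a~b a~c)

      -- An empty part means that the walk turns straight back at `v`: then `u` is fixed by the
      -- rotation there and is the only neighbour of `v`.
      v-bare : xs ≡ [] → ∀ {c} → ¬ v ~′ c
      v-bare refl (v~c , _ , g) = g (refl , alone (~-sym u~v) (cong proj₂ rx) v~c)
      u-bare : ys ≡ [] → ∀ {c} → ¬ u ~′ c
      u-bare refl (u~c , g , _) = g (refl , alone u~v (cong proj₂ ry) u~c)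

      old-bare : ∀ {a c} → a ∈ bare → ¬ a ~′ c
      old-bare a∈ (a~c , _) = bare-sound a∈ a~c

      -- One end of `uv` still reaches the old root of `u`; the other end becomes a root. Whether
      -- the component really falls apart need not be known, since the additional face or bare
      -- vertex pays for the root in either case.
      new-root : ∃[ r ] ∀ x → ∃[ s ] (s ∈ r ∷ roots × Star _~′_ x s)
      new-root with rooted u
      ... | r₀ , r₀∈ , s₀ with reached s₀
      ...   | inj₂ (inj₂ v→r₀) = u , λ x → let r , r∈ , s = rooted x in case reaches s of λ
                { (inj₁ t) → r , there r∈ , t
                ; (inj₂ (inj₁ x→u)) → u , here refl , x→u
                ; (inj₂ (inj₂ x→v)) → r₀ , there r₀∈ , x→v ◅◅ v→r₀ }
      ...   | inj₂ (inj₁ u→r₀) = v , λ x → let r , r∈ , s = rooted x in case reaches s of λ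
                { (inj₁ t) → r , there r∈ , t
                ; (inj₂ (inj₁ x→u)) → r₀ , there r₀∈ , x→u ◅◅ u→r₀
                ; (inj₂ (inj₂ x→v)) → v , here refl , x→v }
      ...   | inj₁ u→r₀ = v , λ x → let r , r∈ , s = rooted x in case reaches s of λ
                { (inj₁ t) → r , there r∈ , t
                ; (inj₂ (inj₁ x→u)) → r₀ , there r₀∈ , x→u ◅◅ u→r₀
                ; (inj₂ (inj₂ x→v)) → v , here refl , x→v }

      u∉bare : u ∉ bare
      u∉bare m = bare-sound m u~v
      v∉bare : v ∉ bare
      v∉bare m = bare-sound m (~-sym u~v)

      assemble : ∀ faces′ bare′ → All (Cyclic φ′) faces′ → concat faces′ ≡ xs ++ ys ++ concat rest →
        Unique bare′ → (∀ {a b} → a ∈ bare′ → ¬ a ~′ b) →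
        suc (length faces + length bare) ≡ length faces′ + length bare′ → Embedded H′
      assemble faces′ bare′ t e ub sb c =
        Assemble.result faces′ t (subst (λ l → concat faces ↭ d ∷ d′ ∷ l) (sym e) q)
        bare′ ub sb (proj₁ new-root ∷ roots) (proj₂ new-root)
        (lin 3 (λ a b R → # 1 ⊕ a ≡' b ⇒ ⊢ a ⊕ 2 · (# 1 ⊕ R) ≤' b ⊕ 2 · R ⊕ # 1)
          (length faces + length bare) (length faces′ + length bare′) (length roots) c)

      counted : ∀ a b → a + b ≡ 2 → suc (length faces + length bare) ≡ (a + length rest) + (b + length bare)
      counted a b e = lin 5 (λ F r I a b → F ≡' # 1 ⊕ r ⇒ a ⊕ b ≡' # 2 ⇒
        ⊢ # 1 ⊕ (F ⊕ I) ≡' (a ⊕ r) ⊕ (b ⊕ I))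
        (length faces) (length rest) (length bare) a b len e

      ∷-bare : ∀ {a as} → (∀ {c} → ¬ a ~′ c) → (∀ {b c} → b ∈ as → ¬ b ~′ c) → ∀ {b c} → b ∈ a ∷ as →
        ¬ b ~′ c
      ∷-bare h g (here refl) = h
      ∷-bare h g (there m) = g m

    split-face : ∀ {f rest} → faces ↭ f ∷ rest → d ∈ f → d′ ∈ f → Embedded H′
    split-face {f} {rest} p d∈f d′∈f
      with as , bs , refl ← ∈-∃++ d∈f
      with cf ∷ cs ← All-resp-↭ p traced
      with ∈-resp-↭ (turn as) d′∈f
    ... | here e = ⊥-elim (d≢d′ (sym e))
    ... | there m with xs , ys , e ← ∈-∃++ m = go xs ys refl
      where
      rxy : Run φ (φ d) (xs ++ d′ ∷ ys) d
      rxy = subst (λ l → Run φ (φ d) l d) e (rotate as cf)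
      q : concat faces ↭ d ∷ d′ ∷ (xs ++ ys ++ concat rest)
      q = trans↭ (concat-↭ p) (trans↭ (++⁺ʳ _ (turn as)) (prep d (subst (λ l → l ++ concat rest ↭ _) (sym e)
        (subst (_↭ d′ ∷ xs ++ ys ++ concat rest) (sym (++-assoc xs (d′ ∷ ys) (concat rest)))
          (shift d′ xs (ys ++ concat rest))))))
      open Split {rest} {xs} {ys} q (↭-length p) cs (proj₁ (Run-split xs rxy)) (proj₂ (Run-split xs rxy))
      go : ∀ xs₀ ys₀ → (xs₀ , ys₀) ≡ (xs , ys) → Embedded H′
      go [] [] refl = assemble rest (u ∷ v ∷ bare) traced-rest refl
        (∉⇒Unique (λ { (here h) → u≢v h ; (there h) → u∉bare h }) (∉⇒Unique v∉bare bare-unique))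
        (∷-bare (u-bare refl) (∷-bare (v-bare refl) old-bare)) (counted 0 2 refl)
      go [] (y ∷ ys₀) refl = assemble ((y ∷ ys₀) ∷ rest) (v ∷ bare) (traced-y (λ ()) ∷ traced-rest) refl
        (∉⇒Unique v∉bare bare-unique) (∷-bare (v-bare refl) old-bare) (counted 1 1 refl)
      go (x ∷ xs₀) [] refl = assemble ((x ∷ xs₀) ∷ rest) (u ∷ bare) (traced-x (λ ()) ∷ traced-rest) refl
        (∉⇒Unique u∉bare bare-unique) (∷-bare (u-bare refl) old-bare) (counted 1 1 refl)
      go (x ∷ xs₀) (y ∷ ys₀) refl = assemble ((x ∷ xs₀) ∷ (y ∷ ys₀) ∷ rest) bare
        (traced-x (λ ()) ∷ traced-y (λ ()) ∷ traced-rest) refl bare-unique old-bare (counted 2 0 refl)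

    deletion : Embedded H′
    deletion with find-face faces (covered u~v)
    ... | f , rest , p , d∈f with ∈-++⁻ f (∈-resp-↭ (concat-↭ p) (covered (~-sym u~v)))
    ...   | inj₁ d′∈f = split-face p d∈f d′∈f
    ...   | inj₂ d′∈ with g , rest′ , p′ , d′∈g ← find-face rest d′∈ = merge (trans↭ p (prep f p′)) d∈f d′∈g

-- Face boundaries of the given plane embedding

module Initial {n : ℕ} (G : Graph n) (plane : PlaneEmbedding G) where
  open import Data.Fin using () renaming (_<_ to _<ᶠ_; _<?_ to _<ᶠ?_)
  open import Data.Fin.Properties using () renaming (<-cmp to <ᶠ-cmp)
  open Graph G
  open Embeddings {n}
  open Tracing {V²}
  open Skipping {V²} _≟²_ using (Steps)
  open PlaneEmbedding plane
  open RotationSystem rotation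

  φ : V² → V²
  φ = step next

  IsDart : V² → Set
  IsDart z = proj₁ z ~ proj₂ z

  φ-dart : ∀ {z} → IsDart z → IsDart (φ z)
  φ-dart h = closed (~-sym h)

  class : ∀ z → IsDart z → Fin faces
  class z h = proj₁ #faces (z , h)

  Steps⇒class : ∀ {x y} (hx : IsDart x) (hy : IsDart y) → Steps φ x y → class x hx ≡ class y hy
  Steps⇒class hx hy = Equivalence.to (proj₂ (proj₂ #faces) (_ , hx) (_ , hy))

  class⇒Steps : ∀ {x y} (hx : IsDart x) (hy : IsDart y) → class x hx ≡ class y hy → Steps φ x y
  class⇒Steps hx hy = Equivalence.from (proj₂ (proj₂ #faces) (_ , hx) (_ , hy))

  first-visit : ∀ {x y} → Steps φ x y → ∃[ zs ] (Run φ x zs y × y ∉ zs)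
  first-visit ε = [] , refl , λ ()
  first-visit {x} {y} (refl ◅ s) with x ≟² y | first-visit s
  ... | yes e | _ = [] , e , λ ()
  ... | no h | zs , r , y∉ = x ∷ zs , (refl , r) , λ { (here e) → h (sym e) ; (there m) → y∉ m }

  Run-deterministic : ∀ {x y} zs zs′ → Run φ x zs y → Run φ x zs′ y → y ∉ zs → y ∉ zs′ → zs ≡ zs′
  Run-deterministic [] [] _ _ _ _ = refl
  Run-deterministic [] (z ∷ zs′) refl (refl , _) _ h = ⊥-elim (h (here refl))
  Run-deterministic (z ∷ zs) [] (refl , _) refl h _ = ⊥-elim (h (here refl))
  Run-deterministic (z ∷ zs) (_ ∷ zs′) (refl , r) (refl , r′) h h′ =
    cong (z ∷_) (Run-deterministic zs zs′ r r′ (h ∘ there) (h′ ∘ there))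

  -- A repeated z would yield two runs from φ z to `y` of different lengths, both avoiding `y` on
  -- the way, against determinism.
  Run-unique : ∀ {x y} zs → Run φ x zs y → y ∉ zs → Unique zs
  Run-unique [] _ _ = []
  Run-unique (z ∷ zs) (refl , r) y∉ = ∉⇒Unique z∉ (Run-unique zs r (y∉ ∘ there))
    where
    z∉ : z ∉ zs
    z∉ m with as , bs , refl ← ∈-∃++ m with _ , r″ ← Run-split as r =
      m≢1+n+m (length bs) (trans (cong length (Run-deterministic bs (as ++ z ∷ bs) r″ r
          (λ k → y∉ (there (∈-++⁺ʳ as (there k)))) (y∉ ∘ there)))
        (trans (length-++ as) (+-suc (length as) (length bs))))

  Run-reachable : ∀ {x y} zs → Run φ x zs y → ∀ {z} → z ∈ zs → Steps φ x z
  Run-reachable (z ∷ zs) (refl , r) (here refl) = ε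
  Run-reachable (z ∷ zs) (refl , r) (there m) = refl ◅ Run-reachable zs r m

  Run-closed : ∀ {x y} zs → Run φ x zs y → ∀ {z} → z ∈ zs → φ z ∈ zs ⊎ φ z ≡ y
  Run-closed (z ∷ []) (refl , r) (here refl) = inj₂ r
  Run-closed (z ∷ _ ∷ _) (refl , refl , _) (here refl) = inj₁ (there (here refl))
  Run-closed (z ∷ zs) (_ , r) (there m) = case Run-closed zs r m of λ
    { (inj₁ h) → inj₁ (there h) ; (inj₂ h) → inj₂ h }

  Cyclic-closed : ∀ {z zs} → Run φ (φ z) zs z → ∀ {x y} → Steps φ x y → x ∈ z ∷ zs → y ∈ z ∷ zs
  Cyclic-closed r ε m = m
  Cyclic-closed {z} {zs} r (refl ◅ s) m = Cyclic-closed r s (case Run-closed (z ∷ zs) (refl , r) m of λ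
    { (inj₁ h) → h ; (inj₂ e) → here e })

  record Boundary (i : Fin faces) : Set where
    field
      start   : V²
      rest    : List V²
      dart    : IsDart start
      ofFace  : class start dart ≡ i
      run     : Run φ (φ start) rest start
      start∉  : start ∉ rest

    boundary : List V²
    boundary = start ∷ rest

    boundary-unique : Unique boundary
    boundary-unique = ∉⇒Unique start∉ (Run-unique rest run start∉)

    darts : ∀ {z} → Steps φ start z → IsDart z
    darts s = go s dart
      where
      go : ∀ {x z} → Steps φ x z → IsDart x → IsDart z
      go ε h = h
      go (refl ◅ s) h = go s (φ-dart h)

    member-dart : ∀ {z} → z ∈ boundary → IsDart z
    member-dart m = darts (Run-reachable boundary (refl , run) m)

    member-class : ∀ {z} → z ∈ boundary → (h : IsDart z) → class z h ≡ i
    member-class m h = trans (sym (Steps⇒class dart h (Run-reachable boundary (refl , run) m))) ofFace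

    contains : ∀ {z} (h : IsDart z) → class z h ≡ i → z ∈ boundary
    contains h e = Cyclic-closed run (class⇒Steps dart h (trans ofFace (sym e))) (here refl)

  -- A representative z and φ z have the same class, and class equality can be turned back into
  -- steps from φ z to z. Cutting these at the first return gives the boundary.
  boundaryOf : ∀ i → Boundary i
  boundaryOf i with ((z , h) , e) ← proj₁ (proj₂ #faces) i
    with zs , r , z∉ ← first-visit (class⇒Steps (φ-dart h) h
      (sym (Steps⇒class h (φ-dart h) (refl ◅ ε)))) = record
    { start = z ; rest = zs ; dart = h ; ofFace = e ; run = r ; start∉ = z∉ }

  open Boundary

  boundaries : List (List V²)
  boundaries = tabulate λ i → boundary (boundaryOf i)

  boundaries-unique : Unique (concat boundaries)
  boundaries-unique = Unique.concat⁺
    (All.tabulate⁺ λ i → boundary-unique (boundaryOf i))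
    (AllPairs.tabulate⁺ λ {i} {j} i≢j (a , b) →
      i≢j (trans (sym (member-class (boundaryOf i) a (member-dart (boundaryOf i) a)))
                 (member-class (boundaryOf j) b (member-dart (boundaryOf i) a))))

  boundaries-sound : ∀ {z} → z ∈ concat boundaries → IsDart z
  boundaries-sound m with l , z∈ , l∈ ← ∈-concat⁻′ boundaries m with i , refl ← ∈-tabulate⁻ l∈ =
    member-dart (boundaryOf i) z∈

  boundaries-covered : ∀ {z} → IsDart z → z ∈ concat boundaries
  boundaries-covered {z} h = ∈-concat⁺′ (contains (boundaryOf (class z h)) h refl) (∈-tabulate⁺ (class z h))

  darts≤2edges : length (concat boundaries) ≤ 2 * length (edges G)
  darts≤2edges = ≤-trans (length-⊆ boundaries-unique λ m → sides (boundaries-sound m))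
    (≤-reflexive (trans (length-++ (edges G)) (cong (length (edges G) +_)
      (trans (length-map Product.swap (edges G)) (sym (+-identityʳ _))))))
    where
    edge : ∀ {a b} → a <ᶠ b → a ~ b → (a , b) ∈ edges G
    edge {a} {b} a<b a~b = ∈-filter⁺ (λ (u , v) → (u <ᶠ? v) ×-dec (u ~? v))
      (∈-cartesianProduct⁺ (∈-allFin a) (∈-allFin b)) (a<b , a~b)
    sides : ∀ {z} → IsDart z → z ∈ edges G ++ map Product.swap (edges G)
    sides {a , b} h with <ᶠ-cmp a b
    ... | tri< a<b _ _ = ∈-++⁺ˡ (edge a<b h)
    ... | tri≈ _ e _ = ⊥-elim (~-irrefl e h)
    ... | tri> _ _ b<a = ∈-++⁺ʳ (edges G) (∈-map⁺ Product.swap (edge b<a (~-sym h)))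

  representative : Fin components → Fin n
  representative i = proj₁ (proj₁ (proj₂ #components) i)

  embedded : Embedded G
  embedded = record
    { next = next ; closed = closed ; cyclic = cyclic ; faces = boundaries
    ; traced = All.tabulate⁺ λ i → run (boundaryOf i)
    ; unique = boundaries-unique ; covered = boundaries-covered ; sound = boundaries-sound
    ; bare = isolated G ; bare-unique = Unique.filter⁺ _ (Unique.allFin⁺ n)
    ; bare-sound = λ {v} {u} v∈ v~u → case subst (1 ≤_)
        (proj₂ (∈-filter⁻ (λ v → degree G v ℕ.≟ 0) {xs = allFin n} v∈))
        (∈-length (∈-filter⁺ (v ~?_) (∈-allFin u) v~u)) of λ ()
    ; roots = tabulate representative
    ; rooted = λ x → let i = proj₁ #components x in representative i , ∈-tabulate⁺ i ,
        Equivalence.from (proj₂ (proj₂ #components) x (representative i))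
          (sym (proj₂ (proj₁ (proj₂ #components) i)))
    ; euler = lin 9 (λ L E n F I R C F′ R′ → L ≤' 2 · E ⇒ n ⊕ (F ⊕ I) ≡' E ⊕ 2 · C ⇒ F′ ≡' F ⇒ R′ ≡' C ⇒
          ⊢ L ⊕ 4 · R′ ≤' 2 · n ⊕ 2 · F′ ⊕ 2 · I)
        (length (concat boundaries)) (length (edges G)) n faces (length (isolated G)) 0 components
        (length boundaries) (length (tabulate representative)) darts≤2edges euler
        (length-tabulate (λ i → boundary (boundaryOf i))) (length-tabulate representative)
    }

-- Euler's formula without faces of length 4 or 5

module Sparsity {n : ℕ} (H : Graph n) (E : Embeddings.Embedded H)
  (no-C4 : C4-Free H) (no-C5 : C5-Free H)
  (no-leaf : ∀ v → degree H v ≢ 1)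
  (two-next-to-≥3 : ∀ {u v} → degree H u ≡ 2 → Graph._~_ H u v → 3 ≤ degree H v)
  {a₀ b₀ : Fin n} (a₀~b₀ : Graph._~_ H a₀ b₀) where

  open Neighbourhoods H
  open Embeddings {n}
  open Tracing {V²}
  open Skipping {Fin n} _≟_ using (Steps; fixed-steps)
  open Embedded E

  private
    V : List (Fin n)
    V = allFin n

    φ : V² → V²
    φ = step next

    L : List V²
    L = concat faces

  ~-respʳ : ∀ {u v w} → u ~ v → v ≡ w → u ~ w
  ~-respʳ h refl = h

  -- A neighbour fixed by the rotation at `a` is the only one, which would make `a` a leaf.
  no-backtrack : ∀ {a b} → a ~ b → next a b ≢ b
  no-backtrack {a} {b} a~b e = no-leaf a (≤-antisym
    (length-⊆ {ys = b ∷ []} (N-unique a) λ m → here (fixed-steps e (cyclic a~b (∈N⁻ m))))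
    (∈-length (∈N⁺ a~b)))

  -- Holds for the darts of triangular faces. These are counted twice, so that every face weighs at
  -- least 6.
  Short : V² → Set
  Short e = φ (φ (φ e)) ≡ e

  short? : ∀ e → Dec (Short e)
  short? e = φ (φ (φ e)) ≟² e

  -- A face is a closed walk without backtracking, so length 4 or 5 would give a cycle.
  face-weight : ∀ f → Cyclic φ f → (∀ {a b} → (a , b) ∈ f → a ~ b) → 6 ≤ ∑[ f ] (λ e → 1 + 𝟙 (short? e))
  face-weight ((a , b) ∷ []) e dart = ⊥-elim (~-irrefl (sym (cong proj₁ e)) (dart (here refl)))
  face-weight ((a , b) ∷ _ ∷ []) (refl , e) dart =
    ⊥-elim (no-backtrack (~-sym (dart (here refl))) (cong proj₁ e))
  face-weight (z ∷ _ ∷ _ ∷ []) (refl , refl , e) dart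
    with short? z | short? (φ z) | short? (φ (φ z))
  ... | yes _ | yes _ | yes _ = ≤-refl
  ... | no h | _ | _ = ⊥-elim (h e)
  ... | _ | no h | _ = ⊥-elim (h (cong φ e))
  ... | _ | _ | no h = ⊥-elim (h (cong (φ ∘ φ) e))
  face-weight ((a , b) ∷ _ ∷ _ ∷ _ ∷ []) (refl , refl , refl , e) dart = ⊥-elim (no-C4
    (dart (here refl)) (dart (there (here refl))) (dart (there (there (here refl))))
    (~-respʳ (dart (there (there (there (here refl))))) (cong proj₁ e))
    (λ a≡c → no-backtrack (~-sym (dart (here refl))) (sym a≡c))
    (λ b≡d → no-backtrack (~-sym (dart (there (here refl)))) (sym b≡d)))
  face-weight ((a , b) ∷ _ ∷ _ ∷ _ ∷ _ ∷ []) (refl , refl , refl , refl , e) dart = ⊥-elim (no-C5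
    (dart (here refl)) (dart (there (here refl))) (dart (there (there (here refl))))
    (dart (there (there (there (here refl)))))
    (~-respʳ (dart (there (there (there (there (here refl)))))) (cong proj₁ e))
    (λ q → no-backtrack (~-sym (dart (here refl))) (sym q))
    (λ q → no-backtrack (~-sym (dart (there (here refl)))) (sym q))
    (λ q → no-backtrack (~-sym (dart (there (there (here refl))))) (sym q))
    (λ q → no-backtrack (~-sym (dart (there (there (there (here refl)))))) (trans (cong proj₁ e) (sym q)))
    (λ q → no-backtrack (~-sym (dart (there (there (there (there (here refl)))))))
      (trans (cong proj₂ e) (sym q))))
  face-weight f@(_ ∷ _ ∷ _ ∷ _ ∷ _ ∷ _ ∷ f′) _ _ = ≤-trans {6} {length f} (m≤m+n 6 (length f′))
    (≤-trans (≤-reflexive (length≡Σ f)) (Σ-mono f λ _ → s≤s z≤n))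

  faces-weight : 6 * length faces ≤ length L + length (filter short? L)
  faces-weight = ≤-trans (go faces traced (λ m → sound m))
    (≤-reflexive (trans (Σ-+ L (λ _ → 1) (λ e → 𝟙 (short? e)))
      (cong₂ _+_ (sym (length≡Σ L)) (sym (length-filter≡Σ short? L)))))
    where
    go : ∀ fs → All (Cyclic φ) fs → (∀ {a b} → (a , b) ∈ concat fs → a ~ b) →
      6 * length fs ≤ ∑[ concat fs ] (λ e → 1 + 𝟙 (short? e))
    go [] _ _ = z≤n
    go (f ∷ fs) (c ∷ cs) dart = subst₂ _≤_ (sym (*-suc 6 (length fs))) (sym (Σ-++ f (concat fs) _))
      (+-mono-≤ (face-weight f c (dart ∘ ∈-++⁺ˡ)) (go fs cs (dart ∘ ∈-++⁺ʳ f)))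

  allV² : List V²
  allV² = cartesianProduct V V

  V²-unique : Unique allV²
  V²-unique = Unique.cartesianProduct⁺ (Unique.allFin⁺ n) (Unique.allFin⁺ n)

  ∈allV² : ∀ z → z ∈ allV²
  ∈allV² (a , b) = ∈-cartesianProduct⁺ (∈-allFin a) (∈-allFin b)

  count-V² : ∀ {P : Fin n → Fin n → Set} (P? : ∀ u v → Dec (P u v)) →
    length (filter (λ (u , v) → P? u v) allV²) ≡ ∑[ V ] λ u → ∑[ V ] λ v → 𝟙 (P? u v)
  count-V² P? = trans (length-filter≡Σ (λ (u , v) → P? u v) allV²) (Σ-cartesianProduct V V _)

  degree≤L : ∑[ V ] (degree H) ≤ length L
  degree≤L = subst (_≤ length L)
    (trans (count-V² _~?_) (sym (Σ-cong V λ {u} _ → length-filter≡Σ (u ~?_) V)))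
    (length-⊆ (Unique.filter⁺ _ V²-unique)
      λ m → covered (proj₂ (∈-filter⁻ (λ (u , v) → u ~? v) {xs = allV²} m)))

  short-triangle : ∀ {a b} → a ~ b → Short (a , b) → Triangle a b (next b a)
  short-triangle {a} {b} a~b e = a~b ,
    ~-sym (~-respʳ (closed (~-sym (closed (~-sym a~b)))) (cong proj₁ e)) , closed (~-sym a~b)

  -- Both sides of an edge can be triangular faces only in a triangle component.
  ¬both-short : ∀ {a b} → a ~ b → Short (a , b) → Short (b , a) → ⊥
  ¬both-short {a} {b} a~b e e′ = <⇒≱
    (two-next-to-≥3 (≤-antisym (only-two b-orbit) (two-of b~a b~c a≢c)) b~a)
      (only-two a-orbit)
    where
    c = next b a
    t = short-triangle a~b e
    b~a = ~-sym a~b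
    b~c = proj₂ (proj₂ t)
    a≢c : a ≢ c
    a≢c = ~⇒≢ (proj₁ (proj₂ t))
    c≡ : next a b ≡ c
    c≡ = third-unique no-C4 (triangle-swap (triangle-rot (short-triangle b~a e′))) t
    only-two : ∀ {v x y} → (∀ {w} → v ~ w → w ≡ x ⊎ w ≡ y) → degree H v ≤ 2
    only-two {v} {x} {y} f = length-⊆ {ys = x ∷ y ∷ []} (N-unique v) λ m → case f (∈N⁻ m) of λ
      { (inj₁ refl) → here refl ; (inj₂ refl) → there (here refl) }
    two-of : ∀ {v x y} → v ~ x → v ~ y → x ≢ y → 2 ≤ degree H v
    two-of v~x v~y x≢y = length-⊆ ((x≢y ∷ []) ∷ [] ∷ []) λ
      { (here refl) → ∈N⁺ v~x ; (there (here refl)) → ∈N⁺ v~y }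
    orbit : ∀ {v x y w} → next v x ≡ y → next v y ≡ x → Steps (next v) x w → w ≡ x ⊎ w ≡ y
    orbit p q ε = inj₁ refl
    orbit p q (refl ◅ s) with refl ← p = case orbit q refl s of λ { (inj₁ h) → inj₂ h ; (inj₂ h) → inj₁ h }
    b-orbit : ∀ {w} → b ~ w → w ≡ a ⊎ w ≡ c
    b-orbit b~w = orbit refl (subst (λ z → next b z ≡ a) c≡ (back e′)) (cyclic b~a b~w)
      where
      back : Short (b , a) → next b (next a b) ≡ a
      back h = trans (cong (λ z → next z (next a b)) (sym (cong proj₁ h))) (cong proj₂ h)
    a-orbit : ∀ {w} → a ~ w → w ≡ b ⊎ w ≡ c
    a-orbit a~w = orbit c≡ back (cyclic a~b a~w)
      where
      back : next a c ≡ b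
      back = trans (cong (λ z → next z c) (sym (cong proj₁ e))) (cong proj₂ e)

  -- By `¬both-short` the reversal of a short dart is not short, so the short darts and their
  -- reversals are disjoint; all of them are ordered pairs in triangles.
  shorts≤triangles : 2 * length (filter short? L) ≤ ∑[ V ] λ u → ∑[ V ] λ v → 𝟙 (inTriangle? u v)
  shorts≤triangles = subst₂ _≤_
    (trans (length-++ S) (cong (length S +_) (trans (length-map Product.swap S) (sym (+-identityʳ _)))))
    (count-V² inTriangle?)
    (length-⊆ {ys = filter (λ (u , v) → inTriangle? u v) allV²}
      (Unique.++⁺ S-unique (Unique.map⁺ (λ {x} {y} → cong Product.swap) S-unique)
        λ (p , q) → case ∈-map⁻ Product.swap q of λ { (z , z∈ , refl) →
          ¬both-short (S-dart z∈) (S-short z∈) (S-short p) })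
      λ {z} m → ∈-filter⁺ (λ (u , v) → inTriangle? u v) (∈allV² z) (case ∈-++⁻ S m of λ
        { (inj₁ p) → _ , short-triangle (S-dart p) (S-short p)
        ; (inj₂ q) → case ∈-map⁻ Product.swap q of λ { (z , z∈ , refl) →
            _ , triangle-swap (triangle-rot (short-triangle (S-dart z∈) (S-short z∈))) } }))
    where
    S = filter short? L
    S-unique : Unique S
    S-unique = Unique.filter⁺ short? unique
    S-dart : ∀ {z} → z ∈ S → proj₁ z ~ proj₂ z
    S-dart m = sound (proj₁ (∈-filter⁻ short? {xs = L} m))
    S-short : ∀ {z} → z ∈ S → Short z
    S-short m = proj₂ (∈-filter⁻ short? {xs = L} m)

  lonely : List (Fin n)
  lonely = filter (λ v → degree H v ℕ.≟ 0) V

  lonely⇒≁ : ∀ {v u} → v ∈ lonely → ¬ v ~ u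
  lonely⇒≁ {v} v∈ v~u = case subst (1 ≤_) (proj₂ (∈-filter⁻ (λ v → degree H v ℕ.≟ 0) {xs = V} v∈))
    (∈-length (∈N⁺ v~u)) of λ ()

  bare≤lonely : length bare ≤ length lonely
  bare≤lonely = length-⊆ bare-unique λ {v} m →
    ∈-filter⁺ (λ v → degree H v ℕ.≟ 0) (∈-allFin v) (zero-degree (N v) ∈N⁻ (λ v~u → bare-sound m v~u))
    where
    zero-degree : ∀ {v} xs → (∀ {x} → x ∈ xs → v ~ x) → (∀ {u} → ¬ v ~ u) → length xs ≡ 0
    zero-degree [] _ _ = refl
    zero-degree (x ∷ xs) f h = ⊥-elim (h (f (here refl)))

  n≡ : n ≡ (∑[ V ] λ u → 𝟙 (1 ≤? degree H u)) + length lonely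
  n≡ = trans (sym (length-tabulate {n = n} id)) (trans (length≡Σ V)
    (trans (Σ-cong V λ {u} _ → pointwise (degree H u)) (trans (Σ-+ V _ _)
      (cong ((∑[ V ] λ u → 𝟙 (1 ≤? degree H u)) +_) (sym (length-filter≡Σ _ V))))))
    where
    pointwise : ∀ m → 1 ≡ 𝟙 (1 ≤? m) + 𝟙 (m ℕ.≟ 0)
    pointwise zero = refl
    pointwise (suc m) = refl

  -- An isolated vertex can only be its own root, and the root of `a₀` is a further one because it
  -- has a neighbour.
  lonely<roots : suc (length lonely) ≤ length roots
  lonely<roots with r , r∈ , s ← rooted a₀ = length-⊆
    (∉⇒Unique (λ m → lonely⇒≁ m (proj₂ (has-neighbour s))) (Unique.filter⁺ _ (Unique.allFin⁺ n)))
    λ { (here refl) → r∈ ; (there {xs = _} m) → self-rooted m }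
    where
    has-neighbour : ∀ {r} → Star _~_ a₀ r → ∃[ x ] r ~ x
    has-neighbour s = go s (_ , a₀~b₀)
      where
      go : ∀ {x r} → Star _~_ x r → ∃[ y ] x ~ y → ∃[ y ] r ~ y
      go ε h = h
      go (e ◅ s) _ = go s (_ , ~-sym e)
    self-rooted : ∀ {v} → v ∈ lonely → v ∈ roots
    self-rooted {v} m with rooted v
    ... | _ , r∈ , ε = r∈
    ... | _ , _ , e ◅ _ = ⊥-elim (lonely⇒≁ m e)

  -- Six times Euler's inequality. An isolated vertex cancels: 24 for its root against 12 for the
  -- vertex and 12 for its bare face. The 24 that remains comes from the root of `a₀` and makes the
  -- bound strict.
  sparse : 4 * ∑[ V ] (degree H) + 24 ≤
    12 * (∑[ V ] λ u → 𝟙 (1 ≤? degree H u)) + (∑[ V ] λ u → ∑[ V ] λ v → 𝟙 (inTriangle? u v))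
  sparse = lin 10 (λ D ℓ F S T n M I B R → D ≤' ℓ ⇒ 6 · F ≤' ℓ ⊕ S ⇒ 2 · S ≤' T ⇒ n ≡' M ⊕ I ⇒ B ≤' I ⇒
    # 1 ⊕ I ≤' R ⇒
      ℓ ⊕ 4 · R ≤' 2 · n ⊕ 2 · F ⊕ 2 · B ⇒ ⊢ 4 · D ⊕ # 24 ≤' 12 · M ⊕ T)
    (∑[ V ] (degree H)) (length L) (length faces) (length (filter short? L))
    (∑[ V ] λ u → ∑[ V ] λ v → 𝟙 (inTriangle? u v)) n (∑[ V ] λ u → 𝟙 (1 ≤? degree H u)) (length lonely)
      (length bare) (length roots)
    degree≤L faces-weight shorts≤triangles n≡ bare≤lonely lonely<roots euler

-- Exhaustive search and least witnesses

module Decisions where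

  Searchable : Set → Set₁
  Searchable A = ∀ {P : A → Set} → (∀ a → Dec (P a)) → Dec (∃ P)

  Fin-searchable : ∀ {m} → Searchable (Fin m)
  Fin-searchable = any?

  Vec-searchable : ∀ {A} → Searchable A → ∀ m → Searchable (Vec A m)
  Vec-searchable s zero P? = map′ (λ p → [] , p) (λ { ([] , p) → p }) (P? [])
  Vec-searchable s (suc m) P? = map′ (λ (a , as , p) → a ∷ as , p) (λ { (a ∷ as , p) → a , as , p })
    (s λ a → Vec-searchable s m λ as → P? (a ∷ as))

  search-all : ∀ {A : Set} → Searchable A → ∀ {P : A → Set} → (∀ a → Dec (P a)) → Dec (∀ a → P a)
  search-all s P? = map′ (λ h a → decidable-stable (P? a) λ ¬p → h (a , ¬p)) (λ h (a , ¬p) → ¬p (h a))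
    (¬? (s λ a → ¬? (P? a)))

  least : ∀ {P : ℕ → Set} → (∀ j → Dec (P j)) → ∀ {b} → P b → ∃[ k ] (Least P k × k ≤ b)
  least {P} P? {b} pb = go b 0 (λ _ _ → z≤n) (≤-reflexive (sym (+-identityʳ b)))
    where
    go : ∀ fuel k → (∀ j → P j → k ≤ j) → b ≤ fuel + k → ∃[ k ] (Least P k × k ≤ b)
    go fuel k below h with P? k
    ... | yes p = k , (p , below) , below b pb
    go zero k below h | no ¬p = ⊥-elim (¬p (subst P (≤-antisym h (below b pb)) pb))
    go (suc fuel) k below h | no ¬p =
      go fuel (suc k) (λ j pj → ≤∧≢⇒< (below j pj) λ { refl → ¬p pj }) (subst (b ≤_) (sym (+-suc fuel k)) h)

-- Colouring and painting along a degenerate order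

module Greedy {n : ℕ} (Q : Graph n) where
  open Graph Q
  open Decisions
  open Neighbourhoods Q using (N; N-unique; ∈N⁺; ∈N⁻)
  open import Data.Fin.Subset using (Subset; ⊤; _─_; Nonempty; inside) renaming (_∈_ to _∈ₛ_; _⊆_ to _⊆ₛ_; _∉_ to _∉ₛ_)
  open import Data.Fin.Subset.Properties
    using (nonempty?; _⊆?_; p─q⊆p; anySubset?) renaming (_∈?_ to _∈ₛ?_)
  open import Data.List using (lookup)
  open import Data.List.Membership.DecPropositional (_≟_ {n}) using (_∈?_)
  open import Data.List.Membership.DecPropositional ℕ._≟_ using () renaming (_∈?_ to _∈ᶜ?_)
  open import Data.List.Relation.Unary.Any.Properties using (lookup-index)

  outside : List (Fin n) → Fin n → List (Fin n)
  outside ws v = filter (λ x → ¬? (x ∈? ws)) (N v)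

  ∈outside⁺ : ∀ {ws v x} → v ~ x → x ∉ ws → x ∈ outside ws v
  ∈outside⁺ {ws} h = ∈-filter⁺ (λ x → ¬? (x ∈? ws)) (∈N⁺ h)

  ∈outside⁻ : ∀ {ws v x} → x ∈ outside ws v → v ~ x × x ∉ ws
  ∈outside⁻ {ws} {v} m = let a , b = ∈-filter⁻ (λ x → ¬? (x ∈? ws)) {xs = N v} m in ∈N⁻ a , b

  -- Vertices removed one at a time (the last one at the head), each with at
  -- most m neighbours left at that moment; coloured in the opposite order,
  -- each meets at most m coloured neighbours.
  data Peeled (m : ℕ) : List (Fin n) → Set where
    stop : Peeled m []
    peel : ∀ {w ws} → Peeled m ws → w ∉ ws → length (outside ws w) ≤ m → Peeled m (w ∷ ws)

  Peeled-unique : ∀ {m ws} → Peeled m ws → Unique ws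
  Peeled-unique stop = []
  Peeled-unique (peel p w∉ _) = ∉⇒Unique w∉ (Peeled-unique p)

  Degenerate : ℕ → Set
  Degenerate m = ∃[ ws ] (Peeled m ws × (∀ v → v ∈ ws))

  peel-all : ∀ m → ∃[ ws ] (Peeled m ws × (∀ v → v ∉ ws → m < length (outside ws v)))
  peel-all m = go n [] stop (≤-reflexive (sym (+-identityʳ n)))
    where
    go : ∀ fuel ws → Peeled m ws → n ≤ fuel + length ws →
      ∃[ ws ] (Peeled m ws × (∀ v → v ∉ ws → m < length (outside ws v)))
    go fuel ws p h with any? (λ v → ¬? (v ∈? ws) ×-dec length (outside ws v) ≤? m)
    ... | no none = ws , p , λ v v∉ → ≰⇒> λ q → none (v , v∉ , q)
    go zero ws p h | yes (v , v∉ , q) = ⊥-elim (<⇒≱ (s≤s h)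
      (subst (suc (length ws) ≤_) (length-tabulate {n = n} id)
        (length-⊆ {ys = allFin n} (Peeled-unique (peel p v∉ q)) λ _ → ∈-allFin _)))
    go (suc fuel) ws p h | yes (v , v∉ , q) =
      go fuel (v ∷ ws) (peel p v∉ q) (subst (n ≤_) (sym (+-suc fuel (length ws))) h)

  unused : ∀ {xs ys : List ℕ} → Unique xs → length ys < length xs → ∃[ c ] (c ∈ xs × c ∉ ys)
  unused {xs} {ys} u h with Any.any? (λ c → ¬? (c ∈ᶜ? ys)) xs
  ... | yes p = find p
  ... | no none = ⊥-elim (<⇒≱ h (length-⊆ u λ {c} c∈ → decidable-stable (c ∈ᶜ? ys) λ c∉ →
    none (lose c∈ c∉)))

  degenerate⇒choosable : ∀ {m} → Degenerate m → Choosable Q (suc m)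
  -- All vertices start uncoloured and 0 is a mere placeholder: the invariants of `go` concern only
  -- vertices outside the remaining list.
  degenerate⇒choosable {m} (ws , p , all) L = go p (λ _ → 0)
    (λ {u} _ u∉ _ → ⊥-elim (u∉ (all u))) (λ v v∉ → ⊥-elim (v∉ (all v)))
    where
    open ListAssignment L
    go : ∀ {ws} → Peeled m ws → (f : Fin n → ℕ) → (∀ {u v} → u ~ v → u ∉ ws → v ∉ ws → f u ≢ f v) →
      (∀ v → v ∉ ws → f v ∈ list v) → Coloring Q L
    go stop f proper allowed = record { color = f ; proper = λ h →
      proper h (λ ()) (λ ()) ; allowed = λ v → allowed v (λ ()) }
    go {w ∷ ws} (peel p w∉ few) f proper allowed
      with c , c∈ , fresh ← unused {ys = map f (outside ws w)} (unique w)
        (≤-trans (s≤s (subst (_≤ m) (sym (length-map f (outside ws w))) few))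
          (≤-reflexive (sym (size w)))) =
      go p f′ proper′ allowed′
      where
      f′ : Fin n → ℕ
      f′ x with x ≟ w
      ... | yes _ = c
      ... | no _ = f x
      ∉∷ : ∀ {x} → x ≢ w → x ∉ ws → x ∉ w ∷ ws
      ∉∷ h g (here e) = h e
      ∉∷ h g (there m) = g m
      proper′ : ∀ {u v} → u ~ v → u ∉ ws → v ∉ ws → f′ u ≢ f′ v
      proper′ {u} {v} u~v hu hv with u ≟ w | v ≟ w
      ... | yes refl | yes refl = ⊥-elim (~-irrefl refl u~v)
      ... | yes refl | no _ = λ e → fresh (subst (_∈ _) (sym e) (∈-map⁺ f (∈outside⁺ u~v hv)))
      ... | no _ | yes refl = λ e → fresh (subst (_∈ _) e (∈-map⁺ f (∈outside⁺ (~-sym u~v) hu)))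
      ... | no g | no g′ = proper u~v (∉∷ g hu) (∉∷ g′ hv)
      allowed′ : ∀ v → v ∉ ws → f′ v ∈ list v
      allowed′ v h with v ≟ w
      ... | yes refl = c∈
      ... | no g = allowed v (∉∷ g h)

  predecessors : List (Fin n) → Fin n → List (Fin n)
  predecessors [] v = []
  predecessors (w ∷ ws) v with v ≟ w
  ... | yes _ = outside ws v
  ... | no _ = predecessors ws v

  predecessors-unique : ∀ ws v → Unique (predecessors ws v)
  predecessors-unique [] v = []
  predecessors-unique (w ∷ ws) v with v ≟ w
  ... | yes _ = Unique.filter⁺ _ (N-unique v)
  ... | no _ = predecessors-unique ws v

  predecessors-few : ∀ {m ws} → Peeled m ws → ∀ v → length (predecessors ws v) ≤ m
  predecessors-few stop v = z≤n
  predecessors-few {ws = w ∷ _} (peel p _ few) v with v ≟ w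
  ... | yes refl = few
  ... | no _ = predecessors-few p v

  record Reply (order : List (Fin n)) (S : Subset n) : Set where
    field
      painted     : List (Fin n)
      listed      : ∀ {v} → v ∈ painted → v ∈ₛ S
      independent : ∀ {u v} → u ∈ painted → v ∈ painted → ¬ u ~ v
      dominating  : ∀ {v} → v ∈ order → v ∈ₛ S →
        v ∈ painted ⊎ ∃[ u ] (u ∈ painted × u ∈ predecessors order v)

  -- The order is scanned from its head, with `chosen` the vertices painted so far. A listed vertex
  -- is passed over only if it has a neighbour in `chosen`; this one lies outside the rest of the
  -- order, so it is a predecessor.
  greedy : ∀ {ws} → Unique ws → ∀ S (chosen : List (Fin n)) → (∀ {v} → v ∈ chosen → v ∈ₛ S) →
    (∀ {u v} → u ∈ chosen → v ∈ chosen → ¬ u ~ v) → (∀ {v} → v ∈ chosen → v ∉ ws) →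
    Σ[ r ∈ Reply ws S ] (∀ {v} → v ∈ chosen → v ∈ Reply.painted r)
  greedy {[]} _ S chosen sub ind _ =
    record { painted = chosen ; listed = sub ; independent = ind ; dominating = λ () } , id
  greedy {w ∷ ws} uniq@(_ ∷ uniq′) S chosen sub ind disj = go (w ∈ₛ? S) (Any.any? (w ~?_) chosen)
    where
    extend : ∀ {chosen′} (rest : Σ[ r ∈ Reply ws S ] (∀ {v} → v ∈ chosen′ → v ∈ Reply.painted r)) →
      (∀ {v} → v ∈ chosen → v ∈ chosen′) →
      (w ∈ₛ S → w ∈ Reply.painted (proj₁ rest) ⊎ ∃[ u ]
        (u ∈ Reply.painted (proj₁ rest) × u ∈ outside ws w)) →
      Σ[ r ∈ Reply (w ∷ ws) S ] (∀ {v} → v ∈ chosen → v ∈ Reply.painted r)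
    extend (r , keep) sub′ at-w = record
      { painted = Reply.painted r ; listed = Reply.listed r ; independent =
        Reply.independent r ; dominating = dom }
      , keep ∘ sub′
      where
      dom : ∀ {v} → v ∈ w ∷ ws → v ∈ₛ S →
        v ∈ Reply.painted r ⊎ ∃[ u ] (u ∈ Reply.painted r × u ∈ predecessors (w ∷ ws) v)
      dom {v} m v∈S with v ≟ w | m
      ... | yes refl | _ = at-w v∈S
      ... | no h | here e = ⊥-elim (h e)
      ... | no h | there m′ = Reply.dominating r m′ v∈S
    leave : Σ[ r ∈ Reply ws S ] (∀ {v} → v ∈ chosen → v ∈ Reply.painted r)
    leave = greedy uniq′ S chosen sub ind (λ m k → disj m (there k))
    go : Dec (w ∈ₛ S) → Dec (Any.Any (w ~_) chosen) →
      Σ[ r ∈ Reply (w ∷ ws) S ] (∀ {v} → v ∈ chosen → v ∈ Reply.painted r)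
    go (no w∉S) _ = extend leave id λ w∈S → ⊥-elim (w∉S w∈S)
    go (yes w∈S) (yes blocked) = extend leave id λ _ → let x , x∈ , w~x = find blocked in
      inj₂ (x , proj₂ leave x∈ , ∈outside⁺ w~x λ k → disj x∈ (there k))
    go (yes w∈S) (no free) = extend
      (greedy uniq′ S (w ∷ chosen)
        (λ { (here refl) → w∈S ; (there m) → sub m })
        (λ { (here refl) (here refl) → ~-irrefl refl ; (here refl) (there m) h → free (lose m h)
           ; (there m) (here refl) h → free (lose m (~-sym h)) ; (there m) (there m′) → ind m m′ })
        (λ { (here refl) → head∉tail uniq ; (there m) k → disj m (there k) }))
      there λ _ → inj₁ (proj₂ (greedy uniq′ S (w ∷ chosen) _ _ _) (here refl))

  toSubset : List (Fin n) → Subset n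
  toSubset xs = Vec.tabulate λ v → does (v ∈? xs)

  ∈toSubset⁺ : ∀ {xs v} → v ∈ xs → v ∈ₛ toSubset xs
  ∈toSubset⁺ {xs} {v} m = lookup⇒[]= v _ (trans (lookup∘tabulate _ v) (dec-true (v ∈? xs) m))

  ∈toSubset⁻ : ∀ {xs v} → v ∈ₛ toSubset xs → v ∈ xs
  ∈toSubset⁻ {xs} {v} m with v ∈? xs | trans (sym (lookup∘tabulate (λ v → does (v ∈? xs)) v)) ([]=⇒lookup m)
  ... | yes h | _ = h

  members : Subset n → List (Fin n)
  members U = filter (_∈ₛ? U) (allFin n)

  ∈─⁻ : ∀ {m} {U I : Subset m} {v} → v ∈ₛ U ─ I → v ∉ₛ I
  ∈─⁻ {U = inside ∷ U} {I = false ∷ I} {zero} _ ()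
  ∈─⁻ {U = _ ∷ U} {I = _ ∷ I} {suc v} (Vec.there m) (Vec.there k) = ∈─⁻ {U = U} m k

  recordListing-∈ : ∀ {S listed v} → v ∈ₛ S → recordListing Q S listed v ≡ suc (listed v)
  recordListing-∈ m rewrite []=⇒lookup m = refl

  recordListing-∉ : ∀ {S listed v} → v ∉ₛ S → recordListing Q S listed v ≡ listed v
  recordListing-∉ {S} {listed} {v} h with Vec.lookup S v in eq
  ... | true = ⊥-elim (h (lookup⇒[]= v S eq))
  ... | false = refl

  -- Painter paints greedily along the order, so whenever a vertex is listed but
  -- not painted one of its predecessors is.
  degenerate⇒paintable : ∀ {m} → Degenerate m → Paintable Q (suc m)
  degenerate⇒paintable {m} (ws , p , all) = go (length (members ⊤)) ⊤ (λ _ → 0) ≤-refl λ _ _ → z≤n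
    where
    done : Subset n → Fin n → List (Fin n)
    done U v = filter (λ x → ¬? (x ∈ₛ? U)) (predecessors ws v)

    -- The last hypothesis is the invariant: each listing of an unpainted vertex is charged to a
    -- different painted predecessor, and there are at most `m` of them. The fuel decreases since
    -- each reply paints some vertex.
    go : ∀ fuel U listed → length (members U) ≤ fuel → (∀ v → v ∈ₛ U → listed v ≤ length (done U v)) →
      PainterWins Q (suc m) U listed
    go fuel U listed size bounded = wins
      (λ v v∈U → s≤s (≤-trans (bounded v v∈U)
        (≤-trans (length-⊆ (Unique.filter⁺ _ (predecessors-unique ws v))
            λ k → proj₁ (∈-filter⁻ (λ x → ¬? (x ∈ₛ? U)) {xs = predecessors ws v} k))
          (predecessors-few p v))))
      λ S (s , s∈S) S⊆U → respond S s s∈S S⊆U fuel size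
      where
      respond : ∀ S s → s ∈ₛ S → S ⊆ₛ U → ∀ fuel → length (members U) ≤ fuel →
        Σ[ I ∈ Subset n ] (I ⊆ₛ S × Independent Q I × PainterWins Q (suc m) (U ─ I)
          (recordListing Q S listed))
      respond S s s∈S S⊆U fuel size = I , (λ k → r.listed (∈toSubset⁻ k)) ,
        (λ a b → r.independent (∈toSubset⁻ a) (∈toSubset⁻ b)) , continue fuel size
        where
        reply = proj₁ (greedy (Peeled-unique p) S [] (λ ()) (λ ()) (λ ()))
        module r = Reply reply
        I = toSubset r.painted
        some : ∃[ x ] x ∈ r.painted
        some = case r.dominating (all s) s∈S of λ { (inj₁ k) → s , k ; (inj₂ (u , k , _)) → u , k }
        smaller : suc (length (members (U ─ I))) ≤ length (members U)
        smaller = let x , x∈ = some in length-⊆ {xs = x ∷ members (U ─ I)}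
          (∉⇒Unique (λ k → ∈─⁻ {U = U} (proj₂ (∈-filter⁻ (_∈ₛ? (U ─ I)) {xs = allFin n} k)) (∈toSubset⁺ x∈))
            (Unique.filter⁺ _ (Unique.allFin⁺ n)))
          λ { (here refl) → ∈-filter⁺ (_∈ₛ? U) (∈-allFin x) (S⊆U (r.listed x∈))
            ; (there {xs = _} k) → let a , b = ∈-filter⁻ (_∈ₛ? (U ─ I)) {xs = allFin n} k in
                ∈-filter⁺ (_∈ₛ? U) a (p─q⊆p U I b) }
        bounded′ : ∀ v → v ∈ₛ U ─ I → recordListing Q S listed v ≤ length (done (U ─ I) v)
        bounded′ v v∈ with v ∈ₛ? S
        ... | no v∉S = ≤-trans (≤-reflexive (recordListing-∉ {S} {listed} v∉S))
          (≤-trans (bounded v (p─q⊆p U I v∈))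
            (length-filter-mono (λ x → ¬? (x ∈ₛ? U)) (λ x → ¬? (x ∈ₛ? (U ─ I)))
            (predecessors-unique ws v) λ _ h k → h (p─q⊆p U I k)))
        ... | yes v∈S with r.dominating (all v) v∈S
        ...   | inj₁ k = ⊥-elim (∈─⁻ {U = U} v∈ (∈toSubset⁺ k))
        ...   | inj₂ (u , u∈ , u∈pred) = ≤-trans (≤-reflexive (recordListing-∈ {S} {listed} v∈S))
          (≤-trans (s≤s (bounded v (p─q⊆p U I v∈))) (length-⊆ {xs = u ∷ done U v}
            (∉⇒Unique (λ k → proj₂ (∈-filter⁻ (λ x → ¬? (x ∈ₛ? U)) {xs = predecessors ws v} k)
              (S⊆U (r.listed u∈)))
              (Unique.filter⁺ _ (predecessors-unique ws v)))
            λ { (here refl) → ∈-filter⁺ (λ x → ¬? (x ∈ₛ? (U ─ I))) u∈pred λ k →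
              ∈─⁻ {U = U} k (∈toSubset⁺ u∈)
              ; (there k) → let a , b = ∈-filter⁻ (λ x → ¬? (x ∈ₛ? U)) {xs = predecessors ws v} k in
                  ∈-filter⁺ (λ x → ¬? (x ∈ₛ? (U ─ I))) a λ q → b (p─q⊆p U I q) }))
        continue : ∀ fuel → length (members U) ≤ fuel →
          PainterWins Q (suc m) (U ─ I) (recordListing Q S listed)
        continue zero size = ⊥-elim (<⇒≱ (≤-trans (s≤s z≤n) smaller) size)
        continue (suc fuel) size = go fuel (U ─ I) (recordListing Q S listed)
          (≤-pred (≤-trans smaller size)) bounded′

  -- Deciding paintability and choosability

  independent? : ∀ I → Dec (Independent Q I)
  independent? I = map′ (λ h {u} {v} → h u v) (λ h u v → h)
    (all? λ u → all? λ v → u ∈ₛ? I →-dec v ∈ₛ? I →-dec ¬? (u ~? v))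

  -- The termination measure of the game: a listed vertex either leaves U or loses one of its
  -- remaining listings, so every round lowers the sum.
  remaining : ℕ → Subset n → (Fin n → ℕ) → ℕ
  remaining k U listed = ∑[ members U ] λ v → k ∸ listed v

  remaining-decreases : ∀ {k U listed S I} → (∀ v → v ∈ₛ U → listed v < k) → Nonempty S → S ⊆ₛ U →
    remaining k (U ─ I) (recordListing Q S listed) < remaining k U listed
  remaining-decreases {k} {U} {listed} {S} {I} bound (s , s∈S) S⊆U = subst₂ _<_
    (sym (Σ-filter (_∈ₛ? (U ─ I)) (allFin n) _)) (sym (Σ-filter (_∈ₛ? U) (allFin n) _))
    (Σ-strict (allFin n) (∈-allFin s) (λ v → proj₁ (pointwise v)) (proj₂ (pointwise s) s∈S))
    where
    Σ-strict : ∀ (xs : List (Fin n)) {f g : Fin n → ℕ} {x} → x ∈ xs → (∀ v → f v ≤ g v) → f x < g x →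
      ∑[ xs ] f < ∑[ xs ] g
    Σ-strict (x ∷ xs) (here refl) h q = +-mono-<-≤ q (Σ-mono xs λ {v} _ → h v)
    Σ-strict (y ∷ xs) (there m) h q = +-mono-≤-< (h y) (Σ-strict xs m h q)
    new old : Fin n → ℕ
    new v = 𝟙 (v ∈ₛ? (U ─ I)) * (k ∸ recordListing Q S listed v)
    old v = 𝟙 (v ∈ₛ? U) * (k ∸ listed v)
    pointwise : ∀ v → new v ≤ old v × (v ∈ₛ S → new v < old v)
    pointwise v with v ∈ₛ? (U ─ I) | v ∈ₛ? U
    ... | no _ | no v∉U = z≤n , λ m → ⊥-elim (v∉U (S⊆U m))
    ... | no _ | yes v∈U = z≤n , λ _ → ≤-trans (m<n⇒0<n∸m (bound v v∈U)) (m≤m+n _ 0)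
    ... | yes h | no v∉U = ⊥-elim (v∉U (p─q⊆p U I h))
    ... | yes _ | yes v∈U with v ∈ₛ? S
    ...   | no v∉S rewrite recordListing-∉ {S} {listed} v∉S = ≤-refl , λ m → ⊥-elim (v∉S m)
    ...   | yes v∈S rewrite recordListing-∈ {S} {listed} v∈S =
      let lt = +-monoˡ-< 0 (∸-monoʳ-< {k} (n<1+n (listed v)) (bound v v∈U)) in <⇒≤ lt , λ _ → lt

  wins? : ∀ k fuel U listed → remaining k U listed < fuel → Dec (PainterWins Q k U listed)
  wins? k (suc fuel) U listed h with all? (λ v → v ∈ₛ? U →-dec listed v <? k)
  ... | no ¬bound = no λ { (wins b _) → ¬bound b }
  ... | yes bound = map′ (λ f → wins bound f) (λ { (wins _ f) → f })
    (search-all (λ {P} → anySubset?) reply?)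
    where
    Reply? : Subset n → Set
    Reply? S = Σ[ I ∈ Subset n ] (I ⊆ₛ S × Independent Q I × PainterWins Q k (U ─ I)
      (recordListing Q S listed))
    reply? : ∀ S → Dec (Nonempty S → S ⊆ₛ U → Reply? S)
    reply? S with nonempty? S | S ⊆? U
    ... | no ¬ne | _ = yes λ ne → ⊥-elim (¬ne ne)
    ... | yes _ | no ¬sub = yes λ _ sub → ⊥-elim (¬sub sub)
    ... | yes ne | yes sub = map′ (λ r _ _ → r) (λ f → f ne sub) (anySubset? λ I →
      I ⊆? S ×-dec independent? I ×-dec wins? k fuel (U ─ I) (recordListing Q S listed)
        (≤-trans (remaining-decreases {I = I} bound ne sub) (≤-pred h)))

  paintable? : ∀ k → Dec (Paintable Q k)
  paintable? k = wins? k _ ⊤ (λ _ → 0) ≤-refl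

  -- Only the pattern of coincidences among the n * j listed colours matters,
  -- so it suffices to consider colours below n * j.
  FinitelyChoosable : ℕ → Set
  FinitelyChoosable j = ∀ (L : Vec (Vec (Fin (n * j)) j) n) →
    (∀ v a b → Vec.lookup (Vec.lookup L v) a ≡ Vec.lookup (Vec.lookup L v) b → a ≡ b) →
    ∃[ c ] (∀ u v → u ~ v →
      Vec.lookup (Vec.lookup L u) (Vec.lookup {n = n} c u) ≢ Vec.lookup (Vec.lookup L v) (Vec.lookup c v))

  finitelyChoosable? : ∀ j → Dec (FinitelyChoosable j)
  finitelyChoosable? j = search-all (Vec-searchable (Vec-searchable Fin-searchable j) n) λ L →
    (all? λ v → all? λ a → all? λ b → (_ ≟ _) →-dec (a ≟ b)) →-dec
    Vec-searchable Fin-searchable n λ c → all? λ u → all? λ v → (u ~? v) →-dec ¬? (_ ≟ _)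

  choosable⇒finite : ∀ {j} → Choosable Q j → FinitelyChoosable j
  choosable⇒finite {j} f L inj = Vec.tabulate (λ v → proj₁ (choice v)) , λ u v u~v e →
    proper u~v (trans (proj₂ (choice u)) (trans (cong toℕ
      (trans (cong (Vec.lookup (Vec.lookup L u)) (sym (lookup∘tabulate (λ v → proj₁ (choice v)) u)))
        (trans e (cong (Vec.lookup (Vec.lookup L v)) (lookup∘tabulate (λ v → proj₁ (choice v)) v)))))
          (sym (proj₂ (choice v)))))
    where
    colours : Fin n → List ℕ
    colours v = tabulate λ a → toℕ (Vec.lookup (Vec.lookup L v) a)
    assignment : ListAssignment Q j
    assignment = record
      { list = colours
      ; unique = λ v → Unique.tabulate⁺ λ {a} {b} e → inj v a b (toℕ-injective e)
      ; size = λ v → length-tabulate (λ a → toℕ (Vec.lookup (Vec.lookup L v) a)) }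
    open Coloring (f assignment)
    choice : ∀ v → ∃[ a ] color v ≡ toℕ (Vec.lookup (Vec.lookup L v) a)
    choice v = ∈-tabulate⁻ (allowed v)

  finite⇒choosable : ∀ {j} → FinitelyChoosable j → Choosable Q j
  finite⇒choosable {j} f L = record
    { color = λ v → entry v (Vec.lookup c v)
    ; proper = λ {u} {v} u~v e → proj₂ found u v u~v
      (trans (L′-lookup u _) (trans (code-cong e) (sym (L′-lookup v _))))
    ; allowed = λ v → ∈-lookup (cast (sym (size v)) (Vec.lookup c v)) }
    where
    open ListAssignment L
    used : List ℕ
    used = concat (map list (allFin n))
    used-length : length used ≡ n * j
    used-length = trans (go (allFin n)) (cong (_* j) (length-tabulate {n = n} id))
      where
      go : ∀ vs → length (concat (map list vs)) ≡ length vs * j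
      go [] = refl
      go (v ∷ vs) = trans (length-++ (list v)) (cong₂ _+_ (size v) (go vs))
    entry : Fin n → Fin j → ℕ
    entry v a = lookup (list v) (cast (sym (size v)) a)
    entry∈ : ∀ v a → entry v a ∈ used
    entry∈ v a = ∈-concat⁺′ (∈-lookup (cast (sym (size v)) a)) (∈-map⁺ list (∈-allFin v))
    -- The position is read off the decided membership and not off the given proof, so a colour
    -- listed at several vertices has a single code.
    code : ∀ x → x ∈ used → Fin (n * j)
    code x x∈ with x ∈ᶜ? used
    ... | yes p = cast used-length (Any.index p)
    ... | no h = ⊥-elim (h x∈)
    code-cong : ∀ {x y} {x∈ : x ∈ used} {y∈ : y ∈ used} → x ≡ y → code x x∈ ≡ code y y∈
    code-cong {x} {x∈ = x∈} refl with x ∈ᶜ? used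
    ... | yes p = refl
    ... | no h = ⊥-elim (h x∈)
    code-injective : ∀ {x y} {x∈ : x ∈ used} {y∈ : y ∈ used} → code x x∈ ≡ code y y∈ → x ≡ y
    code-injective {x} {y} {x∈} {y∈} e with x ∈ᶜ? used | y ∈ᶜ? used
    ... | yes p | yes q = trans (lookup-index p)
      (trans (cong (lookup used) (cast-injective e)) (sym (lookup-index q)))
      where
      cast-injective : ∀ {a b} → cast used-length a ≡ cast used-length b → a ≡ b
      cast-injective {a} {b} e = toℕ-injective
        (trans (sym (toℕ-cast used-length a)) (trans (cong toℕ e) (toℕ-cast used-length b)))
    ... | no h | _ = ⊥-elim (h x∈)
    ... | _ | no h = ⊥-elim (h y∈)
    L′ : Vec (Vec (Fin (n * j)) j) n
    L′ = Vec.tabulate λ v → Vec.tabulate λ a → code (entry v a) (entry∈ v a)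
    L′-lookup : ∀ v a → Vec.lookup (Vec.lookup L′ v) a ≡ code (entry v a) (entry∈ v a)
    L′-lookup v a = trans (cong (λ r → Vec.lookup r a) (lookup∘tabulate _ v)) (lookup∘tabulate _ a)
    found = f L′ λ v a b e → toℕ-injective (trans (sym (toℕ-cast (sym (size v)) a)) (trans (cong toℕ
      (lookup-injective (unique v) _ _ (code-injective {x∈ = entry∈ v a} {y∈ = entry∈ v b}
        (trans (sym (L′-lookup v a)) (trans e (L′-lookup v b))))))
      (toℕ-cast (sym (size v)) b)))
    c = proj₁ found

  choosable? : ∀ j → Dec (Choosable Q j)
  choosable? j = map′ finite⇒choosable choosable⇒finite (finitelyChoosable? j)

-- From forbidden cycles to forbidden closed walks

module Cycles where
  open import Data.List using (lookup)
  open import Data.Fin.Patterns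
  open import Data.List.Extrema.Nat using (xs≤max)

  module _ {n : ℕ} (G : Graph n) where
    open Graph G

    private
      ~⇒≢ : ∀ {u v} → u ~ v → u ≢ v
      ~⇒≢ h e = ~-irrefl e h

    no-4-cycle : ¬ Cycle G 4 → C4-Free G
    no-4-cycle none {a} {b} {c} {d} ab bc cd da a≢c b≢d = none record
      { 3≤k = s≤s (s≤s (s≤s z≤n))
      ; vertex = lookup (a ∷ b ∷ c ∷ d ∷ [])
      ; injective = λ {i} {j} → lookup-injective
        ((~⇒≢ ab ∷ a≢c ∷ (~⇒≢ da ∘ sym) ∷ []) ∷ (~⇒≢ bc ∷ b≢d ∷ []) ∷ (~⇒≢ cd ∷ []) ∷ [] ∷ []) i j
      ; adjacent = adjacent }
      where
      adjacent : ∀ i j → toℕ j ≡ suc (toℕ i) % 4 →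
        lookup (a ∷ b ∷ c ∷ d ∷ []) i ~ lookup (a ∷ b ∷ c ∷ d ∷ []) j
      adjacent 0F j e with refl ← toℕ-injective {i = j} {j = 1F} e = ab
      adjacent 1F j e with refl ← toℕ-injective {i = j} {j = 2F} e = bc
      adjacent 2F j e with refl ← toℕ-injective {i = j} {j = 3F} e = cd
      adjacent 3F j e with refl ← toℕ-injective {i = j} {j = 0F} e = da

    no-5-cycle : ¬ Cycle G 5 → C5-Free G
    no-5-cycle none {a} {b} {c} {d} {e} ab bc cd de ea a≢c b≢d c≢e d≢a e≢b = none record
      { 3≤k = s≤s (s≤s (s≤s z≤n))
      ; vertex = lookup (a ∷ b ∷ c ∷ d ∷ e ∷ [])
      ; injective = λ {i} {j} → lookup-injective
          ((~⇒≢ ab ∷ a≢c ∷ (d≢a ∘ sym) ∷ (~⇒≢ ea ∘ sym) ∷ []) ∷ (~⇒≢ bc ∷ b≢d ∷ (e≢b ∘ sym) ∷ []) ∷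
           (~⇒≢ cd ∷ c≢e ∷ []) ∷ (~⇒≢ de ∷ []) ∷ [] ∷ []) i j
      ; adjacent = adjacent }
      where
      adjacent : ∀ i j → toℕ j ≡ suc (toℕ i) % 5 →
        lookup (a ∷ b ∷ c ∷ d ∷ e ∷ []) i ~ lookup (a ∷ b ∷ c ∷ d ∷ e ∷ []) j
      adjacent 0F j q with refl ← toℕ-injective {i = j} {j = 1F} q = ab
      adjacent 1F j q with refl ← toℕ-injective {i = j} {j = 2F} q = bc
      adjacent 2F j q with refl ← toℕ-injective {i = j} {j = 3F} q = cd
      adjacent 3F j q with refl ← toℕ-injective {i = j} {j = 4F} q = de
      adjacent 4F j q with refl ← toℕ-injective {i = j} {j = 0F} q = ea

  degree≤Δ : ∀ {n} (G : Graph n) v → degree G v ≤ Δ G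
  degree≤Δ {n} G v = All.lookup (xs≤max 0 (map (degree G) (allFin n))) (∈-map⁺ (degree G) (∈-allFin v))

-- Induction on the number of edges

module Reduction {n : ℕ} (k : ℕ) (32≤k : 32 ≤ k) where
  open Embeddings {n}
  open import Data.List.Membership.DecPropositional (_≟_ {n}) using (_∈?_)

  record Good (H : Graph n) : Set where
    field
      embedded : Embedded H
      degree≤k : ∀ v → degree H v ≤ k
      no-C4    : C4-Free H
      no-C5    : C5-Free H

  darts : Graph n → List V²
  darts H = filter (λ (u , v) → u ~? v) (cartesianProduct (allFin n) (allFin n))
    where open Graph H

  module Step (H : Graph n) (good : Good H) {ws : List (Fin n)}
    (peeled : Greedy.Peeled (square H) (k + 2) ws) where
    open Neighbourhoods H
    open Good good
    module Sq = Greedy (square H)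

    Reducible : Fin n → Fin n → Set
    Reducible u v = u ∈ ws × u ~ v × (∀ y → y ~ u → y ≢ v → y ~ v ⊎ v ∈ ws)

    reducible? : ∀ u v → Dec (Reducible u v)
    reducible? u v = u ∈? ws ×-dec u ~? v ×-dec
      all? λ y → y ~? u →-dec ¬? (y ≟ v) →-dec (y ~? v ⊎-dec v ∈? ws)

    module Reduce {u v : Fin n} (u∈ : u ∈ ws) (u~v : u ~ v)
      (covered : ∀ y → y ~ u → y ≢ v → y ~ v ⊎ v ∈ ws) where
      H′ : Graph n
      H′ = delete H u v

      good′ : Good H′
      good′ = record
        { embedded = Deletion.deletion H embedded u~v
        ; degree≤k = λ x → ≤-trans (length-filter-mono _ (x ~?_) (Unique.allFin⁺ n) λ _ → proj₁)
          (degree≤k x)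
        ; no-C4 = λ (a , _) (b , _) (c , _) (d , _) → no-C4 a b c d
        ; no-C5 = λ (a , _) (b , _) (c , _) (d , _) (e , _) → no-C5 a b c d e }

      fewer : length (darts H′) < length (darts H)
      fewer = length-⊆ {xs = (u , v) ∷ darts H′}
        (∉⇒Unique (λ m → proj₁ (proj₂ (proj₂
          (∈-filter⁻ _ {xs = cartesianProduct (allFin n) (allFin n)} m))) (refl , refl))
          (Unique.filter⁺ _ (Unique.cartesianProduct⁺ (Unique.allFin⁺ n) (Unique.allFin⁺ n))))
        λ { (here refl) → ∈-filter⁺ _ (∈-cartesianProduct⁺ (∈-allFin u) (∈-allFin v)) u~v
          ; (there m) → let a , b , _ = ∈-filter⁻ _ {xs = cartesianProduct (allFin n) (allFin n)} m in
              ∈-filter⁺ _ a b }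

      ≢u : ∀ {x} → x ∉ ws → x ≢ u
      ≢u x∉ refl = x∉ u∈

      -- Neither end is `u`, so a path of length two can use the deleted edge only with `u` in the
      -- middle and `v` as an end. Then `v` is outside `ws`, and `covered` makes the two ends
      -- adjacent, so they are not at distance two.
      square-kept : ∀ {x y} → x ∉ ws → y ∉ ws → Graph._~_ (square H) x y → Graph._~_ (square H′) x y
      square-kept x∉ y∉ (inj₁ x~y) = inj₁ (x~y , (λ (e , _) → ≢u x∉ e) , (λ (_ , e) → ≢u y∉ e))
      square-kept {x} {y} x∉ y∉ (inj₂ (x≢y , x≁y , w , x~w , w~y)) = inj₂ (x≢y , x≁y ∘ proj₁ , w ,
        (x~w , (λ (e , _) → ≢u x∉ e) , λ { (refl , refl) →
          clash x∉ y∉ (x≁y ∘ ~-sym) (x≢y ∘ sym) (~-sym w~y) }) ,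
        (w~y , (λ { (refl , refl) → clash y∉ x∉ x≁y x≢y x~w }) , (λ (_ , e) → ≢u y∉ e)))
        where
        clash : ∀ {y} → v ∉ ws → y ∉ ws → ¬ y ~ v → y ≢ v → y ~ u → ⊥
        clash v∉ _ y≁v y≢v y~u = case covered _ y~u y≢v of λ { (inj₁ h) → y≁v h ; (inj₂ h) → v∉ h }

      module Sq′ = Greedy (square H′)

      -- Here `ws` is removed first, by its own peeling in H. Any vertex removed later meets only
      -- neighbours outside `ws`; by `square-kept` these are neighbours in the square of `H′` as
      -- well, so the count made there still bounds them.
      add-peeled : ∀ {ws′} → Sq′.Peeled (k + 2) ws′ →
        Sq.Peeled (k + 2) (filter (λ x → ¬? (x ∈? ws)) ws′ ++ ws)
      add-peeled Greedy.stop = peeled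
      add-peeled {w ∷ ws′} (Greedy.peel p w∉ few) with w ∈? ws
      ... | yes _ = add-peeled p
      ... | no w∉ws = Greedy.peel (add-peeled p) fresh
        (≤-trans (length-⊆ (Unique.filter⁺ _ (Neighbourhoods.N-unique (square H) w)) still) few)
        where
        fresh : w ∉ filter (λ x → ¬? (x ∈? ws)) ws′ ++ ws
        fresh m = case ∈-++⁻ (filter (λ x → ¬? (x ∈? ws)) ws′) m of λ
          { (inj₁ a) → w∉ (proj₁ (∈-filter⁻ (λ x → ¬? (x ∈? ws)) {xs = ws′} a)) ; (inj₂ b) → w∉ws b }
        still : ∀ {x} → x ∈ Sq.outside (filter (λ x → ¬? (x ∈? ws)) ws′ ++ ws) w → x ∈ Sq′.outside ws′ w
        still {x} m = let w~x , x∉ = Sq.∈outside⁻ m ; x∉ws = x∉ ∘ ∈-++⁺ʳ (filter (λ x → ¬? (x ∈? ws)) ws′) in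
          Sq′.∈outside⁺ (square-kept w∉ws x∉ws w~x)
            λ x∈ → x∉ (∈-++⁺ˡ (∈-filter⁺ (λ x → ¬? (x ∈? ws)) x∈ x∉ws))

      reduce : Sq′.Degenerate (k + 2) → Sq.Degenerate (k + 2)
      reduce (ws′ , p , all) = _ , add-peeled p , λ v → here-or-there v (v ∈? ws)
        where
        here-or-there : ∀ v → Dec (v ∈ ws) → v ∈ filter (λ x → ¬? (x ∈? ws)) ws′ ++ ws
        here-or-there v (yes m) = ∈-++⁺ʳ _ m
        here-or-there v (no h) = ∈-++⁺ˡ (∈-filter⁺ (λ x → ¬? (x ∈? ws)) (all v) h)

    irreducible-complete : (∀ u v → ¬ Reducible u v) → (∀ v → v ∉ ws → k + 2 < length (Sq.outside ws v)) →
      ∀ v → v ∈ ws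
    irreducible-complete irr closed v with v ∈? ws
    ... | yes m = m
    -- Together `sparse` and `dense` give 24 ≤ 0. The vertex outside `ws` supplies the edge that
    -- `Sparsity` asks for, since its square neighbourhood is not empty.
    ... | no v∉ = ⊥-elim (<⇒≱ (s≤s (z≤n {23})) (+-cancelˡ-≤ (4 * D.total-degree) 24 0
        (≤-trans sparse′ (≤-trans (≤-reflexive (+-comm (12 * D.non-isolated) D.triangle-edges))
          (≤-trans D.dense (≤-reflexive (sym (+-identityʳ _))))))))
      where
      closed′ : ∀ v → v ∉ ws → k + 3 ≤ length (Sq.outside ws v)
      closed′ v v∉ = subst (_≤ length (Sq.outside ws v)) (sym (+-suc k 2)) (closed v v∉)
      irr′ : ∀ {u v} → u ∈ ws → u ~ v → (∀ y → y ~ u → y ≢ v → y ~ v ⊎ v ∈ ws) → ⊥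
      irr′ {u} {v} a b c = irr u v (a , b , c)
      module D = Discharging H k 32≤k degree≤k no-C4 (_∈ ws) (_∈? ws) closed′ irr′
      some-edge : ∃[ a ] ∃[ b ] a ~ b
      some-edge = go (Sq.outside ws v) Sq.∈outside⁻ (≤-trans (s≤s z≤n) (closed v v∉))
        where
        go : ∀ xs → (∀ {x} → x ∈ xs → Graph._~_ (square H) v x × x ∉ ws) → 1 ≤ length xs →
          ∃[ a ] ∃[ b ] a ~ b
        go (x ∷ _) f _ with proj₁ (f (here refl))
        ... | inj₁ v~x = v , x , v~x
        ... | inj₂ (_ , _ , w , v~w , _) = v , w , v~w
      sparse′ : 4 * D.total-degree + 24 ≤ 12 * D.non-isolated + D.triangle-edges
      sparse′ = Sparsity.sparse H embedded no-C4 no-C5 D.no-leaf D.two-next-to-≥3 (proj₂ (proj₂ some-edge))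

  degenerate : ∀ fuel H → length (darts H) ≤ fuel → Good H → Greedy.Degenerate (square H) (k + 2)
  degenerate fuel H size good with Greedy.peel-all (square H) (k + 2)
  ... | ws , peeled , closed with any? (λ u → any? (λ v → Step.reducible? H good peeled u v))
  ...   | no none = ws , peeled ,
    Step.irreducible-complete H good peeled (λ u v r → none (u , v , r)) closed
  degenerate zero H size good | ws , peeled , closed | yes (u , v , u∈ , u~v , c) =
    ⊥-elim (<⇒≱ (≤-trans (s≤s z≤n) (Step.Reduce.fewer H good peeled u∈ u~v c)) size)
  degenerate (suc fuel) H size good | ws , peeled , closed | yes (u , v , u∈ , u~v , c) =
    R.reduce (degenerate fuel R.H′ (≤-pred (≤-trans R.fewer size)) R.good′)
    where module R = Step.Reduce H good peeled u∈ u~v c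

-- One order of the square, with at most Δ + 2 earlier neighbours for each vertex, serves both
-- bounds. The exact minima are then found by a search that stops at Δ + 3 at the latest.
corollary1 : ∀ {n : ℕ} (G : Graph n) → Planar G → 32 ≤ Δ G →
    ¬ Cycle G 4 → ¬ Cycle G 5 →
    (∃[ k ] (IsListChromaticNumber (square G) k × k ≤ Δ G + 3)) ×
    (∃[ k ] (IsPaintNumber (square G) k × k ≤ Δ G + 3))
corollary1 {n} G plane 32≤Δ no4 no5 =
  least (Greedy.choosable? (square G))
    (at (Choosable (square G)) (Greedy.degenerate⇒choosable (square G) order)) ,
  least (Greedy.paintable? (square G))
    (at (Paintable (square G)) (Greedy.degenerate⇒paintable (square G) order))
  where
  open Decisions
  open Cycles
  order : Greedy.Degenerate (square G) (Δ G + 2)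
  order = Reduction.degenerate (Δ G) 32≤Δ _ G ≤-refl record
    { embedded = Initial.embedded G plane
    ; degree≤k = degree≤Δ G
    ; no-C4 = no-4-cycle G no4
    ; no-C5 = no-5-cycle G no5 }
  at : ∀ (P : ℕ → Set) → P (suc (Δ G + 2)) → P (Δ G + 3)
  at P = subst P (sym (+-suc (Δ G) 2))
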